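{- Let $\ell\ge 2$ and $0\le i<\ell$. Suppose that $\lambda\approx(\mu,r,\kappa)$ is an $\ell$-partition, and write $\varphi=\varphi_i(\lambda)$, $\varepsilon=\varepsilon_i(\lambda)$. Then 1. If $\varphi>1$, then $\widetilde f_i^{\,\varphi-1}\lambda$ is an $\ell$-partition if and only if: $\kappa_{r+1}=0$, the first row of $\lambda$ has a conormal $i$-box, and $\varphi=r+1$. 2. If $\varepsilon>1$, then $\widetilde e_i\lambda$ is an $\ell$-partition if and only if: the first row of $\lambda$ has a conormal $(i+1)$-box and either ($\varepsilon=r$ and $\kappa_r=0$) or ($\varepsilon=r+1$ and $\kappa_{r+1}=0$).
   Context: A partition is $\ell$-regular if it does not have $\ell$ or more equal nonzero parts. A removable $\ell$-rim hook (for short, $\ell$-rim hook) of $\lambda$ is a connected sequence of $\ell$ boxes of the Young diagram of $\lambda$, containing no $2\times2$ square, whose removal from $\lambda$ leaves the Young diagram of a partition. It is horizontal if all its boxes lie in one row, and non-horizontal otherwise. An $\ell$-core is a partition with no removable $\ell$-rim hook. An $\ell$-partition is an $\ell$-regular partition which has no non-horizontal $\ell$-rim hooks and such that, after removing any number of horizontal $\ell$-rim hooks in any order, the remaining diagram has no non-horizontal $\ell$-rim hooks. Decomposition. Partitions are extended by parts equal to $0$ when needed. Let $\mu$ be an $\ell$-core with $\mu_1-\mu_2\ne\ell-1$, $r\ge0$ an integer, $\kappa=(\kappa_1,\dots,\kappa_{r+1})$ a partition with at most $r+1$ parts. Let $\nu$ be the partition with $\nu_j=\mu_1+(r-j+1)(\ell-1)$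 for $1\le j\le r$ and $\nu_{r+i}=\mu_i$ for $i\ge1$. Then $\lambda\approx(\mu,r,\kappa)$ means $\lambda_i=\nu_i+\ell\kappa_i$ for $1\le i\le r+1$ and $\lambda_i=\nu_i$ for $i>r+1$. (Every $\ell$-partition has a unique such decomposition.) Crystal $B(\Lambda_0)$ of $\widehat{\mathfrak{sl}_\ell}$ (nodes: the $\ell$-regular partitions). The position in row $a$, column $b$ has residue $b-a \bmod \ell$; residues are taken mod $\ell$. A box $x$ of $\lambda$ is a removable $i$-box if it has residue $i$ and $\lambda\setminus x$ is a partition; a position $y\notin\lambda$ is an addable $i$-box if it has residue $i$ and $\lambda\cup y$ is a partition. Put $-$ in each removable $i$-box and $+$ in each addable $i$-box. The $i$-signature of $\lambda$ is the word of $+$'s and $-$'s read from bottom left to top right; the reduced $i$-signature is obtained by repeatedly deleting adjacent pairs $-+$, giving a word $+\cdots+-\cdots-$. Boxes of the remaining $-$'s are the normal $i$-boxes and boxes (positions) of the remaining $+$'s are the conormal $i$-boxes; $\varepsilon_i(\lambda)$ and $\varphi_i(\lambda)$ are their respective numbers. The good $i$-box is the one of the leftmost remaining $-$; the cogood $i$-box is the one of the rightmost remaining $+$. $\widetilde e_i\lambda$ is $\lambda$ with its good $i$-box removed (or $0$ if there is none), and $\widetilde f_i\lambda$ is $\lambda$ with its cogood $i$-box added (or $0$ if there is none). -}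

module Defs where

open import Data.Empty using (⊥-elim)
open import Data.Fin.Base using (Fin)
open import Data.Integer.Base as ℤ using (+_)
import Data.Integer.Divisibility as ℤ
open import Data.List.Base as List
  using (List; []; _∷_; [_]; concatMap; downFrom; upTo; foldr; head; last; length; partitionSums)
open import Data.List.Membership.Propositional using (_∈_; _∉_)
open import Data.List.Relation.Unary.All using (All)
open import Data.List.Relation.Unary.Any using (Any)
open import Data.List.Relation.Unary.Linked using (Linked)
open import Data.List.Relation.Unary.Unique.Propositional using (Unique)
open import Data.Maybe.Base as Maybe using (Maybe; just; _>>=_)
open import Data.Nat.Base
open import Data.Nat.Divisibility using (_∣?_)
open import Data.Nat.Properties
open import Data.Product.Base using (Σ; ∃-syntax; _×_; _,_; proj₁; proj₂)
open import Data.Product.Properties using (,-injective)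
open import Data.Sum.Base using (_⊎_; inj₁; inj₂)
open import Function.Base using (_∘_)
open import Function.Bundles using (_⇔_; mk⇔; Equivalence)
open import Function.Definitions using (Injective)
open import Relation.Binary.Construct.Closure.ReflexiveTransitive using (Star)
open import Relation.Binary.PropositionalEquality
  using (_≡_; _≢_; refl; sym; trans)
open import Relation.Nullary using (¬_; Dec; yes; no)
open import Relation.Nullary.Decidable using (_×-dec_)

-- A partition is a weakly decreasing sequence of naturals that is eventually
-- zero.  Rows and columns are numbered from 0, so `part l a` is the (a+1)-st
-- part.  `bound` is any row from which on the parts vanish; it need not be the
-- number of nonzero parts, and no notion below depends on its choice.
record Partition : Set where
  field
    part       : ℕ → ℕ
    bound      : ℕ
    decreasing : ∀ a → part (suc a) ≤ part a
    vanishing  : ∀ a → bound ≤ a → part a ≡ 0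

open Partition public

-- (row , column)
Box : Set
Box = ℕ × ℕ

infix 4 _∈ᵈ_

_∈ᵈ_ : Box → Partition → Set
(a , b) ∈ᵈ l = b < part l a

Adjacent : Box → Box → Set
Adjacent (a , b) (a′ , b′) = ∣ a - a′ ∣ + ∣ b - b′ ∣ ≡ 1

-- `RimHook ℓ l h m`: the boxes h form a removable ℓ-rim hook of l, and removing
-- them leaves m.
record RimHook (ℓ : ℕ) (l : Partition) (h : List Box) (m : Partition) : Set where
  field
    size      : length h ≡ ℓ
    distinct  : Unique h
    inside    : All (_∈ᵈ l) h
    connected : Linked Adjacent h
    noSquare  : ∀ a b → ¬ ((a , b) ∈ h × (a , suc b) ∈ h ×
                           (suc a , b) ∈ h × (suc a , suc b) ∈ h)
    removal   : ∀ x → x ∈ᵈ m ⇔ (x ∈ᵈ l × x ∉ h)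

Horizontal : List Box → Set
Horizontal h = ∃[ a ] All (λ x → proj₁ x ≡ a) h

IsRegular : ℕ → Partition → Set
IsRegular ℓ l =
  ¬ (∃[ v ] 0 < v × Σ (Fin ℓ → ℕ) λ rows →
       Injective _≡_ _≡_ rows × (∀ k → part l (rows k) ≡ v))

IsCore : ℕ → Partition → Set
IsCore ℓ l = ∀ h m → ¬ RimHook ℓ l h m

NoNonHorizontalHook : ℕ → Partition → Set
NoNonHorizontalHook ℓ l = ∀ h m → RimHook ℓ l h m → Horizontal h

RemoveHorizontal : ℕ → Partition → Partition → Set
RemoveHorizontal ℓ l m = ∃[ h ] RimHook ℓ l h m × Horizontal h

-- `Star` allows zero removals, so the condition on l itself is included.
IsℓPartition : ℕ → Partition → Set
IsℓPartition ℓ l =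
  IsRegular ℓ l ×
  (∀ m → Star (RemoveHorizontal ℓ) l m → NoNonHorizontalHook ℓ m)

-- The parts of ν: in 1-based terms ν_j = μ₁ + (r-j+1)(ℓ-1) for j ≤ r and
-- ν_{r+i} = μ_i; row a below is j = a+1.
ν : ℕ → Partition → ℕ → ℕ → ℕ
ν ℓ μ r a with a <? r
... | yes _ = part μ 0 + (r ∸ a) * (ℓ ∸ 1)
... | no  _ = part μ (a ∸ r)

-- l ≈ (μ , r , κ), together with the conditions on the triple.
record Decomposition (ℓ : ℕ) (l μ : Partition) (r : ℕ) (κ : Partition) : Set where
  field
    core  : IsCore ℓ μ
    gap   : part μ 0 ∸ part μ 1 ≢ ℓ ∸ 1
    short : part κ (suc r) ≡ 0
    upper : ∀ a → a ≤ r → part l a ≡ ν ℓ μ r a + ℓ * part κ a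
    lower : ∀ a → r < a → part l a ≡ ν ℓ μ r a

-- b - a ≡ i (mod ℓ); i need not be reduced modulo ℓ.
HasResidue : ℕ → ℕ → Box → Set
HasResidue ℓ i (a , b) = + ℓ ℤ.∣ (+ b ℤ.- + a) ℤ.- + i

Removable : Partition → Box → Set
Removable l x = x ∈ᵈ l × ∃[ m ] (∀ y → y ∈ᵈ m ⇔ (y ∈ᵈ l × y ≢ x))

Addable : Partition → Box → Set
Addable l x = ¬ (x ∈ᵈ l) × ∃[ m ] (∀ y → y ∈ᵈ m ⇔ (y ∈ᵈ l ⊎ y ≡ x))

setRow : (l : Partition) (a v : ℕ) → part l (suc a) ≤ v →
         (∀ c → a ≡ suc c → v ≤ part l c) → Partition
setRow l a v below above = record
  { part       = new
  ; bound      = bound l ⊔ suc a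
  ; decreasing = dec
  ; vanishing  = van
  }
  where
  new : ℕ → ℕ
  new c with c ≟ a
  ... | yes _ = v
  ... | no  _ = part l c

  dec : ∀ c → new (suc c) ≤ new c
  dec c with suc c ≟ a | c ≟ a
  ... | yes p | yes q = ⊥-elim (1+n≢n (trans p (sym q)))
  ... | yes p | no  _ = above c (sym p)
  ... | no  _ | yes refl = below
  ... | no  _ | no  _ = decreasing l c

  van : ∀ c → bound l ⊔ suc a ≤ c → new c ≡ 0
  van c le with c ≟ a
  ... | yes refl = ⊥-elim (1+n≰n (m⊔n≤o⇒n≤o (bound l) (suc a) le))
  ... | no  _    = vanishing l c (m⊔n≤o⇒m≤o (bound l) (suc a) le)

removable? : ∀ l x → Dec (Removable l x)
removable? l (a , b) with part l a ≟ suc b | part l (suc a) ≤? b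
... | no p≢ | _ = no λ (x∈ , m , eq) →
  let x∉m = λ x∈m → proj₂ (Equivalence.to (eq (a , b)) x∈m) refl
      y∈m = Equivalence.from (eq (a , suc b))
              (≤∧≢⇒< x∈ (p≢ ∘ sym) , 1+n≢n ∘ proj₂ ∘ ,-injective)
  in x∉m (<-trans (n<1+n b) y∈m)
... | yes _ | no q≰ = no λ (x∈ , m , eq) →
  let x∉m = λ x∈m → proj₂ (Equivalence.to (eq (a , b)) x∈m) refl
      y∈m = Equivalence.from (eq (suc a , b))
              (≰⇒> q≰ , 1+n≢n ∘ proj₁ ∘ ,-injective)
  in x∉m (<-≤-trans y∈m (decreasing m a))
... | yes p | yes q = yes (≤-reflexive (sym p) , setRow l a b q above , eq)
  where
  above : ∀ c → a ≡ suc c → b ≤ part l c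
  above c refl = ≤-trans (n≤1+n b) (≤-trans (≤-reflexive (sym p)) (decreasing l c))

  eq : ∀ y → y ∈ᵈ setRow l a b q above ⇔ (y ∈ᵈ l × y ≢ (a , b))
  eq (c , d) with c ≟ a
  ... | yes refl = mk⇔
    (λ d<b → ≤-trans (m<n⇒m<1+n d<b) (≤-reflexive (sym p)) ,
             λ e → <⇒≢ d<b (proj₂ (,-injective e)))
    (λ (d< , ne) → ≤∧≢⇒< (≤-pred (≤-trans d< (≤-reflexive p))) λ { refl → ne refl })
  ... | no c≢a = mk⇔ (λ d< → d< , c≢a ∘ proj₁ ∘ ,-injective) proj₁

addable? : ∀ l x → Dec (Addable l x)
addable? l (a , b) with part l a ≟ b
... | no p≢ = no λ (x∉ , m , eq) →
  let x∈m = Equivalence.from (eq (a , b)) (inj₂ refl)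
      p<b = ≤∧≢⇒< (≮⇒≥ x∉) p≢
  in case (Equivalence.to (eq (a , part l a)) (<-trans p<b x∈m))
  where
  case : ¬ ((a , part l a) ∈ᵈ l ⊎ (a , part l a) ≡ (a , b))
  case (inj₁ lt) = <-irrefl refl lt
  case (inj₂ e)  = p≢ (proj₂ (,-injective e))
addable? l (zero , b) | yes p = yes ((<-irrefl (sym p)) , setRow l 0 (suc b) below (λ _ ()) , eq)
  where
  below : part l 1 ≤ suc b
  below = ≤-trans (decreasing l 0) (≤-trans (≤-reflexive p) (n≤1+n b))

  eq : ∀ y → y ∈ᵈ setRow l 0 (suc b) below (λ _ ()) ⇔ (y ∈ᵈ l ⊎ y ≡ (0 , b))
  eq (c , d) with c ≟ 0
  ... | no c≢0 = mk⇔ inj₁ λ { (inj₁ d<) → d< ; (inj₂ refl) → ⊥-elim (c≢0 refl) }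
  ... | yes refl with d ≟ b
  ...   | yes refl = mk⇔ (λ _ → inj₂ refl) (λ _ → n<1+n d)
  ...   | no d≢b = mk⇔
    (λ d<1+b → inj₁ (<-≤-trans (≤∧≢⇒< (≤-pred d<1+b) d≢b) (≤-reflexive (sym p))))
    λ { (inj₁ d<) → m<n⇒m<1+n (≤-trans d< (≤-reflexive p)) ; (inj₂ refl) → ⊥-elim (d≢b refl) }
addable? l (suc a , b) | yes p with b <? part l a
... | no b≮ = no λ (x∉ , m , eq) →
  let x∈m = Equivalence.from (eq (suc a , b)) (inj₂ refl)
  in case (Equivalence.to (eq (a , b)) (<-≤-trans x∈m (decreasing m a)))
  where
  case : ¬ ((a , b) ∈ᵈ l ⊎ (a , b) ≡ (suc a , b))
  case (inj₁ lt) = b≮ lt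
  case (inj₂ ())
... | yes b< = yes (<-irrefl (sym p) , setRow l (suc a) (suc b) below above , eq)
  where
  below : part l (suc (suc a)) ≤ suc b
  below = ≤-trans (decreasing l (suc a)) (≤-trans (≤-reflexive p) (n≤1+n b))

  above : ∀ c → suc a ≡ suc c → suc b ≤ part l c
  above c refl = b<

  eq : ∀ y → y ∈ᵈ setRow l (suc a) (suc b) below above ⇔ (y ∈ᵈ l ⊎ y ≡ (suc a , b))
  eq (c , d) with c ≟ suc a
  ... | no c≢ = mk⇔ inj₁ λ { (inj₁ d<) → d< ; (inj₂ refl) → ⊥-elim (c≢ refl) }
  ... | yes refl with d ≟ b
  ...   | yes refl = mk⇔ (λ _ → inj₂ refl) (λ _ → n<1+n d)
  ...   | no d≢b = mk⇔
    (λ d<1+b → inj₁ (<-≤-trans (≤∧≢⇒< (≤-pred d<1+b) d≢b) (≤-reflexive (sym p))))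
    λ { (inj₁ d<) → m<n⇒m<1+n (≤-trans d< (≤-reflexive p)) ; (inj₂ refl) → ⊥-elim (d≢b refl) }

module Crystal (ℓ i : ℕ) where

  hasResidue? : ∀ x → Dec (HasResidue ℓ i x)
  hasResidue? (a , b) = ℓ ∣? ℤ.∣ (+ b ℤ.- + a) ℤ.- + i ∣

  RemovableBox : Partition → Set
  RemovableBox l = ∃[ x ] HasResidue ℓ i x × Removable l x

  AddableBox : Partition → Set
  AddableBox l = ∃[ x ] HasResidue ℓ i x × Addable l x

  -- A letter of the signature, carrying its box: inj₁ is −, inj₂ is +.
  Sign : Partition → Set
  Sign l = RemovableBox l ⊎ AddableBox l

  signs : ∀ l → Box → List (Sign l)
  signs l x with hasResidue? x ×-dec removable? l x | hasResidue? x ×-dec addable? l x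
  ... | yes p | _     = [ inj₁ (x , p) ]
  ... | no  _ | yes q = [ inj₂ (x , q) ]
  ... | no  _ | no  _ = []

  -- All boxes of l and the first position to the right of each row (including
  -- one empty row below), row by row from the bottom, left to right in a row.
  readingOrder : Partition → List Box
  readingOrder l = concatMap (λ a → List.map (a ,_) (upTo (suc (part l a))))
                             (downFrom (suc (bound l)))

  signature : ∀ l → List (Sign l)
  signature l = concatMap (signs l) (readingOrder l)

  -- Prepend a letter to a reduced word, deleting a resulting pair −+.
  prepend : ∀ {l} → Sign l → List (Sign l) → List (Sign l)
  prepend (inj₁ _) (inj₂ _ ∷ w) = w
  prepend s        w            = s ∷ w

  reducedSignature : ∀ l → List (Sign l)
  reducedSignature l = foldr (prepend {l}) [] (signature l)

  normal : ∀ l → List (RemovableBox l)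
  normal l = proj₁ (partitionSums (reducedSignature l))

  conormal : ∀ l → List (AddableBox l)
  conormal l = proj₂ (partitionSums (reducedSignature l))

  ε : Partition → ℕ
  ε l = length (normal l)

  φ : Partition → ℕ
  φ l = length (conormal l)

  -- `nothing` is the zero of the crystal.
  ẽ : Partition → Maybe Partition
  ẽ l = Maybe.map (λ (_ , _ , _ , m , _) → m) (head (normal l))

  f̃ : Partition → Maybe Partition
  f̃ l = Maybe.map (λ (_ , _ , _ , m , _) → m) (last (conormal l))

  f̃^ : ℕ → Partition → Maybe Partition
  f̃^ zero    l = just l
  f̃^ (suc n) l = f̃^ n l >>= f̃

  FirstRowConormal : Partition → Set
  FirstRowConormal l = Any (λ y → proj₁ (proj₁ y) ≡ 0) (conormal l)

{-# OPTIONS --safe #-}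
-- Replace a partition by its beads, the integers part a - a.  Removing a rim
-- hook moves a bead from s + ℓ to an empty position s, horizontally if and only
-- if no bead is passed.  Hence the ℓ-partitions are the partitions such that the
-- beads to the right of any empty position x are either all congruent to x
-- modulo ℓ or all incongruent to x (the condition of James and Mathas).
-- Equivalently, the beads below some position g form an ℓ-core, and all beads
-- above g are congruent to g; the decomposition (μ , r , κ) displays such a g.
-- The condition forces the i-signature of an ℓ-partition to be reduced.  So the
-- power of f̃ moves every bead of runner i that can move except for the lowest
-- one, and ẽ moves the lowest bead of runner i + 1 that can move.  In the result
-- the beads left behind face the moved ones across an empty position, so the
-- condition of James and Mathas restricts the moving rows to the first r or
-- r + 1 rows.
module Submission where

open import Defs

-- The definition of an `ℓ`-partition quantifies over all sequences of removals, which makes it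
-- unusable on a concrete result of the crystal operators. `JM` depends on the set of beads alone:
-- slides preserve it, and a violation can be lowered until it is a non-horizontal hook. To prove
-- `JM` for a result, a position `g` as in `Good` is exhibited; to exploit it, one well-chosen gap
-- of the result is enough.
--
-- Everything is measured from `t = β μ 0 - + r`, the bead that row `r` (counted from 0) has when
-- its part of `κ` vanishes. After raising, `g` is `t + 1`. After lowering, `g` is `t` or `t + L`,
-- according to whether row `r` or row `r - 1` has moved; this is the origin of the two alternatives
-- in the second statement. The condition on `μ₁ - μ₂` keeps the first bead below row `r` off the
-- runner of `t`, and this bead rules out moving rows below `r` when the result is an `ℓ`-partition.
--
-- The partial powers of `f̃` cannot be assumed to satisfy `JM`, so absence of cancellation is
-- carried through the iteration as the separate invariant `Reduced`.

module Beads where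

  open import Data.Empty using (⊥; ⊥-elim)
  open import Data.Fin.Base as Fin using (Fin; fromℕ<)
  import Data.Fin.Properties as Fin
  open import Data.Integer.Base
    using (ℤ; +_; -[1+_]; 0ℤ; -_; _+_; _-_; _*_; _≤_; +≤+; nonNegative) renaming (∣_∣ to ∣_∣ᶻ)
  import Data.Integer.Divisibility.Signed as Signed
  import Data.Integer.Properties as ℤ
  open import Data.Integer.Tactic.RingSolver using (solve)
  open import Data.List.Base as List
    using (List; []; _∷_; map; length; iterate; lookup; foldr; downFrom; upTo; partitionSums)
  import Data.List.Membership.DecPropositional as DecMembership
  open import Data.List.Membership.Propositional using (_∈_; _∉_)
  open import Data.List.Membership.Propositional.Properties
    using (∈-map⁺; ∈-map⁻; ∈-lookup; ∈-concatMap⁺; ∈-upTo⁺; ∈-downFrom⁺; ∈-downFrom⁻)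
  open import Data.List.Properties using (length-map; length-iterate; length-downFrom)
  open import Data.List.Relation.Unary.All as All using (All; []; _∷_)
  import Data.List.Relation.Unary.All.Properties as All
  open import Data.List.Relation.Unary.AllPairs as AllPairs using (AllPairs; []; _∷_)
  import Data.List.Relation.Unary.AllPairs.Properties as AllPairs
  open import Data.List.Relation.Unary.Any as Any using (here; there)
  import Data.List.Relation.Unary.Any.Properties as Any
  open import Data.List.Relation.Unary.Linked as Linked using (Linked; []; [-]; _∷_)
  import Data.List.Relation.Unary.Linked.Properties as Linked
  open import Data.List.Relation.Unary.Unique.Propositional using (Unique)
  open import Data.Maybe.Base as Maybe using (Maybe; just; _>>=_)
  import Data.Maybe.Relation.Unary.Any as MaybeAny
  open import Data.Nat.Base as ℕ using (ℕ; zero; suc; z≤n; s≤s; ∣_-_∣; _∸_; _⊓_; _⊔_)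
  open import Data.Nat.Divisibility using (_∣_; _∣?_)
  import Data.Nat.Properties as ℕ
  open import Data.Product.Base using (∃-syntax; _×_; _,_; proj₁; proj₂)
  open import Data.Product.Properties using (≡-dec; ,-injective)
  open import Data.Sum.Base using (_⊎_; inj₁; inj₂)
  open import Data.Unit.Base using (⊤)
  open import Function.Base using (id; _∘_)
  open import Function.Bundles using (_⇔_; Equivalence; mk⇔)
  open import Function.Definitions using (Injective)
  open import Relation.Binary.Construct.Closure.ReflexiveTransitive as Star using (Star; _◅_)
  open import Relation.Binary.Definitions using (tri<; tri≈; tri>)
  open import Relation.Binary.PropositionalEquality
    using (_≡_; _≢_; refl; sym; trans; cong; cong₂; subst; subst₂)
  open import Relation.Nullary using (¬_; Dec; yes; no)
  import Relation.Nullary.Decidable as Dec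
  open import Relation.Nullary.Decidable using (_×-dec_)

  open DecMembership (≡-dec ℕ._≟_ ℕ._≟_) using (_∈?_)

  -- The ring solver elaborates its list of variables much faster with these
  -- names than with the overloaded constructors.
  infixr 5 _::_
  pattern end = List.[]
  pattern _::_ x xs = List._∷_ x xs

  -- Linear arithmetic over the integers.

  infixl 4 _⊕_

  _⊕_ : ∀ {a b c d} → a ≤ b → c ≤ d → a + c ≤ b + d
  _⊕_ = ℤ.+-mono-≤

  eq : ∀ {a b} → a ≡ b → a ≤ b
  eq = ℤ.≤-reflexive

  qe : ∀ {a b} → a ≡ b → b ≤ a
  qe e = ℤ.≤-reflexive (sym e)

  0≤ : ∀ n → 0ℤ ≤ + n
  0≤ n = +≤+ z≤n

  -- Linear arithmetic: add up the hypotheses with ⊕ and compare the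
  -- differences of both sides with the ring solver.
  lin : ∀ {a b x y} → x ≤ y → b - a ≡ y - x → a ≤ b
  lin h e = ℤ.0≤i-j⇒j≤i (subst (0ℤ ≤_) (sym e) (ℤ.i≤j⇒0≤j-i h))

  lin⊥ : ∀ {x y} n → x ≤ y → y - x ≡ -[1+ n ] → ⊥
  lin⊥ n h e with subst (0ℤ ≤_) e (ℤ.i≤j⇒0≤j-i h)
  ... | ()

  lin≡ : ∀ {a b x y} → x ≡ y → b - a ≡ y - x → a ≡ b
  lin≡ {a} {b} {x} refl e = sym (ℤ.i-j≡0⇒i≡j b a (trans e (ℤ.i≡j⇒i-j≡0 {x} refl)))

  infix 4 _≺_ _≤≺?_

  -- The strict order is written as a weak one, so that strict hypotheses enter the sums of `lin`
  -- directly and integrality is built in.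
  _≺_ : ℤ → ℤ → Set
  x ≺ y = + 1 + x ≤ y

  cmp : ∀ x y → x ≺ y ⊎ x ≡ y ⊎ y ≺ x
  cmp x y with ℤ.<-cmp x y
  ... | tri< x<y _ _ = inj₁ (ℤ.i<j⇒suc[i]≤j x<y)
  ... | tri≈ _ x≡y _ = inj₂ (inj₁ x≡y)
  ... | tri> _ _ y<x = inj₂ (inj₂ (ℤ.i<j⇒suc[i]≤j y<x))

  ≺⇒≱ : ∀ {x y} → x ≺ y → ¬ (y ≤ x)
  ≺⇒≱ {x} {y} p q = lin⊥ 0 (p ⊕ q) (solve (x :: y :: end))

  ≺⇒≤ : ∀ {x y} → x ≺ y → x ≤ y
  ≺⇒≤ {x} {y} p = lin (p ⊕ 0≤ 1) (solve (x :: y :: end))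

  ≺-irrefl : ∀ {x} → ¬ (x ≺ x)
  ≺-irrefl p = ≺⇒≱ p ℤ.≤-refl

  _≤≺?_ : ∀ x y → x ≤ y ⊎ y ≺ x
  x ≤≺? y with cmp x y
  ... | inj₁ p = inj₁ (lin (p ⊕ 0≤ 1) (solve (x :: y :: end)))
  ... | inj₂ (inj₁ p) = inj₁ (eq p)
  ... | inj₂ (inj₂ p) = inj₂ p

  ≤-difference : ∀ {x y} → x ≤ y → ∃[ n ] y ≡ x + + n
  ≤-difference {x} {y} p with y - x in e | ℤ.i≤j⇒0≤j-i p
  ... | + n | _ = n , move (+ n) e
    where
    move : ∀ d → y - x ≡ d → y ≡ x + d
    move d e = lin≡ e (solve (x :: y :: d :: end))

  -- Congruence, flush runners and the criterion of James and Mathas.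

  -- The modulus is a variable: the ring solver would not accept + ℓ as an atom.
  module Congruence (L : ℤ) (2≤L : + 2 ≤ L) where

    infix 4 _≈_ _≉_

    data _≈_ (x y : ℤ) : Set where
      by : ∀ k → x ≡ y + k * L → x ≈ y

    _≉_ : ℤ → ℤ → Set
    x ≉ y = ¬ (x ≈ y)

    ≈-refl : ∀ {x} → x ≈ x
    ≈-refl {x} = by 0ℤ (solve (x :: L :: end))

    ≈-sym : ∀ {x y} → x ≈ y → y ≈ x
    ≈-sym {x} {y} (by k e) = by (- k) (lin≡ (sym e) (solve (x :: y :: k :: L :: end)))

    ≈-trans : ∀ {x y z} → x ≈ y → y ≈ z → x ≈ z
    ≈-trans {x} {y} {z} (by k refl) (by m refl) = by (m + k) (solve (z :: k :: m :: L :: end))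

    ≈-reflexive : ∀ {x y} → x ≡ y → x ≈ y
    ≈-reflexive refl = ≈-refl

    ≈-+ : ∀ {x y} c → x ≈ y → x + c ≈ y + c
    ≈-+ {x} {y} c (by k refl) = by k (solve (y :: c :: k :: L :: end))

    ≈-cancel-+ : ∀ {x y} c → x + c ≈ y + c → x ≈ y
    ≈-cancel-+ {x} {y} c (by k e) = by k (lin≡ e (solve (x :: y :: c :: k :: L :: end)))

    -L≈ : ∀ x → x - L ≈ x
    -L≈ x = by -[1+ 0 ] (solve (x :: L :: end))

    +L≈ : ∀ x → x + L ≈ x
    +L≈ x = by (+ 1) (solve (x :: L :: end))

    L≤multiple : ∀ {k} → + 1 ≤ k → L ≤ k * L
    L≤multiple {k} p = subst (_≤ k * L) (ℤ.*-identityˡ L) (ℤ.*-monoʳ-≤-nonNeg L {{nonNegative (ℤ.≤-trans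
        (0≤ 2) 2≤L)}} p)

    multiple≤0 : ∀ {k} → k ≤ 0ℤ → k * L ≤ 0ℤ
    multiple≤0 {k} p = subst (k * L ≤_) (ℤ.*-zeroˡ L) (ℤ.*-monoʳ-≤-nonNeg L {{nonNegative (ℤ.≤-trans
        (0≤ 2) 2≤L)}} p)

    ≈-step : ∀ {x y} → x ≈ y → y ≺ x → y + L ≤ x
    ≈-step {x} {y} (by k e) p = go (k * L) e (L≤multiple (ℤ.i<j⇒suc[i]≤j (ℤ.≰⇒> k≰0)))
      where
      go : ∀ d → x ≡ y + d → L ≤ d → y + L ≤ x
      go d e q = lin (q ⊕ qe e) (solve (x :: y :: d :: L :: end))
      stop : ∀ d → x ≡ y + d → ¬ (d ≤ 0ℤ)
      stop d e q = lin⊥ 0 (q ⊕ eq e ⊕ p) (solve (x :: y :: d :: end))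
      k≰0 : ¬ (k ≤ 0ℤ)
      k≰0 q = stop (k * L) e (multiple≤0 q)

    ≉-suc : ∀ x → x + + 1 ≉ x
    ≉-suc x p = lin⊥ 0 (≈-step p (lin (ℤ.≤-refl {x}) (solve (x :: end))) ⊕ 2≤L) (solve (x :: L :: end))

    ≉-pred : ∀ x → x - + 1 ≉ x
    ≉-pred x p = ≉-suc (x - + 1) (≈-trans {y = x} (≈-reflexive (solve (x :: end))) (≈-sym p))

    -- The hook-length criterion of James and Mathas in terms of beads: B is the
    -- set of beads, and a position x ∉ B corresponds to a column, which meets
    -- the row of the bead y > x in a box of hook length y - x.
    JM : (ℤ → Set) → Set
    JM B = ∀ x y z → ¬ B x → B y → B z → x ≺ y → x ≺ z → y ≈ x → z ≈ x

    -- The abacus form of an `ℓ`-core: no runner has a gap below a bead.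
    Flush : (ℤ → Set) → Set
    Flush B = ∀ x → B x → B (x - L)

    -- Iterates `closed` downwards in steps of `L`. The bound `g` is inherited because positions
    -- only decrease; the fuel `n` bounds the distance left to `y`.
    flush-below : ∀ {B : ℤ → Set} {g} → (∀ x → B x → x ≺ g → B (x - L)) →
                  ∀ x y → y ≈ x → y ≤ x → x ≺ g → B x → B y
    flush-below {B} {g} closed x y y≈x y≤x x<g Bx with ≤-difference y≤x
    ... | n , e = go n x y≈x (subst (_≤ y + + n) (sym e) ℤ.≤-refl) x<g Bx y≤x
      where
      go : ∀ n x → y ≈ x → x ≤ y + + n → x ≺ g → B x → y ≤ x → B y
      go n x y≈x x≤y+n x<g Bx y≤x with cmp y x
      ... | inj₂ (inj₁ refl) = Bx
      ... | inj₂ (inj₂ x<y) = ⊥-elim (≺⇒≱ x<y y≤x)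
      go zero x y≈x x≤y+n x<g Bx y≤x | inj₁ y<x =
        ⊥-elim (≺⇒≱ y<x (subst (x ≤_) (ℤ.+-identityʳ y) x≤y+n))
      go (suc n) x y≈x x≤y+n x<g Bx y≤x | inj₁ y<x =
        go n (x - L) (≈-trans y≈x (≈-sym (-L≈ x))) (dec (+ n) x≤y+n)
           (lin (x<g ⊕ 2≤L ⊕ 0≤ 2) (solve (x :: g :: L :: end))) (closed x Bx x<g)
           (lin (≈-step (≈-sym y≈x) y<x) (solve (x :: y :: L :: end)))
        where
        dec : ∀ n → x ≤ y + (+ 1 + n) → x - L ≤ y + n
        dec n p = lin (p ⊕ 2≤L ⊕ 0≤ 1) (solve (x :: y :: n :: L :: end))

    -- An L-core below g, and beads on the runner of g only above it.
    record Good (B : ℤ → Set) (g : ℤ) : Set where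
      field
        gap   : ¬ B g
        floor : B (g - L)
        above : ∀ x → B x → g ≺ x → x ≈ g
        below : ∀ x → B x → x ≺ g → B (x - L)

    -- If `y` is below `g`, flushness fills `x`. If `y` is above `g`, then `x` is on the runner of
    -- `g`. It cannot be at or below `g - L`, where `floor` fills the runner, so it is at least `g`,
    -- and every bead beyond it is congruent to `g`.
    good⇒JM : ∀ {B : ℤ → Set} {g} → Good B g → JM B
    good⇒JM {B} {g} G x y z ¬Bx By Bz x<y x<z y≈x with cmp y g
    ... | inj₁ y<g = ⊥-elim (¬Bx (flush-below (Good.below G) y x (≈-sym y≈x) (≺⇒≤ x<y) y<g By))
    ... | inj₂ (inj₁ refl) = ⊥-elim (Good.gap G By)
    ... | inj₂ (inj₂ g<y) with x ≤≺? (g - L)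
    ...   | inj₁ x≤g-L = ⊥-elim (¬Bx (flush-below below (g - L) x (≈-trans x≈g (≈-sym (-L≈ g))) x≤g-L
                                        (lin (2≤L ⊕ 0≤ 1) (solve (g :: L :: end))) floor))
      where
      open Good G
      x≈g = ≈-trans (≈-sym y≈x) (above y By g<y)
    ...   | inj₂ g-L<x = ≈-trans (above z Bz (lin (≈⇒g≤x ⊕ x<z) (solve (x :: g :: z :: end)))) (≈-sym x≈g)
      where
      open Good G
      x≈g = ≈-trans (≈-sym y≈x) (above y By g<y)
      ≈⇒g≤x : g ≤ x
      ≈⇒g≤x = lin (≈-step (≈-trans x≈g (≈-sym (-L≈ g))) g-L<x) (solve (x :: g :: L :: end))

    record Slide (B B′ : ℤ → Set) (s : ℤ) : Set where
      field
        from : B (s + L)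
        gap  : ¬ B s
        to   : B′ s
        keep : ∀ x → B x → B′ x ⊎ x ≡ s + L
        back : ∀ x → B′ x → (B x × x ≢ s + L) ⊎ x ≡ s

    -- The new gap `s + L` inherits the condition from the old gap `s`, which had the congruent bead
    -- `s + L` above it. Any other gap was a gap before; there the moved bead is replaced by its old
    -- position, which is congruent and still above.
    slide-JM : ∀ {B B′ : ℤ → Set} {s} → Slide B B′ s → JM B → JM B′
    slide-JM {B} {B′} {s} S jm x y z ¬B′x B′y B′z x<y x<z y≈x with x ℤ.≟ s + L
    ... | yes refl = above z B′z x<z
      where
      open Slide S
      above : ∀ w → B′ w → s + L ≺ w → w ≈ s + L
      above w B′w p with back w B′w
      ... | inj₁ (Bw , _) = ≈-trans (jm s (s + L) w gap from Bw (lin (2≤L ⊕ 0≤ 1) (solve (s :: L :: end)))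
                              (lin (p ⊕ 2≤L ⊕ 0≤ 2) (solve (s :: w :: L :: end))) (+L≈ s)) (≈-sym (+L≈ s))
      ... | inj₂ refl = ⊥-elim (lin⊥ 2 (p ⊕ 2≤L) (solve (s :: L :: end)))
    ... | no x≢ with lift y B′y x<y | lift z B′z x<z
      where
      open Slide S
      lift : ∀ w → B′ w → x ≺ w → ∃[ v ] B v × x ≺ v × v ≈ w
      lift w B′w x<w with back w B′w
      ... | inj₁ (Bw , _) = w , Bw , x<w , ≈-refl
      ... | inj₂ refl = s + L , from , lin (x<w ⊕ 2≤L ⊕ 0≤ 2) (solve (x :: s :: L :: end)) , +L≈ s
    ... | y₁ , By₁ , x<y₁ , y₁≈y | z₁ , Bz₁ , x<z₁ , z₁≈z =
      ≈-trans (≈-sym z₁≈z) (jm x y₁ z₁ ¬Bx By₁ Bz₁ x<y₁ x<z₁ (≈-trans y₁≈y y≈x))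
      where
      ¬Bx : ¬ B x
      ¬Bx Bx with Slide.keep S x Bx
      ... | inj₁ B′x = ¬B′x B′x
      ... | inj₂ e = x≢ e

  ≤-≺-trans : ∀ {x y z} → x ≤ y → y ≺ z → x ≺ z
  ≤-≺-trans {x} {y} {z} p q = lin (p ⊕ q) (solve (x :: y :: z :: end))

  ≺-≤-trans : ∀ {x y z} → x ≺ y → y ≤ z → x ≺ z
  ≺-≤-trans = ℤ.≤-trans

  ≺-suc : ∀ {x y} → x ≤ y → x ≺ y + + 1
  ≺-suc {x} {y} p = lin p (solve (x :: y :: end))

  pred-≺ : ∀ x → x - + 1 ≺ x
  pred-≺ x = lin (ℤ.≤-refl {x}) (solve (x :: end))

  ≺⇒≤pred : ∀ {x y} → x ≺ y → x ≤ y - + 1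
  ≺⇒≤pred {x} {y} p = lin p (solve (x :: y :: end))

  -- Beads

  -- Unfolding β would prevent unification from solving for its arguments.
  opaque
    β : Partition → ℕ → ℤ
    β l a = + part l a - + a

    β-def : ∀ l a → β l a ≡ + part l a - + a
    β-def l a = refl

    β-suc : ∀ l a → β l (suc a) ≺ β l a
    β-suc l a = go (+ part l (suc a)) (+ part l a) (+ a) (+≤+ (decreasing l a))
      where
      go : ∀ p q a → p ≤ q → p - (+ 1 + a) ≺ q - a
      go p q a h = lin h (solve (p :: q :: a :: end))

  Bead : Partition → ℤ → Set
  Bead l x = ∃[ a ] β l a ≡ x

  content : Box → ℤ
  content (a , b) = + b - + a

  ≤-shift : ∀ {b c} a → b ℕ.≤ c → + b - + a ≤ + c - + a
  ≤-shift a p = ℤ.+-monoˡ-≤ (- (+ a)) (+≤+ p)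

  ≤-unshift : ∀ {b c} a → + b - + a ≤ + c - + a → b ℕ.≤ c
  ≤-unshift {b} {c} a p = ℤ.drop‿+≤+ (go (+ b) (+ c) (+ a) p)
    where
    go : ∀ b c a → b - a ≤ c - a → b ≤ c
    go b c a p = lin p (solve (a :: b :: c :: end))

  ≺-shift : ∀ {b c} a → b ℕ.< c → + b - + a ≺ + c - + a
  ≺-shift {b} {c} a p = go (+ b) (+ c) (+ a) (+≤+ p)
    where
    go : ∀ b c a → + 1 + b ≤ c → b - a ≺ c - a
    go b c a p = lin p (solve (a :: b :: c :: end))

  ≺-unshift : ∀ {b c} a → + b - + a ≺ + c - + a → b ℕ.< c
  ≺-unshift {b} {c} a p = ℤ.drop‿+≤+ (go (+ b) (+ c) (+ a) p)
    where
    go : ∀ b c a → b - a ≺ c - a → + 1 + b ≤ c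
    go b c a p = lin p (solve (a :: b :: c :: end))

  β-antitone : ∀ l {a c} → a ℕ.≤ c → β l c ≤ β l a
  β-antitone l a≤c with ℕ.≤⇒≤′ a≤c
  ... | ℕ.≤′-refl = ℤ.≤-refl
  ... | ℕ.≤′-step {c} p = ℤ.≤-trans (≺⇒≤ (β-suc l c)) (β-antitone l (ℕ.≤′⇒≤ p))

  β-strict : ∀ l {a c} → a ℕ.< c → β l c ≺ β l a
  β-strict l {a} a<c = ≤-≺-trans (β-antitone l a<c) (β-suc l a)

  β-cancel-≺ : ∀ l {a c} → β l c ≺ β l a → a ℕ.< c
  β-cancel-≺ l {a} {c} p with a ℕ.<? c
  ... | yes a<c = a<c
  ... | no a≮c = ⊥-elim (≺⇒≱ p (β-antitone l (ℕ.≮⇒≥ a≮c)))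

  β-cancel-≤ : ∀ l {a c} → β l c ≤ β l a → a ℕ.≤ c
  β-cancel-≤ l {a} {c} p with a ℕ.≤? c
  ... | yes a≤c = a≤c
  ... | no a≰c = ⊥-elim (≺⇒≱ (β-strict l (ℕ.≰⇒> a≰c)) p)

  β-injective : ∀ l {a c} → β l a ≡ β l c → a ≡ c
  β-injective l e = ℕ.≤-antisym (β-cancel-≤ l (qe e)) (β-cancel-≤ l (eq e))

  locate : ∀ l x → x ≺ β l 0 → ∃[ j ] β l (suc j) ≤ x × x ≺ β l j
  locate l x p with ≤-difference (≺⇒≤ {x} p)
  ... | n , e = go n 0 p (eq e)
    where
    go : ∀ n j → x ≺ β l j → β l j ≤ x + + n → ∃[ j ] β l (suc j) ≤ x × x ≺ β l j
    go zero j p q = ⊥-elim (≺⇒≱ p (subst (β l j ≤_) (ℤ.+-identityʳ x) q))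
    go (suc n) j p q with β l (suc j) ≤≺? x
    ... | inj₁ r = j , r , p
    ... | inj₂ r = go n (suc j) r (drop (+ n) (β l (suc j)) (β l j) q (β-suc l j))
      where
      drop : ∀ n y z → z ≤ x + (+ 1 + n) → y ≺ z → y ≤ x + n
      drop n y z p q = lin (p ⊕ q) (solve (n :: x :: y :: z :: end))

  between⇒gap : ∀ l {x} j → β l (suc j) ≺ x → x ≺ β l j → ¬ Bead l x
  between⇒gap l j p q (c , refl) = ℕ.<⇒≱ (β-cancel-≺ l q) (ℕ.≤-pred (β-cancel-≺ l p))

  bead? : ∀ l x → Dec (Bead l x)
  bead? l x with cmp x (β l 0)
  ... | inj₂ (inj₁ e) = yes (0 , sym e)
  ... | inj₂ (inj₂ p) = no λ { (c , refl) → ≺⇒≱ p (β-antitone l z≤n) }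
  ... | inj₁ p with locate l x p
  ...   | j , q , r with cmp (β l (suc j)) x
  ...     | inj₁ q′ = no (between⇒gap l j q′ r)
  ...     | inj₂ (inj₁ e) = yes (suc j , e)
  ...     | inj₂ (inj₂ q′) = ⊥-elim (≺⇒≱ q′ q)

  -- Rim hooks

  data Neighbours (x y : ℤ) : Set where
    up   : y ≡ x + + 1 → Neighbours x y
    down : y ≡ x - + 1 → Neighbours x y

  data Run (d : ℤ) : ℤ → List ℤ → Set where
    []   : ∀ {x} → Run d x []
    _∷_ : ∀ {x y ys} → y ≡ x + d → Run d y ys → Run d x (y ∷ ys)

  -- A change of direction would revisit the element two places before, so the first step fixes the
  -- direction of the whole path.
  run-up : ∀ {x y ys} → y ≡ x + + 1 → Unique (x ∷ y ∷ ys) → Linked Neighbours (y ∷ ys) → Run (+ 1) y ys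
  run-up refl u [-] = []
  run-up {x} refl ((_ ∷ x≢z ∷ _) ∷ u) (down refl ∷ _) = ⊥-elim (x≢z (solve (x :: end)))
  run-up refl (_ ∷ u) (up refl ∷ p) = refl ∷ run-up refl u p

  run-down : ∀ {x y ys} → y ≡ x - + 1 → Unique (x ∷ y ∷ ys) → Linked Neighbours (y ∷ ys) → Run (- (+ 1)) y ys
  run-down refl u [-] = []
  run-down {x} refl ((_ ∷ x≢z ∷ _) ∷ u) (up refl ∷ _) = ⊥-elim (x≢z (solve (x :: end)))
  run-down refl (_ ∷ u) (down refl ∷ p) = refl ∷ run-down refl u p

  record Interval (xs : List ℤ) (s t : ℤ) : Set where
    field
      bounds : ∀ x → x ∈ xs → s ≤ x × x ≤ t
      bottom : s ∈ xs
      top    : t ∈ xs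

  run-up-interval : ∀ {x xs} → Run (+ 1) x xs → Interval (x ∷ xs) x (x + + length xs)
  run-up-interval {x} [] = record
    { bounds = λ { _ (here refl) → ℤ.≤-refl , qe (ℤ.+-identityʳ x) }
    ; bottom = here refl ; top = here (ℤ.+-identityʳ x) }
  run-up-interval {x} (_∷_ {ys = ys} refl r) = record
    { bounds = λ { _ (here refl) → ℤ.≤-refl , wide ; y (there p) → lower p , upper p }
    ; bottom = here refl ; top = there (subst (_∈ (x + + 1 ∷ ys)) shift (top I)) }
    where
    open Interval
    I = run-up-interval r
    shift : x + + 1 + + length ys ≡ x + + suc (length ys)
    shift = ℤ.+-assoc x (+ 1) (+ length ys)
    wide : x ≤ x + + suc (length ys)
    wide = ℤ.i≤i+j x (+ suc (length ys))
    lower : ∀ {y} → y ∈ (x + + 1 ∷ ys) → x ≤ y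
    lower p = ℤ.≤-trans (ℤ.i≤i+j x (+ 1)) (proj₁ (bounds I _ p))
    upper : ∀ {y} → y ∈ (x + + 1 ∷ ys) → y ≤ x + + suc (length ys)
    upper p = subst (_ ≤_) shift (proj₂ (bounds I _ p))

  run-down-interval : ∀ {x xs} → Run (- (+ 1)) x xs → Interval (x ∷ xs) (x - + length xs) x
  run-down-interval {x} [] = record
    { bounds = λ { _ (here refl) → eq (ℤ.+-identityʳ x) , ℤ.≤-refl }
    ; bottom = here (ℤ.+-identityʳ x) ; top = here refl }
  run-down-interval {x} (_∷_ {ys = ys} refl r) = record
    { bounds = λ { _ (here refl) → wide , ℤ.≤-refl ; y (there p) → lower p , upper p }
    ; bottom = there (subst (_∈ (x - + 1 ∷ ys)) (shift x (+ length ys)) (bottom I)) ; top = here refl }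
    where
    open Interval
    I = run-down-interval r
    shift : ∀ x n → x - + 1 - n ≡ x - (+ 1 + n)
    shift x n = solve (x :: n :: end)
    wide : x - + suc (length ys) ≤ x
    wide = ℤ.i-j≤i x (+ suc (length ys))
    lower : ∀ {y} → y ∈ (x - + 1 ∷ ys) → x - + suc (length ys) ≤ y
    lower p = subst (_≤ _) (shift x (+ length ys)) (proj₁ (bounds I _ p))
    upper : ∀ {y} → y ∈ (x - + 1 ∷ ys) → y ≤ x
    upper p = ℤ.≤-trans (proj₂ (bounds I _ p)) (ℤ.i-j≤i x (+ 1))

  -- For the contents along a rim hook. Which end the list starts from is unknown, and only the
  -- bounds and the two end points are kept, which is all that `Strip` asks for.
  path-interval : ∀ n xs → length xs ≡ suc n → Unique xs → Linked Neighbours xs →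
                  ∃[ s ] Interval xs s (s + + n)
  path-interval _ (x ∷ []) refl u p = x , run-up-interval []
  path-interval _ (x ∷ y ∷ ys) refl u (up e ∷ p) = x , run-up-interval (e ∷ run-up e u p)
  path-interval _ (x ∷ y ∷ ys) refl u (down e ∷ p) =
    _ , subst (Interval (x ∷ y ∷ ys) _) (shift x (+ length (y ∷ ys))) (run-down-interval (e ∷ run-down e u p))
    where
    shift : ∀ x n → x ≡ x - n + n
    shift x n = solve (x :: n :: end)

  private
    AllPairs-∈ : ∀ {A : Set} {R S : A → A → Set} {xs} →
                 (∀ {x y} → x ∈ xs → y ∈ xs → R x y → S x y) → AllPairs R xs → AllPairs S xs
    AllPairs-∈ f [] = []
    AllPairs-∈ f (ps ∷ pss) =
      All.tabulate (λ y∈ → f (here refl) (there y∈) (All.lookup ps y∈)) ∷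
      AllPairs-∈ (λ x∈ y∈ → f (there x∈) (there y∈)) pss

    distance-1 : ∀ b c → ∣ b - c ∣ ≡ 1 → c ≡ suc b ⊎ b ≡ suc c
    distance-1 zero    c       e = inj₁ e
    distance-1 (suc b) zero    e = inj₂ e
    distance-1 (suc b) (suc c) e with distance-1 b c e
    ... | inj₁ p = inj₁ (cong suc p)
    ... | inj₂ p = inj₂ (cong suc p)

    adjacent⇒neighbours : ∀ {x y} → Adjacent x y → Neighbours (content x) (content y)
    adjacent⇒neighbours {a , b} {a′ , b′} e with ∣ a - a′ ∣ in p | ∣ b - b′ ∣ in q
    adjacent⇒neighbours {a , b} {a′ , b′} refl | zero | .1 with ℕ.∣m-n∣≡0⇒m≡n {a} {a′} p | distance-1 b b′ q
    ... | refl | inj₁ refl = up (go (+ a) (+ b))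
      where
      go : ∀ a b → + 1 + b - a ≡ b - a + + 1
      go a b = solve (a :: b :: end)
    ... | refl | inj₂ refl = down (go (+ a) (+ b′))
      where
      go : ∀ a b → b - a ≡ + 1 + b - a - + 1
      go a b = solve (a :: b :: end)
    adjacent⇒neighbours {a , b} {a′ , b′} refl | suc zero | .0 with distance-1 a a′ p | ℕ.∣m-n∣≡0⇒m≡n {b} {b′} q
    ... | inj₁ refl | refl = down (go (+ a) (+ b))
      where
      go : ∀ a b → b - (+ 1 + a) ≡ b - a - + 1
      go a b = solve (a :: b :: end)
    ... | inj₂ refl | refl = up (go (+ a′) (+ b))
      where
      go : ∀ a b → b - a ≡ b - (+ 1 + a) + + 1
      go a b = solve (a :: b :: end)

  content≺β : ∀ l {a b} → b ℕ.< part l a → content (a , b) ≺ β l a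
  content≺β l {a} {b} p = subst (content (a , b) ≺_) (sym (β-def l a)) (≺-shift a p)

  content≺β⁻ : ∀ l {a b} → content (a , b) ≺ β l a → b ℕ.< part l a
  content≺β⁻ l {a} {b} p = ≺-unshift a (subst (content (a , b) ≺_) (β-def l a) p)

  β≤content : ∀ l {a b} → part l a ℕ.≤ b → β l a ≤ content (a , b)
  β≤content l {a} {b} p = subst (_≤ content (a , b)) (sym (β-def l a)) (≤-shift a p)

  β≤content⁻ : ∀ l {a b} → β l a ≤ content (a , b) → part l a ℕ.≤ b
  β≤content⁻ l {a} {b} p = ≤-unshift a (subst (_≤ content (a , b)) (β-def l a) p)

  column : ∀ l a x → β l a ≤ x → ∃[ b ] content (a , b) ≡ x
  column l a x p with ≤-difference p
  ... | n , refl = part l a ℕ.+ n , trans (go (+ part l a) (+ n) (+ a)) (cong (_+ + n) (sym (β-def l a)))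
    where
    go : ∀ p n a → p + n - a ≡ p - a + n
    go p n a = solve (p :: n :: a :: end)

  module Hooks (ℓ : ℕ) (2≤ℓ : 2 ℕ.≤ ℓ) (L : ℤ) (L≡ℓ : L ≡ + ℓ) where

    2≤L : + 2 ≤ L
    2≤L = subst (+ 2 ≤_) (sym L≡ℓ) (+≤+ 2≤ℓ)

    open Congruence L 2≤L public

    -- m arises from l by removing a strip whose boxes have the contents
    -- s, …, s + L - 1.
    record Strip (l m : Partition) (s : ℤ) : Set where
      In : ℕ → ℤ → Set
      In j x = β m j ≤ x × x ≺ β l j
      field
        shrink    : ∀ j → β m j ≤ β l j
        interlace : ∀ j → β l (suc j) ≤ β m j
        bounded   : ∀ j x → In j x → s ≤ x × x ≺ s + L
        start     : ∃[ c ] In c s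
        finish    : ∃[ a ] In a (s + L - + 1)

      s≺s+L : s ≺ s + L
      s≺s+L = lin (2≤L ⊕ 0≤ 1) (solve (s :: L :: end))

      β-start : ∀ c → In c s → β m c ≡ s
      β-start c (p , q) with cmp (β m c) s
      ... | inj₂ (inj₁ e) = e
      ... | inj₂ (inj₂ r) = ⊥-elim (≺⇒≱ r p)
      ... | inj₁ r = ⊥-elim (≺⇒≱ (pred-≺ s)
        (proj₁ (bounded c (s - + 1) (≺⇒≤pred {β m c} r , ≤-≺-trans (≺⇒≤ {s - + 1} (pred-≺ s)) q))))

      β≤finish : ∀ j → β m j ≤ s + L → β l j ≤ s + L
      β≤finish j p with β l j ≤≺? s + L
      ... | inj₁ q = q
      ... | inj₂ q = ⊥-elim (≺-irrefl {s + L} (proj₂ (bounded j (s + L) (p , q))))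

      β-finish : ∀ a → In a (s + L - + 1) → β l a ≡ s + L
      β-finish a (p , q) = ℤ.≤-antisym
        (β≤finish a (ℤ.≤-trans p (≺⇒≤ (pred-≺ (s + L)))))
        (≺-pred⁻ (s + L) (β l a) q)
        where
        ≺-pred⁻ : ∀ x y → x - + 1 ≺ y → x ≤ y
        ≺-pred⁻ x y p = lin p (solve (x :: y :: end))

      -- A row `j` of `l` with bead `s` lies below the row that loses content `s`. Its new bead is
      -- therefore less than `s`, and it loses content `s - 1`, which is outside the strip.
      gap : ¬ Bead l s
      gap (j , e) with start
      ... | c , i = ≺⇒≱ (pred-≺ s) (proj₁ (bounded j (s - + 1)
          (≺⇒≤pred {β m j} (≺-≤-trans {β m j} (β-strict m c<j) (eq (β-start c i))) , ≺-≤-trans {s - + 1}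
              (pred-≺ s) (qe e))))
        where
        c<j : c ℕ.< j
        c<j = β-cancel-≺ l (≤-≺-trans (eq e) (proj₂ i))

      bead : Bead l (s + L)
      bead with finish
      ... | a , i = a , β-finish a i

      -- The row that loses content `s` has a bead above `s` and at most `s + L`. If no bead is
      -- passed it is `s + L` itself, so this is also the row that loses content `s + L - 1`.
      -- Interlacing keeps all other rows out of the strip.
      one-row : (∀ x → s ≺ x → x ≺ s + L → ¬ Bead l x) → ∃[ a ] ∀ j x → In j x → j ≡ a
      one-row free with start | finish
      ... | c , i | a , k = a , unique
        where
        βa : β l a ≡ s + L
        βa = β-finish a k
        c≡a : c ≡ a
        c≡a with cmp (β l c) (s + L)
        ... | inj₁ p = ⊥-elim (free (β l c) (proj₂ i) p (c , refl))
        ... | inj₂ (inj₁ p) = β-injective l (trans p (sym βa))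
        ... | inj₂ (inj₂ p) = ⊥-elim (≺⇒≱ p (β≤finish c (ℤ.≤-trans (proj₁ i) (≺⇒≤ s≺s+L))))
        unique : ∀ j x → In j x → j ≡ a
        unique j x (p , q) with ℕ.<-cmp j a
        ... | tri≈ _ e _ = e
        ... | tri< j<a _ _ = ⊥-elim (≺⇒≱ (proj₂ (bounded j x (p , q)))
          (ℤ.≤-trans (qe βa) (ℤ.≤-trans (β-antitone l j<a) (ℤ.≤-trans (interlace j) p))))
        ... | tri> _ _ a<j = ⊥-elim (≺⇒≱ q (ℤ.≤-trans (β-antitone l a<j)
          (ℤ.≤-trans (interlace a) (ℤ.≤-trans (eq βm) (proj₁ (bounded j x (p , q)))))))
          where
          βm : β m a ≡ s
          βm = trans (cong (β m) (sym c≡a)) (β-start c i)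

      module OneRow (p : ℕ) (row : ∀ j x → In j x → j ≡ p) where

        from : β l p ≡ s + L
        from with finish
        ... | a , i = trans (cong (β l) (sym (row a _ i))) (β-finish a i)

        to : β m p ≡ s
        to with start
        ... | c , i = trans (cong (β m) (sym (row c _ i))) (β-start c i)

        other : ∀ j → j ≢ p → β m j ≡ β l j
        other j j≢p with cmp (β m j) (β l j)
        ... | inj₁ q = ⊥-elim (j≢p (row j (β m j) (ℤ.≤-refl , q)))
        ... | inj₂ (inj₁ e) = e
        ... | inj₂ (inj₂ q) = ⊥-elim (≺⇒≱ q (shrink j))

        slide : Slide (Bead l) (Bead m) s
        slide = record
          { from = p , from
          ; gap  = gap
          ; to   = p , to
          ; keep = keep
          ; back = back
          }
          where
          keep : ∀ x → Bead l x → Bead m x ⊎ x ≡ s + L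
          keep x (j , e) with j ℕ.≟ p
          ... | yes refl = inj₂ (trans (sym e) from)
          ... | no j≢p = inj₁ (j , trans (other j j≢p) e)
          back : ∀ x → Bead m x → (Bead l x × x ≢ s + L) ⊎ x ≡ s
          back x (j , e) with j ℕ.≟ p
          ... | yes refl = inj₂ (trans (sym e) to)
          ... | no j≢p = inj₁ ((j , trans (sym (other j j≢p)) e) ,
            λ x≡ → j≢p (β-injective l (trans (sym (other j j≢p)) (trans e (trans x≡ (sym from))))))

    module RimHookProperties {l m h} (R : RimHook ℓ l h m) where
      open RimHook R

      inside-outside : ∀ {j b} → (j , b) ∈ h → part m j ℕ.≤ b × b ℕ.< part l j
      inside-outside {j} {b} p =
        ℕ.≮⇒≥ (λ b<m → proj₂ (Equivalence.to (removal (j , b)) b<m) p) , All.lookup inside p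

      ∈-hook : ∀ {j b} → part m j ℕ.≤ b → b ℕ.< part l j → (j , b) ∈ h
      ∈-hook {j} {b} p q with (j , b) ∈? h
      ... | yes r = r
      ... | no r = ⊥-elim (ℕ.≤⇒≯ p (Equivalence.from (removal (j , b)) (q , r)))

      part-shrink : ∀ j → part m j ℕ.≤ part l j
      part-shrink j = ℕ.≮⇒≥ (λ p → ℕ.<-irrefl refl (proj₁ (Equivalence.to (removal (j , part l j)) p)))

      -- Otherwise rows `j` and `suc j` would both lose the columns `part m j` and `suc (part m j)`,
      -- a square of four boxes.
      part-interlace : ∀ j → part l (suc j) ℕ.≤ suc (part m j)
      part-interlace j = ℕ.≮⇒≥ λ p →
        let q = ℕ.<-≤-trans p (decreasing l j) ; r = decreasing m j in
        noSquare j (part m j)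
          ( ∈-hook ℕ.≤-refl (ℕ.<-trans (ℕ.n<1+n _) q) , ∈-hook (ℕ.n≤1+n _) q
          , ∈-hook r (ℕ.<-trans (ℕ.n<1+n _) p) , ∈-hook (ℕ.≤-trans r (ℕ.n≤1+n _)) p )

      interlace : ∀ j → β l (suc j) ≤ β m j
      interlace j = subst₂ _≤_ (sym (β-def l (suc j))) (sym (β-def m j))
                      (go (+ part l (suc j)) (+ part m j) (+ j) (+≤+ (part-interlace j)))
        where
        go : ∀ p q j → p ≤ + 1 + q → p - (+ 1 + j) ≤ q - j
        go p q j h = lin h (solve (p :: q :: j :: end))

      In : ℕ → ℤ → Set
      In j x = β m j ≤ x × x ≺ β l j

      hook⇒in : ∀ {j b} → (j , b) ∈ h → In j (content (j , b))
      hook⇒in p with inside-outside p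
      ... | q , r = β≤content m q , content≺β l r

      in⇒hook : ∀ {j x} → In j x → ∃[ b ] content (j , b) ≡ x × (j , b) ∈ h
      in⇒hook {j} {x} (p , q) with column m j x p
      ... | b , refl = b , refl , ∈-hook (β≤content⁻ m p) (content≺β⁻ l q)

      same-row : ∀ {i j x} → In i x → In j x → i ℕ.≤ j
      same-row {i} {j} (_ , p) (q , _) = ℕ.≮⇒≥ λ j<i →
        ≺⇒≱ p (ℤ.≤-trans (β-antitone l j<i) (ℤ.≤-trans (interlace j) q))

      -- By interlacing, the contents lost in a row exceed those lost further down, so the hook
      -- meets each diagonal at most once. Distinct boxes thus give the distinct contents that
      -- `path-interval` requires.
      content-injective : ∀ {x y} → x ∈ h → y ∈ h → content x ≡ content y → x ≡ y
      content-injective {a , b} {a′ , b′} p q e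
        with ℕ.≤-antisym (same-row (hook⇒in p) (subst (In a′) (sym e) (hook⇒in q)))
                         (same-row (subst (In a′) (sym e) (hook⇒in q)) (hook⇒in p))
      ... | refl = cong (a ,_) (ℕ.≤-antisym (≤-unshift a (eq e)) (≤-unshift a (qe e)))

      contents : ∃[ n ] ℓ ≡ suc n × ∃[ s ] Interval (map content h) s (s + + n)
      contents = ℕ.pred ℓ , ℓ≡ , path-interval (ℕ.pred ℓ) (map content h)
        (trans (length-map content h) (trans size ℓ≡))
        (AllPairs.map⁺ (AllPairs-∈ (λ x∈ y∈ x≢y → x≢y ∘ content-injective x∈ y∈) distinct))
        (Linked.map⁺ (Linked.map (λ {x} {y} → adjacent⇒neighbours {x} {y}) connected))
        where
        ℓ≡ : ℓ ≡ suc (ℕ.pred ℓ)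
        ℓ≡ = sym (ℕ.suc-pred ℓ {{ℕ.>-nonZero (ℕ.<-≤-trans ℕ.z<s 2≤ℓ)}})

      opaque
        strip : ∃[ s ] Strip l m s
        strip with contents
        ... | n , ℓ≡ , s , I = s , record
          { shrink    = λ j → subst₂ _≤_ (sym (β-def m j)) (sym (β-def l j)) (≤-shift j (part-shrink j))
          ; interlace = interlace
          ; bounded   = λ j x i → bounded′ i
          ; start     = in-row (Interval.bottom I)
          ; finish    = in-row (subst (_∈ map content h) (sym last) (Interval.top I))
          }
          where
          go : ∀ s n L → L ≡ + 1 + n → s + L - + 1 ≡ s + n
          go s n _ refl = solve (s :: n :: end)
          last : s + L - + 1 ≡ s + + n
          last = go s (+ n) L (trans L≡ℓ (cong +_ ℓ≡))
          in-row : ∀ {x} → x ∈ map content h → ∃[ j ] In j x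
          in-row p with ∈-map⁻ content p
          ... | (j , b) , q , refl = j , hook⇒in q
          close : ∀ x t → x ≤ t - + 1 → x ≺ t
          close x t p = lin p (solve (x :: t :: end))
          bounded′ : ∀ {j x} → In j x → s ≤ x × x ≺ s + L
          bounded′ {j} {x} i with in⇒hook {j} {x} i
          ... | b , refl , q with Interval.bounds I _ (∈-map⁺ content q)
          ...   | r , t = r , close x (s + L) (ℤ.≤-trans t (qe last))

      rows-horizontal : ∀ {a} → (∀ j x → In j x → j ≡ a) → Horizontal h
      rows-horizontal {a} f = a , All.tabulate λ p → f _ _ (hook⇒in p)

      horizontal-rows : ∀ {a} → All (λ x → proj₁ x ≡ a) h → ∀ j x → In j x → j ≡ a
      horizontal-rows H j x i with in⇒hook i
      ... | b , _ , p = All.lookup H p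

  <∸⇒+< : ∀ {b n} k → b ℕ.< n ∸ k → b ℕ.+ k ℕ.< n
  <∸⇒+< {b} {n} zero p = subst (ℕ._< n) (sym (ℕ.+-identityʳ b)) p
  <∸⇒+< {b} {suc n} (suc k) p = subst (ℕ._< suc n) (sym (ℕ.+-suc b k)) (s≤s (<∸⇒+< k p))

  part-antitone : ∀ l {a c} → a ℕ.≤ c → part l c ℕ.≤ part l a
  part-antitone l a≤c with ℕ.≤⇒≤′ a≤c
  ... | ℕ.≤′-refl = ℕ.≤-refl
  ... | ℕ.≤′-step {c} p = ℕ.≤-trans (decreasing l c) (part-antitone l (ℕ.≤′⇒≤ p))

  -- From an empty row on, row `j` has the bead `- j`, so these beads leave no gap.
  empty-row-bead : ∀ l {a x} → part l a ≡ 0 → x ≤ β l a → Bead l x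
  empty-row-bead l {a} {x} e p with ≤-difference p
  ... | n , q = a ℕ.+ n , trans (β-def l (a ℕ.+ n))
    (trans (cong (λ k → + k - + (a ℕ.+ n)) empty) (go (+ a) (+ n) x (trans (sym q) (trans (β-def l a) (cong
        (λ k → + k - + a) e)))))
    where
    empty : part l (a ℕ.+ n) ≡ 0
    empty = ℕ.n≤0⇒n≡0 (ℕ.≤-trans (part-antitone l (ℕ.m≤m+n a n)) (ℕ.≤-reflexive e))
    go : ∀ a n x → x + n ≡ 0ℤ - a → 0ℤ - (a + n) ≡ x
    go a n x e = sym (lin≡ e (solve (a :: n :: x :: end)))

  -- Construction of rim hooks

  Rim : Partition → Box → Set
  Rim l (j , b) = b ℕ.< part l j × part l (suc j) ℕ.≤ suc b

  -- One step along the rim towards the bottom left, lowering the content by 1. In column 0 the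
  -- predecessor is a dummy value; `next-rim` excludes that case.
  next : Partition → Box → Box
  next l (j , b) with part l (suc j) ℕ.≤? b
  ... | yes _ = j , ℕ.pred b
  ... | no  _ = suc j , b

  rim-β : ∀ l {j b} → Rim l (j , b) → β l (suc j) ≤ content (j , b) × content (j , b) ≺ β l j
  rim-β l {j} {b} (p , q) =
    subst (_≤ content (j , b)) (sym (β-def l (suc j))) (go (+ part l (suc j)) (+ b) (+ j) (+≤+ q)) , content≺β l p
    where
    go : ∀ p b j → p ≤ + 1 + b → p - (+ 1 + j) ≤ b - j
    go p b j h = lin h (solve (p :: b :: j :: end))

  rim-unique : ∀ l {x y} → Rim l x → Rim l y → content x ≡ content y → x ≡ y
  rim-unique l {i , b} {j , c} p q e with rim-β l p | rim-β l q
  ... | p₁ , p₂ | q₁ , q₂ with ℕ.≤-antisym (row (subst (_≺ β l j) (sym e) q₂) p₁) (row (subst (_≺ β l i) e p₂) q₁)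
    where
    row : ∀ {i j x} → x ≺ β l j → β l (suc i) ≤ x → j ℕ.≤ i
    row r s = ℕ.≤-pred (β-cancel-≺ l (≤-≺-trans s r))
  ... | refl = cong (i ,_) (ℕ.≤-antisym (≤-unshift i (eq e)) (≤-unshift i (qe e)))

  data Next (l : Partition) (x : Box) : Box → Set where
    nxt : ∀ {y} → Rim l y → content y ≡ content x - + 1 → Adjacent x y → Next l x y

  -- The gap `s` keeps the walk inside the diagram: at the bottom of the first column every smaller
  -- position is a bead, so no gap could lie below the content reached.
  next-rim : ∀ l s x → ¬ Bead l s → Rim l x → s ≺ content x → Next l x (next l x)
  next-rim l s (j , b) gap (p , q) s<x with part l (suc j) ℕ.≤? b
  next-rim l s (j , zero) gap (p , q) s<x | yes r = ⊥-elim (gap (empty-row-bead l (ℕ.n≤0⇒n≡0 r)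
    (subst (s ≤_) (sym (trans (β-def l (suc j)) (cong (λ k → + k - + suc j) (ℕ.n≤0⇒n≡0 r)))) (go (+ j) s<x))))
    where
    go : ∀ j → s ≺ 0ℤ - j → s ≤ 0ℤ - (+ 1 + j)
    go j p = lin p (solve (s :: j :: end))
  next-rim l s (j , suc b) gap (p , q) s<x | yes r =
    nxt (ℕ.<-trans (ℕ.n<1+n b) p , r) (go (+ b) (+ j)) (cong₂ ℕ._+_ (ℕ.∣n-n∣≡0 j) (distance b))
    where
    go : ∀ b j → b - j ≡ + 1 + b - j - + 1
    go b j = solve (b :: j :: end)
    distance : ∀ b → ∣ suc b - b ∣ ≡ 1
    distance zero = refl
    distance (suc b) = distance b
  next-rim l s (j , b) gap (p , q) s<x | no r =
    nxt (ℕ.≰⇒> r , ℕ.≤-trans (decreasing l (suc j)) q) (go (+ b) (+ j)) (cong₂ ℕ._+_ (distance j) (ℕ.∣n-n∣≡0 b))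
    where
    go : ∀ b j → b - (+ 1 + j) ≡ b - j - + 1
    go b j = solve (b :: j :: end)
    distance : ∀ j → ∣ j - suc j ∣ ≡ 1
    distance zero = refl
    distance (suc j) = distance j

  record Walk (l : Partition) (s : ℤ) (x : Box) (w : List Box) : Set where
    field
      linked   : Linked Adjacent w
      unique   : Unique w
      rim      : ∀ {y} → y ∈ w → Rim l y
      range    : ∀ {y} → y ∈ w → s ≤ content y × content y ≤ content x
      complete : ∀ {y} → Rim l y → s ≤ content y → content y ≤ content x → y ∈ w

  walk : ∀ l s n x → ¬ Bead l s → Rim l x → content x ≡ s + + n → Walk l s x (iterate (next l) x (suc n))
  walk l s zero x gap r e = record
    { linked   = [-]
    ; unique   = [] ∷ []
    ; rim      = λ { (here refl) → r }
    ; range    = λ { (here refl) → qe e′ , ℤ.≤-refl }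
    ; complete = λ r′ p q → here (rim-unique l r′ r (ℤ.≤-antisym q (ℤ.≤-trans (eq e′) p)))
    }
    where
    e′ : content x ≡ s
    e′ = trans e (ℤ.+-identityʳ s)
  walk l s (suc n) x gap r e with next-rim l s x gap r (close (content x) (+ n) e (0≤ n))
    where
    close : ∀ c n → c ≡ s + (+ 1 + n) → 0ℤ ≤ n → s ≺ c
    close c n e p = lin (qe e ⊕ p) (solve (s :: c :: n :: end))
  ... | nxt {y} r′ e′ adj = record
    { linked   = adj ∷ linked
    ; unique   = All.tabulate (λ y∈ x≡y → ≺-irrefl {content x}
                   (≤-≺-trans (subst (λ z → content z ≤ content y) (sym x≡y) (proj₂ (range y∈))) y≺x)) ∷ unique
    ; rim      = λ { (here refl) → r ; (there p) → rim p }
    ; range    = λ { (here refl) → s≤x , ℤ.≤-refl ; (there p) → proj₁ (range p) , ℤ.≤-trans (proj₂ (range p))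
        (≺⇒≤ {content y} y≺x) }
    ; complete = complete′
    }
    where
    go : ∀ c n → c ≡ s + (+ 1 + n) → c - + 1 ≡ s + n
    go c n e = lin≡ e (solve (s :: c :: n :: end))
    open Walk (walk l s n y gap r′ (trans e′ (go (content x) (+ n) e)))
    y≺x : content y ≺ content x
    y≺x = subst (_≺ content x) (sym e′) (pred-≺ (content x))
    s≤x : s ≤ content x
    s≤x = subst (s ≤_) (sym e) (ℤ.i≤i+j s (+ suc n))
    complete′ : ∀ {z} → Rim l z → s ≤ content z → content z ≤ content x → z ∈ x ∷ iterate (next l) y (suc n)
    complete′ {z} rz p q with cmp (content z) (content x)
    ... | inj₁ z≺x = there (complete rz p (subst (content z ≤_) (sym e′) (≺⇒≤pred {content z} z≺x)))
    ... | inj₂ (inj₁ e) = here (rim-unique l rz r e)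
    ... | inj₂ (inj₂ x≺z) = ⊥-elim (≺⇒≱ {content x} x≺z q)

  module RemoveHook (ℓ : ℕ) (l : Partition) (a : ℕ) (s : ℤ) (s+ℓ : s + + ℓ ≡ β l a) (gap : ¬ Bead l s) where

    -- In a hook that continues below row j, this row loses its rim, which leaves
    -- part l (suc j) - 1 boxes; the last row is left with the bead s.
    cut : ℕ → ℕ
    cut j = part l j ⊓ ((part l (suc j) ∸ 1) ⊔ ((part l a ℕ.+ (j ∸ a)) ∸ ℓ))

    new : ℕ → ℕ
    new j with a ℕ.≤? j
    ... | yes _ = cut j
    ... | no  _ = part l j

    new≤ : ∀ j → new j ℕ.≤ part l j
    new≤ j with a ℕ.≤? j
    ... | yes _ = ℕ.m⊓n≤m (part l j) _
    ... | no  _ = ℕ.≤-refl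

    -- The last entry in `cut` is the length, truncated at 0, for which row `j` would end with the
    -- bead `s`. These two implications translate its truncated subtraction into positions.
    balance : ∀ {x j} → a ℕ.≤ j → (x ℕ.+ ℓ ℕ.< part l a ℕ.+ (j ∸ a) → + x - + j ≺ s) ×
                                  (+ x - + j ≺ s → x ℕ.+ ℓ ℕ.< part l a ℕ.+ (j ∸ a))
    balance {x} {j} a≤j with ℕ.m≤n⇒∃[o]m+o≡n a≤j
    ... | d , refl rewrite ℕ.m+n∸m≡n a d =
      (λ p → to (+ x) (+ part l a) (+ a) (+ d) (+ ℓ) s (trans s+ℓ (β-def l a)) (+≤+ p)) ,
      (λ p → ℤ.drop‿+≤+ (from (+ x) (+ part l a) (+ a) (+ d) (+ ℓ) s (trans s+ℓ (β-def l a)) p))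
      where
      to : ∀ x p a d L s → s + L ≡ p - a → + 1 + (x + L) ≤ p + d → x - (a + d) ≺ s
      to x p a d L s e h = lin (h ⊕ qe e) (solve (x :: p :: a :: d :: L :: s :: end))
      from : ∀ x p a d L s → s + L ≡ p - a → x - (a + d) ≺ s → + 1 + (x + L) ≤ p + d
      from x p a d L s e h = lin (h ⊕ eq e) (solve (x :: p :: a :: d :: L :: s :: end))

    balance≥ : ∀ {x j} → a ℕ.≤ j → s ≤ + x - + j → part l a ℕ.+ (j ∸ a) ℕ.≤ x ℕ.+ ℓ
    balance≥ {x} {j} a≤j p = ℕ.≮⇒≥ λ q → ≺⇒≱ {+ x - + j} (proj₁ (balance a≤j) q) p

    -- The case distinction rests on `s` being a gap. If the bead of row `suc j` is below `s`, the
    -- whole row fits under the second entry of the maximum in row `j`. If it is above `s`, both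
    -- entries of the maximum in row `suc j` are at most `part l (suc j) ∸ 1`.
    below-cut : ∀ j → a ℕ.≤ j → cut (suc j) ℕ.≤ (part l (suc j) ∸ 1) ⊔ ((part l a ℕ.+ (j ∸ a)) ∸ ℓ)
    below-cut j a≤j with cmp (β l (suc j)) s
    ... | inj₂ (inj₁ e) = ⊥-elim (gap (suc j , e))
    ... | inj₁ p = ℕ.≤-trans (ℕ.m⊓n≤m (part l (suc j)) _) (ℕ.m≤n⇒m≤o⊔n (part l (suc j) ∸ 1) (ℕ.m+n≤o⇒m≤o∸n
          (part l (suc j)) {ℓ} (ℕ.≤-pred
        (subst (part l (suc j) ℕ.+ ℓ ℕ.<_) (trans (cong (part l a ℕ.+_) (ℕ.+-∸-assoc 1 a≤j)) (ℕ.+-suc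
            (part l a) (j ∸ a)))
          (proj₂ (balance (ℕ.m≤n⇒m≤1+n a≤j)) (subst (_≺ s) (β-def l (suc j)) p))))))
    ... | inj₂ (inj₂ p) = ℕ.≤-trans (ℕ.m⊓n≤n (part l (suc j)) _) (ℕ.m≤n⇒m≤n⊔o _ (ℕ.⊔-lub
        (ℕ.∸-monoˡ-≤ 1 (decreasing l (suc j)))
        (ℕ.m≤n+o⇒m∸n≤o _ ℓ (upper (part l (suc j)) (balance′ (part l (suc j)) refl p)))))
      where
      balance′ : ∀ x → part l (suc j) ≡ x → s ≺ β l (suc j) → part l a ℕ.+ (suc j ∸ a) ℕ.< x ℕ.+ ℓ
      balance′ zero e p = ⊥-elim (gap (empty-row-bead l e (≺⇒≤ {s} p)))
      balance′ (suc x) e p = s≤s (balance≥ {x} {suc j} (ℕ.m≤n⇒m≤1+n a≤j)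
        (go (+ x) (+ j) (subst (s ≺_) (trans (β-def l (suc j)) (cong (λ k → + k - + suc j) e)) p)))
        where
        go : ∀ x j → s ≺ + 1 + x - (+ 1 + j) → s ≤ x - (+ 1 + j)
        go x j p = lin p (solve (s :: x :: j :: end))
      upper : ∀ {n} x → n ℕ.< x ℕ.+ ℓ → n ℕ.≤ ℓ ℕ.+ (x ∸ 1)
      upper zero p = ℕ.≤-trans (ℕ.<⇒≤ p) (ℕ.m≤m+n ℓ 0)
      upper (suc x) (s≤s p) = ℕ.≤-trans p (ℕ.≤-reflexive (ℕ.+-comm x ℓ))

    removed : Partition
    removed = record
      { part       = new
      ; bound      = bound l
      ; decreasing = dec
      ; vanishing  = λ j p → ℕ.n≤0⇒n≡0 (ℕ.≤-trans (new≤ j) (ℕ.≤-reflexive (vanishing l j p)))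
      }
      where
      dec : ∀ j → new (suc j) ℕ.≤ new j
      dec j with a ℕ.≤? j
      ... | no  _ = ℕ.≤-trans (new≤ (suc j)) (decreasing l j)
      ... | yes p with a ℕ.≤? suc j
      ...   | no q = ⊥-elim (q (ℕ.m≤n⇒m≤1+n p))
      ...   | yes _ = ℕ.⊓-glb (ℕ.≤-trans (ℕ.m⊓n≤m (part l (suc j)) _) (decreasing l j)) (below-cut j p)

    corner : Rim l (a , ℕ.pred (part l a)) × content (a , ℕ.pred (part l a)) ≡ β l a - + 1 × ℓ ≢ 0
    corner with part l a in e
    ... | zero = ⊥-elim (gap (empty-row-bead l e (subst (s ≤_) s+ℓ (ℤ.i≤i+j s (+ ℓ)))))
    ... | suc p = (ℕ.≤-refl , ℕ.≤-trans (decreasing l a) (ℕ.≤-reflexive e)) ,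
        go (+ p) (+ a) (trans (β-def l a) (cong (λ k → + k - + a) e)) ,
        λ { refl → gap (a , trans (sym s+ℓ) (ℤ.+-identityʳ s)) }
      where
      go : ∀ p a {b} → b ≡ + 1 + p - a → p - a ≡ b - + 1
      go p a {b} e = lin≡ (sym e) (solve (p :: a :: b :: end))

    hook : List Box
    hook = iterate (next l) (a , ℕ.pred (part l a)) ℓ

    hook-walk : Walk l s (a , ℕ.pred (part l a)) hook
    hook-walk with corner
    ... | r , e , ℓ≢0 = subst (λ n → Walk l s (a , ℕ.pred (part l a)) (iterate (next l) (a , ℕ.pred
          (part l a)) n)) suc-pred
        (walk l s (ℕ.pred ℓ) (a , ℕ.pred (part l a)) gap r (trans e (go (+ ℕ.pred ℓ) (subst (λ n
            → s + + n ≡ β l a) (sym suc-pred) s+ℓ))))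
      where
      suc-pred : suc (ℕ.pred ℓ) ≡ ℓ
      suc-pred = ℕ.suc-pred ℓ {{ℕ.≢-nonZero ℓ≢0}}
      go : ∀ n {b} → s + (+ 1 + n) ≡ b → b - + 1 ≡ s + n
      go n {b} e = lin≡ (sym e) (solve (s :: n :: b :: end))

    corner∈hook : (a , ℕ.pred (part l a)) ∈ hook
    corner∈hook with corner
    ... | r , e , _ = Walk.complete hook-walk r (subst (s ≤_) (sym e) (≺⇒≤pred {s} s≺)) ℤ.≤-refl
      where
      s≺ : s ≺ β l a
      s≺ with cmp s (β l a)
      ... | inj₁ p = p
      ... | inj₂ (inj₁ p) = ⊥-elim (gap (a , sym p))
      ... | inj₂ (inj₂ p) = ⊥-elim (≺⇒≱ {β l a} p (subst (s ≤_) s+ℓ (ℤ.i≤i+j s (+ ℓ))))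

    removal : ∀ x → (x ∈ᵈ removed → x ∈ᵈ l × x ∉ hook) × (x ∈ᵈ l × x ∉ hook → x ∈ᵈ removed)
    removal (j , b) with a ℕ.≤? j
    ... | no a≰j = (λ b< → b< , outside) , proj₁
      where
      open Walk hook-walk
      outside : (j , b) ∉ hook
      outside p = ≺⇒≱ {content (j , b)} (≤-≺-trans (subst (content (j , b) ≤_) (proj₁ (proj₂ corner)) (proj₂
          (range p))) (pred-≺ (β l a)))
        (ℤ.≤-trans (β-antitone l (ℕ.≰⇒> a≰j)) (proj₁ (rim-β l (rim p))))
    ... | yes a≤j = to , from
      where
      open Walk hook-walk
      P = part l (suc j) ∸ 1
      Q = (part l a ℕ.+ (j ∸ a)) ∸ ℓ
      to : b ℕ.< cut j → b ℕ.< part l j × (j , b) ∉ hook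
      to b< = ℕ.<-≤-trans b< (ℕ.m⊓n≤m (part l j) (P ⊔ Q)) , outside
        where
        outside : (j , b) ∉ hook
        -- A box counted by `P` has a box diagonally below it, so it is not on the rim; a box
        -- counted by `Q` has content below `s`.
        outside p with ℕ.⊔-sel P Q
        ... | inj₁ e = ℕ.<⇒≱ (<∸⇒+< {b} 1 (ℕ.<-≤-trans b< (ℕ.≤-trans (ℕ.m⊓n≤n (part l j) (P ⊔ Q))
              (ℕ.≤-reflexive e))))
                         (ℕ.≤-trans (proj₂ (rim p)) (ℕ.≤-reflexive (ℕ.+-comm 1 b)))
        ... | inj₂ e = ≺⇒≱ {content (j , b)} (proj₁ (balance a≤j)
                         (<∸⇒+< {b} ℓ (ℕ.<-≤-trans b< (ℕ.≤-trans (ℕ.m⊓n≤n (part l j) (P ⊔ Q))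
                             (ℕ.≤-reflexive e))))) (proj₁ (range p))
      from : b ℕ.< part l j × (j , b) ∉ hook → b ℕ.< cut j
      from (b< , ∉) = ℕ.⊓-glb b< inside
        where
        inside : b ℕ.< P ⊔ Q
        inside with part l (suc j) ℕ.≤? suc b
        ... | no p = ℕ.m≤n⇒m≤n⊔o Q (ℕ.m+n≤o⇒m≤o∸n (suc b) (subst (ℕ._≤ part l (suc j)) (ℕ.+-comm 1 (suc b))
              (ℕ.≰⇒> p)))
        ... | yes p with s ≤≺? content (j , b)
        ...   | inj₂ q = ℕ.m≤n⇒m≤o⊔n P (ℕ.m+n≤o⇒m≤o∸n (suc b) (proj₂ (balance a≤j) q))
        ...   | inj₁ q = ⊥-elim (∉ (complete (b< , p) q (subst (content (j , b) ≤_) (sym (proj₁ (proj₂ corner)))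
                  (≺⇒≤pred {content (j , b)} (≺-≤-trans {content (j , b)} (content≺β l b<) (β-antitone l a≤j))))))

    rimHook : RimHook ℓ l hook removed
    rimHook = record
      { size      = length-iterate (next l) _ ℓ
      ; distinct  = unique
      ; inside    = All.tabulate (λ p → proj₁ (rim p))
      ; connected = linked
      -- Diagonal corners of a square have the same content, and a rim box is determined by its
      -- content.
      ; noSquare  = λ i b (p , _ , _ , q) → ℕ.1+n≢n (cong proj₁ (rim-unique l (rim q) (rim p) (go (+ i) (+ b))))
      ; removal   = λ x → mk⇔ (proj₁ (removal x)) (proj₂ (removal x))
      }
      where
      open Walk hook-walk
      go : ∀ i b → + 1 + b - (+ 1 + i) ≡ b - i
      go i b = solve (i :: b :: end)

  -- Equivalence of the `ℓ`-partition condition with the bead criterion.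

  module Characterisation (ℓ : ℕ) (2≤ℓ : 2 ℕ.≤ ℓ) (L : ℤ) (L≡ℓ : L ≡ + ℓ) where

    open Hooks ℓ 2≤ℓ L L≡ℓ public

    ∣⇒≈ : ∀ {x y} → ℓ ∣ ∣ x - y ∣ᶻ → x ≈ y
    ∣⇒≈ {x} {y} d with Signed.∣ᵤ⇒∣ {+ ℓ} {x - y} d
    ... | Signed.divides q e = by q (go (q * L) (trans e (cong (q *_) (sym L≡ℓ))))
      where
      go : ∀ d → x - y ≡ d → x ≡ y + d
      go d e = lin≡ e (solve (x :: y :: d :: end))

    ≈⇒∣ : ∀ {x y} → x ≈ y → ℓ ∣ ∣ x - y ∣ᶻ
    ≈⇒∣ {x} {y} (by k e) = Signed.∣⇒∣ᵤ {+ ℓ} {x - y} (Signed.divides k (trans (go (k * L) e) (cong (k *_) L≡ℓ)))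
      where
      go : ∀ d → x ≡ y + d → x - y ≡ d
      go d e = lin≡ e (solve (x :: y :: d :: end))

    infix 4 _≈?_
    _≈?_ : ∀ x y → Dec (x ≈ y)
    x ≈? y = Dec.map′ ∣⇒≈ ≈⇒∣ (ℓ ∣? ∣ x - y ∣ᶻ)

    -- The bead `s + L` forces all beads above the gap `s` onto its runner, which has no position
    -- strictly between. Hence every rim hook is horizontal.
    JM-free : ∀ {B : ℤ → Set} {s} → JM B → ¬ B s → B (s + L) → ∀ x → s ≺ x → x ≺ s + L → ¬ B x
    JM-free {s = s} jm gap from x s<x x<s+L Bx =
      ≺⇒≱ {x} x<s+L (≈-step (jm s (s + L) x gap from Bx (lin (2≤L ⊕ 0≤ 1) (solve (s :: L :: end))) s<x (+L≈ s)) s<x)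

    JM-hook : ∀ {l m h} → JM (Bead l) → RimHook ℓ l h m → Horizontal h × JM (Bead m)
    JM-hook {l} jm R = RimHookProperties.rows-horizontal R (proj₂ rows) , slide-JM (Strip.OneRow.slide S
        (proj₁ rows) (proj₂ rows)) jm
      where
      S = proj₂ (RimHookProperties.strip R)
      rows = Strip.one-row S (JM-free jm (Strip.gap S) (Strip.bead S))

    last-row : ∀ l {v} → 0 ℕ.< v → ∀ a → part l a ≡ v → ∃[ c ] part l c ≡ v × part l (suc c) ℕ.< v
    last-row l {v} 0<v a e = go (bound l) a (ℕ.m≤m+n (bound l) a) e
      where
      go : ∀ n a → bound l ℕ.≤ n ℕ.+ a → part l a ≡ v → ∃[ c ] part l c ≡ v × part l (suc c) ℕ.< v
      go zero a p e = ⊥-elim (ℕ.<⇒≢ 0<v (trans (sym (vanishing l a p)) e))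
      go (suc n) a p e with part l (suc a) ℕ.≟ v
      ... | yes e′ = go n (suc a) (subst (bound l ℕ.≤_) (sym (ℕ.+-suc n a)) p) e′
      ... | no ne = a , e , ℕ.≤∧≢⇒< (subst (part l (suc a) ℕ.≤_) e (decreasing l a)) ne

    -- Pigeonhole: otherwise `ℓ` distinct rows would fit among the `ℓ - 1` rows ending with `c`.
    spread : ∀ {c} (rows : Fin ℓ → ℕ) → Injective _≡_ _≡_ rows → (∀ k → rows k ℕ.≤ c)
        → ∃[ k ] rows k ℕ.+ ℓ ℕ.≤ suc c
    spread {c} rows injective rows≤c with Fin.any? (λ k → rows k ℕ.+ ℓ ℕ.≤? suc c)
    ... | yes found = found
    ... | no far = ⊥-elim (collision (Fin.pigeonhole pred<ℓ (λ k → fromℕ< (close k))))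
      where
      pred<ℓ : ℕ.pred ℓ ℕ.< ℓ
      pred<ℓ = ℕ.≤-reflexive (ℕ.suc-pred ℓ {{ℕ.>-nonZero (ℕ.<-≤-trans ℕ.z<s 2≤ℓ)}})
      close′ : ∀ {r} n → 2 ℕ.≤ n → suc c ℕ.< r ℕ.+ n → c ∸ r ℕ.< ℕ.pred n
      close′ {r} (suc (suc n)) _ p = ℕ.m<n+o⇒m∸n<o c r (ℕ.≤-pred (subst (suc c ℕ.<_) (ℕ.+-suc r (suc n)) p))
      close′ (suc zero) (s≤s ()) p
      close : ∀ k → c ∸ rows k ℕ.< ℕ.pred ℓ
      close k = close′ ℓ 2≤ℓ (ℕ.≰⇒> (λ p → far (k , p)))
      collision : ¬ (∃[ i ] ∃[ j ] i Fin.< j × fromℕ< (close i) ≡ fromℕ< (close j))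
      collision (i , j , i<j , e) = Fin.<⇒≢ i<j (injective
        (ℕ.∸-cancelˡ-≡ (rows≤c i) (rows≤c j) (Fin.fromℕ<-injective _ _ (close i) (close j) e)))

    -- ℓ equal parts are ℓ consecutive beads above a gap.
    JM⇒regular : ∀ l → JM (Bead l) → IsRegular ℓ l
    JM⇒regular l jm (v , 0<v , rows , injective , equal)
      with last-row l 0<v (rows (fromℕ< (ℕ.<-≤-trans ℕ.z<s 2≤ℓ))) (equal _)
    ... | c , ec , lt with spread rows injective (λ k → ℕ.≮⇒≥ λ c<r →
            ℕ.<⇒≱ lt (subst (ℕ._≤ part l (suc c)) (equal k) (part-antitone l c<r)))
    ...   | k , p = ≉-pred (β l c) (≈-sym (jm x y (β l c) gap (suc c ∸ ℓ , refl) (c , refl)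
              (≺-≤-trans {x} (pred-≺ (β l c)) (β-antitone l e≤c)) (pred-≺ (β l c)) y≈x))
      where
      x = β l c - + 1
      y = β l (suc c ∸ ℓ)
      e≤c : suc c ∸ ℓ ℕ.≤ c
      e≤c = ℕ.m≤n+o⇒m∸n≤o (suc c) ℓ (ℕ.+-monoˡ-≤ c (ℕ.<⇒≤ 2≤ℓ))
      ee : part l (suc c ∸ ℓ) ≡ v
      ee = ℕ.≤-antisym (subst (part l (suc c ∸ ℓ) ℕ.≤_) (equal k) (part-antitone l (ℕ.m+n≤o⇒m≤o∸n (rows k) p)))
                       (subst (ℕ._≤ part l (suc c ∸ ℓ)) ec (part-antitone l e≤c))
      gap : ¬ Bead l x
      gap = between⇒gap l c (subst₂ (λ p q → p ≺ q - + 1) (sym (β-def l (suc c))) (sym (β-def l c))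
              (go (+ part l (suc c)) (+ part l c) (+ c) (+≤+ (subst (part l (suc c) ℕ.<_) (sym ec) lt))))
                  (pred-≺ (β l c))
        where
        go : ∀ p q c → + 1 + p ≤ q → p - (+ 1 + c) ≺ q - c - + 1
        go p q c h = lin h (solve (p :: q :: c :: end))
      y≡ : y ≡ x + L
      y≡ = trans (β-def l (suc c ∸ ℓ)) (trans (cong (λ k → + k - + (suc c ∸ ℓ)) (trans ee (sym ec)))
             (go (+ part l c) (+ c) (+ (suc c ∸ ℓ)) (β-def l c)
               (subst (λ k → + (suc c ∸ ℓ) + k ≡ + suc c) (sym L≡ℓ) (cong +_ (ℕ.m∸n+n≡m (ℕ.≤-trans (ℕ.m≤n+m ℓ
                   (rows k)) p))))))
        where
        go : ∀ p c e {b} → b ≡ p - c → e + L ≡ + 1 + c → p - e ≡ b - + 1 + L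
        go p c e {b} h f = lin≡ (cong₂ _+_ (sym h) (sym f)) (solve (p :: c :: e :: b :: L :: end))
      y≈x : y ≈ x
      y≈x = ≈-trans (≈-reflexive y≡) (+L≈ x)
    JM⇒ℓPartition : ∀ l → JM (Bead l) → IsℓPartition ℓ l
    JM⇒ℓPartition l jm = JM⇒regular l jm , λ m steps h m′ R → proj₁ (JM-hook (reach jm steps) R)
      where
      reach : ∀ {l m} → JM (Bead l) → Star (RemoveHorizontal ℓ) l m → JM (Bead m)
      reach jm Star.ε = jm
      reach jm ((h , R , _) ◅ steps) = reach (proj₂ (JM-hook jm R)) steps

    Persistent : Partition → Set
    Persistent l = ∀ m → Star (RemoveHorizontal ℓ) l m → NoNonHorizontalHook ℓ m

    -L+L : ∀ y → y - L + L ≡ y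
    -L+L y = solve (y :: L :: end)

    -- The box in row `a` is recorded because it identifies the row of the hook once the hook is
    -- known to be horizontal.
    hook-exists : ∀ l a → ¬ Bead l (β l a - L) → ∃[ h ] ∃[ m ] RimHook ℓ l h m × ∃[ b ] (a , b) ∈ h
    hook-exists l a gap = H.hook , H.removed , H.rimHook , _ , H.corner∈hook
      where
      module H = RemoveHook ℓ l a (β l a - L) (subst (λ k → β l a - L + k ≡ β l a) L≡ℓ (-L+L (β l a))) gap

    horizontal-slide : ∀ {l m h p} → RimHook ℓ l h m → All (λ x → proj₁ x ≡ p) h →
                       β m p ≡ β l p - L × (∀ j → j ≢ p → β m j ≡ β l j) × Slide (Bead l) (Bead m) (β l p - L)
    horizontal-slide {l} {m} {h} {p} R H = trans to s≡ , other , subst (Slide (Bead l) (Bead m)) s≡ slide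
      where
      s = proj₁ (RimHookProperties.strip R)
      S = proj₂ (RimHookProperties.strip R)
      open Strip.OneRow S p (RimHookProperties.horizontal-rows R H)
      go : ∀ s y → y ≡ s + L → s ≡ y - L
      go s y e = lin≡ (sym e) (solve (s :: y :: L :: end))
      s≡ : s ≡ β l p - L
      s≡ = go s (β l p) from

    -- Persistence makes the hook horizontal, so only the bead of row `a` changes. The beads of `m`
    -- are still decreasing by rows, hence none was passed.
    slide-exists : ∀ {l} y → Persistent l → Bead l y → ¬ Bead l (y - L) →
                   ∃[ m ] Persistent m × Slide (Bead l) (Bead m) (y - L) × (∀ x → y - L ≺ x → x ≺ y → ¬ Bead l x)
    slide-exists {l} y P (a , refl) gap with hook-exists l a gap
    ... | h , m , R , b , a∈h with P l Star.ε h m R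
    ...   | p , H with All.lookup H a∈h
    ...     | refl with horizontal-slide R H
    ...       | to , other , slide = m , (λ m′ steps → P m′ ((h , R , p , H) ◅ steps)) , slide , free
      where
      free : ∀ x → β l a - L ≺ x → x ≺ β l a → ¬ Bead l x
      free _ q r (j , refl) with ℕ.<-cmp j a
      ... | tri≈ _ refl _ = ≺-irrefl {β l a} r
      ... | tri< j<a _ _ = ≺⇒≱ {β l j} r (≺⇒≤ {β l a} (β-strict l j<a))
      ... | tri> _ j≢a a<j = ≺⇒≱ {β l j} (subst₂ _≺_ (other j j≢a) to (β-strict m a<j)) (≺⇒≤ {β l a - L} q)

    core⇒flush : ∀ {l} → IsCore ℓ l → Flush (Bead l)
    core⇒flush {l} core y (a , refl) with bead? l (β l a - L)
    ... | yes p = p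
    ... | no gap with hook-exists l a gap
    ...   | h , m , R , _ = ⊥-elim (core h m R)

    -- If y ≈ x, z ≉ x are beads above the gap x, slide y and then z downwards:
    -- one of these hooks is not horizontal.
    no-witness : ∀ n {l} → Persistent l → ∀ x y z → ¬ Bead l x → Bead l y → Bead l z → x ≺ y → x ≺ z →
                 y ≈ x → z ≉ x → (y - x) + (z - x) ≤ + n → ⊥
    no-witness zero P x y z _ _ _ x<y x<z _ _ small = lin⊥ 1 (small ⊕ x<y ⊕ x<z) (solve (x :: y :: z :: end))
    no-witness (suc n) {l} P x y z ¬x By Bz x<y x<z y≈x z≉x small = lower-y (bead? l (y - L))
      where
      smaller-y : (y - L - x) + (z - x) ≤ + n
      smaller-y = go (+ n) small
        where
        go : ∀ n → (y - x) + (z - x) ≤ + 1 + n → (y - L - x) + (z - x) ≤ n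
        go n p = lin (p ⊕ 2≤L ⊕ 0≤ 1) (solve (x :: y :: z :: L :: n :: end))
      smaller-z : (y - x) + (z - L - x) ≤ + n
      smaller-z = go (+ n) smaller-y
        where
        go : ∀ n → (y - L - x) + (z - x) ≤ n → (y - x) + (z - L - x) ≤ n
        go n p = lin p (solve (x :: y :: z :: L :: n :: end))
      y-L≈x : y - L ≈ x
      y-L≈x = ≈-trans (-L≈ y) y≈x
      z-L≉x : z - L ≉ x
      z-L≉x p = z≉x (≈-trans (≈-sym (-L≈ z)) p)
      x≤y-L : x ≤ y - L
      x≤y-L = lin (≈-step y≈x x<y) (solve (x :: y :: L :: end))

      slide-y : x ≺ y - L → z ≢ y → ∃[ m ] Persistent m × Slide (Bead l) (Bead m) (y - L) × (∀ x → y - L ≺ x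
          → x ≺ y → ¬ Bead l x) → ⊥
      slide-y x<y-L z≢y (m , P′ , S , _) = no-witness n P′ x (y - L) z ¬x′ (Slide.to S) (z-stays
          (Slide.keep S z Bz)) x<y-L x<z y-L≈x z≉x smaller-y
        where
        ¬x′ : ¬ Bead m x
        ¬x′ Bx with Slide.back S x Bx
        ... | inj₁ (b , _) = ¬x b
        ... | inj₂ refl = ≺-irrefl {x} x<y-L
        z-stays : Bead m z ⊎ z ≡ y - L + L → Bead m z
        z-stays (inj₁ b) = b
        z-stays (inj₂ e) = ⊥-elim (z≢y (trans e (-L+L y)))

      slide-z : x ≺ z - L → y ≢ z → ∃[ m ] Persistent m × Slide (Bead l) (Bead m) (z - L) × (∀ x → z - L ≺ x
          → x ≺ z → ¬ Bead l x) → ⊥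
      slide-z x<z-L y≢z (m , P′ , S , _) = no-witness n P′ x y (z - L) ¬x′ (y-stays (Slide.keep S y By))
          (Slide.to S) x<y x<z-L y≈x z-L≉x smaller-z
        where
        ¬x′ : ¬ Bead m x
        ¬x′ Bx with Slide.back S x Bx
        ... | inj₁ (b , _) = ¬x b
        ... | inj₂ refl = ≺-irrefl {x} x<z-L
        y-stays : Bead m y ⊎ y ≡ z - L + L → Bead m y
        y-stays (inj₁ b) = b
        y-stays (inj₂ e) = ⊥-elim (y≢z (trans e (-L+L z)))

      -- Here `y` cannot move without filling `x`, so `z` is lowered instead; it remains above `x`
      -- because it starts above `y`.
      lower-z : x ≡ y - L → y ≺ z → Dec (Bead l (z - L)) → ⊥
      lower-z x≡ y<z d = decide d
        where
        x<z-L : x ≺ z - L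
        x<z-L = lin (eq x≡ ⊕ y<z) (solve (x :: y :: z :: L :: end))
        y≢z : y ≢ z
        y≢z refl = ≺-irrefl {y} y<z
        decide : Dec (Bead l (z - L)) → ⊥
        decide (yes b) = no-witness n P x y (z - L) ¬x By b x<y x<z-L y≈x z-L≉x smaller-z
        decide (no ¬b) = slide-z x<z-L y≢z (slide-exists z P Bz ¬b)

      lower-y : Dec (Bead l (y - L)) → ⊥
      lower-y (yes b) = no-witness n P x (y - L) z ¬x b Bz x<y-L x<z y-L≈x z≉x smaller-y
        where
        x<y-L : x ≺ y - L
        x<y-L with cmp x (y - L)
        ... | inj₁ p = p
        ... | inj₂ (inj₁ e) = ⊥-elim (¬x (subst (Bead l) (sym e) b))
        ... | inj₂ (inj₂ p) = ⊥-elim (≺⇒≱ {y - L} p x≤y-L)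
      lower-y (no ¬b) with slide-exists y P By ¬b | cmp y z | cmp x (y - L)
      ... | _ | inj₂ (inj₁ refl) | _ = z≉x y≈x
      ... | _ | inj₂ (inj₂ _) | inj₂ (inj₂ p) = ≺⇒≱ {y - L} p x≤y-L
      ... | _ | inj₁ _ | inj₂ (inj₂ p) = ≺⇒≱ {y - L} p x≤y-L
      ... | S | inj₁ y<z | inj₁ x<y-L = slide-y x<y-L (λ { refl → ≺-irrefl {y} y<z }) S
      ... | _ | inj₁ y<z | inj₂ (inj₁ e) = lower-z e y<z (bead? l (z - L))
      ... | S | inj₂ (inj₂ z<y) | inj₁ x<y-L = slide-y x<y-L (λ { refl → ≺-irrefl {y} z<y }) S
      -- Sliding `y` into `x` would pass `z`, which a horizontal hook cannot do.
      ... | _ , _ , _ , free | inj₂ (inj₂ z<y) | inj₂ (inj₁ refl) = free z x<z z<y Bz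

    persistent⇒JM : ∀ {l} → Persistent l → JM (Bead l)
    persistent⇒JM {l} P x y z ¬x By Bz x<y x<z y≈x with z ≈? x
    ... | yes p = p
    ... | no z≉x with ≤-difference (0≤sum x y z x<y x<z)
      where
      0≤sum : ∀ x y z → x ≺ y → x ≺ z → 0ℤ ≤ (y - x) + (z - x)
      0≤sum x y z p q = lin (p ⊕ q ⊕ 0≤ 2) (solve (x :: y :: z :: end))
    ...   | n , e = ⊥-elim (no-witness n P x y z ¬x By Bz x<y x<z y≈x z≉x (eq (trans e (ℤ.+-identityˡ (+ n)))))

  -- Lists without repetitions

  lookup-injective : ∀ {A : Set} {xs : List A} → Unique xs → ∀ i j → lookup xs i ≡ lookup xs j → i ≡ j
  lookup-injective (_ ∷ _) Fin.zero Fin.zero e = refl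
  lookup-injective (x∉ ∷ _) Fin.zero (Fin.suc j) e = ⊥-elim (All.lookup x∉ (∈-lookup j) e)
  lookup-injective (x∉ ∷ _) (Fin.suc i) Fin.zero e = ⊥-elim (All.lookup x∉ (∈-lookup i) (sym e))
  lookup-injective (_ ∷ u) (Fin.suc i) (Fin.suc j) e = cong Fin.suc (lookup-injective u i j e)

  ⊆-length : ∀ {A : Set} {xs ys : List A} → Unique xs → (∀ {x} → x ∈ xs → x ∈ ys) → length xs ℕ.≤ length ys
  ⊆-length {xs = xs} {ys} u sub = Fin.injective⇒≤ {f = position} λ {i} {j} e → lookup-injective u i j
    (trans (Any.lookup-index (sub (∈-lookup i))) (trans (cong (lookup ys) e) (sym (Any.lookup-index (sub
        (∈-lookup j))))))
    where
    position : Fin (length xs) → Fin (length ys)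
    position i = Any.index (sub (∈-lookup i))

  -- Ties the length of a list, and thereby `φ` and `ε`, to the set of rows that carry the sign.
  record Enumerates (P : ℕ → Set) (xs : List ℕ) : Set where
    field
      unique   : Unique xs
      sound    : ∀ {a} → a ∈ xs → P a
      complete : ∀ {a} → P a → a ∈ xs

  downFrom-unique : ∀ n → Unique (downFrom n)
  downFrom-unique n = AllPairs.applyDownFrom⁺₁ id n λ { j<i _ refl → ℕ.<-irrefl refl j<i }

  module _ {P : ℕ → Set} {xs : List ℕ} (E : Enumerates P xs) where
    open Enumerates E

    initial-length≤ : ∀ n → (∀ {a} → a ℕ.< n → P a) → n ℕ.≤ length xs
    initial-length≤ n p = subst (ℕ._≤ length xs) (length-downFrom n)
      (⊆-length (downFrom-unique n) (λ a∈ → complete (p (∈-downFrom⁻ a∈))))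

    length≤bound : ∀ n → (∀ {a} → P a → a ℕ.< n) → length xs ℕ.≤ n
    length≤bound n p = subst (length xs ℕ.≤_) (length-downFrom n) (⊆-length unique (λ a∈ → ∈-downFrom⁺ (p
        (sound a∈))))

    -- A further row would give `suc n` distinct members of `xs`. This turns the numerical
    -- conditions on `φ` and `ε` into the knowledge of which rows carry a sign.
    initial-bound : ∀ n → (∀ {a} → a ℕ.< n → P a) → length xs ℕ.≤ n → ∀ {a} → P a → a ℕ.< n
    initial-bound n p len {a} Pa with a ℕ.<? n
    ... | yes a<n = a<n
    ... | no a≮n = ⊥-elim (ℕ.<⇒≱ (subst (ℕ._≤ length xs) (cong suc (length-downFrom n))
        (⊆-length (All.tabulate (λ { b∈ refl → a≮n (∈-downFrom⁻ b∈) }) ∷ downFrom-unique n) sub)) len)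
      where
      sub : ∀ {b} → b ∈ a ∷ downFrom n → b ∈ xs
      sub (here refl) = complete Pa
      sub (there b∈) = complete (p (∈-downFrom⁻ b∈))

    singleton : length xs ≡ 1 → ∀ {a c} → P a → P c → a ≡ c
    singleton len {a} {c} Pa Pc with a ℕ.≟ c
    ... | yes e = e
    ... | no a≢c = ⊥-elim (ℕ.<⇒≱ (⊆-length {ys = xs} ((a≢c ∷ []) ∷ ([] ∷ [])) sub) (ℕ.≤-reflexive len))
      where
      sub : ∀ {b} → b ∈ a ∷ c ∷ [] → b ∈ xs
      sub (here refl) = complete Pa
      sub (there (here refl)) = complete Pc

  remove-length : ∀ {P Q : ℕ → Set} {xs ys a} → Enumerates P xs → Enumerates Q ys → P a →
                  (∀ c → Q c → P c × c ≢ a) → (∀ c → P c → c ≢ a → Q c) → length xs ≡ suc (length ys)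
  remove-length {xs = xs} {ys} {a} E F Pa to from = ℕ.≤-antisym
    (⊆-length {ys = a ∷ ys} (Enumerates.unique E) λ {c} c∈ → split c (Enumerates.sound E c∈))
    (⊆-length {xs = a ∷ ys} (All.tabulate (λ c∈ e → proj₂ (to _ (Enumerates.sound F c∈))
        (sym e)) ∷ Enumerates.unique F)
      λ { (here refl) → Enumerates.complete E Pa ; (there c∈) → Enumerates.complete E (proj₁ (to _
          (Enumerates.sound F c∈))) })
    where
    split : ∀ c → _ → c ∈ a ∷ ys
    split c Pc with c ℕ.≟ a
    ... | yes refl = here refl
    ... | no c≢a = there (Enumerates.complete F (from c Pc c≢a))

  last-min : ∀ {A : Set} (f : A → ℕ) xs → AllPairs (λ x y → f y ℕ.< f x) xs → 0 ℕ.< length xs →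
             ∃[ y ] List.last xs ≡ just y × y ∈ xs × (∀ {z} → z ∈ xs → f y ℕ.≤ f z)
  last-min f (x ∷ []) _ _ = x , refl , here refl , λ { (here refl) → ℕ.≤-refl }
  last-min f (x ∷ xs@(_ ∷ _)) (x> ∷ p) _ with last-min f xs p ℕ.z<s
  ... | y , e , y∈ , min = y , e , there y∈ , λ { (here refl) → ℕ.<⇒≤ (All.lookup x> y∈) ; (there z∈) → min z∈ }

  -- Adding and removing a box

  record Changed (l m : Partition) (a : ℕ) (d : ℤ) : Set where
    field
      at    : β m a ≡ β l a + d
      other : ∀ c → c ≢ a → β m c ≡ β l c

  <-extensional : ∀ {p q} → (∀ b → b ℕ.< p → b ℕ.< q) → p ℕ.≤ q
  <-extensional {zero} f = z≤n
  <-extensional {suc p} f = f p (ℕ.n<1+n p)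

  β-cong : ∀ l m {a} → part m a ≡ part l a → β m a ≡ β l a
  β-cong l m {a} e = trans (β-def m a) (trans (cong (λ k → + k - + a) e) (sym (β-def l a)))

  β-shape : ∀ l {a p} → part l a ≡ p → β l a ≡ + p - + a
  β-shape l {a} e = trans (β-def l a) (cong (λ k → + k - + a) e)

  module _ {l a b} (A : Addable l (a , b)) where
    private
      m = proj₁ (proj₂ A)
      iff = λ y → proj₂ (proj₂ A) y

    addable-part : part l a ≡ b
    addable-part with part l a ℕ.≟ b
    ... | yes e = e
    ... | no ne with Equivalence.to (iff (a , part l a)) (ℕ.<-trans (ℕ.≤∧≢⇒< (ℕ.≮⇒≥ (proj₁ A)) ne)
          (Equivalence.from (iff (a , b)) (inj₂ refl)))
    ...   | inj₁ p = ⊥-elim (ℕ.<-irrefl refl p)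
    ...   | inj₂ p = ⊥-elim (ne (proj₂ (,-injective p)))

    addable-above : ∀ c → a ≡ suc c → b ℕ.< part l c
    addable-above c refl with Equivalence.to (iff (c , b)) (ℕ.<-≤-trans (Equivalence.from (iff (a , b))
        (inj₂ refl)) (decreasing m c))
    ... | inj₁ p = p
    ... | inj₂ p = ⊥-elim (ℕ.1+n≢n (sym (proj₁ (,-injective p))))

    added : Changed l m a (+ 1)
    added = record
      { at = trans (β-shape m new) (trans (go (+ b) (+ a)) (cong (_+ + 1) (sym (β-shape l addable-part))))
      ; other = λ c c≢a → β-cong l m (ℕ.≤-antisym
          (<-extensional λ d p → to c c≢a d (Equivalence.to (iff (c , d)) p))
          (<-extensional λ d p → Equivalence.from (iff (c , d)) (inj₁ p)))
      }
      where
      go : ∀ b a → + 1 + b - a ≡ b - a + + 1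
      go b a = solve (b :: a :: end)
      to : ∀ c → c ≢ a → ∀ d → (c , d) ∈ᵈ l ⊎ (c , d) ≡ (a , b) → d ℕ.< part l c
      to c c≢a d (inj₁ p) = p
      to c c≢a d (inj₂ p) = ⊥-elim (c≢a (proj₁ (,-injective p)))
      new≤ : ∀ d → (a , d) ∈ᵈ l ⊎ (a , d) ≡ (a , b) → d ℕ.< suc b
      new≤ d (inj₁ p) = ℕ.m<n⇒m<1+n (subst (d ℕ.<_) addable-part p)
      new≤ d (inj₂ refl) = ℕ.n<1+n d
      new : part m a ≡ suc b
      new = ℕ.≤-antisym (<-extensional λ d p → new≤ d (Equivalence.to (iff (a , d)) p))
                        (Equivalence.from (iff (a , b)) (inj₂ refl))

  module _ {l a b} (R : Removable l (a , b)) where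
    private
      m = proj₁ (proj₂ R)
      iff = λ y → proj₂ (proj₂ R) y
      outside : part m a ℕ.≤ b
      outside = ℕ.≮⇒≥ λ p → proj₂ (Equivalence.to (iff (a , b)) p) refl

    removable-part : part l a ≡ suc b
    removable-part = ℕ.≤-antisym (ℕ.≮⇒≥ λ p → ℕ.<⇒≱
      (Equivalence.from (iff (a , suc b)) (p , λ e → ℕ.1+n≢n (proj₂ (,-injective e))))
      (ℕ.≤-trans outside (ℕ.n≤1+n b))) (proj₁ R)

    removable-below : part l (suc a) ℕ.≤ b
    removable-below = ℕ.≮⇒≥ λ p → ℕ.<⇒≱
      (ℕ.<-≤-trans (Equivalence.from (iff (suc a , b)) (p , λ e → ℕ.1+n≢n (proj₁ (,-injective e))))
          (decreasing m a)) outside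

    taken : Changed l m a (- (+ 1))
    taken = record
      { at = trans (β-shape m new) (trans (go (+ b) (+ a)) (cong (_+ - (+ 1)) (sym (β-shape l removable-part))))
      ; other = λ c c≢a → β-cong l m (ℕ.≤-antisym
          (<-extensional λ d p → proj₁ (Equivalence.to (iff (c , d)) p))
          (<-extensional λ d p → Equivalence.from (iff (c , d)) (p , λ e → c≢a (proj₁ (,-injective e)))))
      }
      where
      go : ∀ b a → b - a ≡ + 1 + b - a + - (+ 1)
      go b a = solve (b :: a :: end)
      new : part m a ≡ b
      new = ℕ.≤-antisym outside (<-extensional λ d p → Equivalence.from (iff (a , d))
        (ℕ.<-≤-trans p (ℕ.<⇒≤ (proj₁ R)) , λ e → ℕ.<⇒≢ p (proj₂ (,-injective e))))

  addable : ∀ l a → (∀ c → a ≡ suc c → part l a ℕ.< part l c) → Addable l (a , part l a)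
  addable l a above = ℕ.<-irrefl refl , setRow l a (suc (part l a)) below above , iff
    where
    below : part l (suc a) ℕ.≤ suc (part l a)
    below = ℕ.m≤n⇒m≤1+n (decreasing l a)
    iff : ∀ y → y ∈ᵈ setRow l a (suc (part l a)) below above ⇔ (y ∈ᵈ l ⊎ y ≡ (a , part l a))
    iff (c , d) with c ℕ.≟ a
    ... | no c≢a = mk⇔ inj₁ λ { (inj₁ p) → p ; (inj₂ e) → ⊥-elim (c≢a (proj₁ (,-injective e))) }
    ... | yes refl = mk⇔ to λ { (inj₁ p) → ℕ.m<n⇒m<1+n p ; (inj₂ refl) → ℕ.n<1+n _ }
      where
      to : d ℕ.< suc (part l c) → (c , d) ∈ᵈ l ⊎ (c , d) ≡ (c , part l c)
      to p with ℕ.m≤n⇒m<n∨m≡n (ℕ.≤-pred p)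
      ... | inj₁ q = inj₁ q
      ... | inj₂ refl = inj₂ refl

  removable : ∀ l a {b} → part l a ≡ suc b → part l (suc a) ℕ.≤ b → Removable l (a , b)
  removable l a {b} e below = ℕ.≤-reflexive (sym e) , setRow l a b below above , iff
    where
    above : ∀ c → a ≡ suc c → b ℕ.≤ part l c
    above c refl = ℕ.≤-trans (ℕ.n≤1+n b) (ℕ.≤-trans (ℕ.≤-reflexive (sym e)) (decreasing l c))
    iff : ∀ y → y ∈ᵈ setRow l a b below above ⇔ (y ∈ᵈ l × y ≢ (a , b))
    iff (c , d) with c ℕ.≟ a
    ... | no c≢a = mk⇔ (λ p → p , λ q → c≢a (proj₁ (,-injective q))) proj₁
    ... | yes refl = mk⇔ (λ p → subst (d ℕ.<_) (sym e) (ℕ.m<n⇒m<1+n p) , λ q → ℕ.<⇒≢ p (proj₂ (,-injective q)))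
      λ (p , q) → ℕ.≤∧≢⇒< (ℕ.≤-pred (subst (d ℕ.<_) e p)) λ { refl → q refl }

  -- Splitting lists of sums

  module _ {A B : Set} where

    lefts-∈ : ∀ {x : A} (w : List (A ⊎ B)) → inj₁ x ∈ w → x ∈ proj₁ (partitionSums w)
    lefts-∈ (inj₁ _ ∷ w) (here refl) = here refl
    lefts-∈ (inj₁ _ ∷ w) (there p) = there (lefts-∈ w p)
    lefts-∈ (inj₂ _ ∷ w) (there p) = lefts-∈ w p

    rights-∈ : ∀ {x : B} (w : List (A ⊎ B)) → inj₂ x ∈ w → x ∈ proj₂ (partitionSums w)
    rights-∈ (inj₂ _ ∷ w) (here refl) = here refl
    rights-∈ (inj₂ _ ∷ w) (there p) = there (rights-∈ w p)
    rights-∈ (inj₁ _ ∷ w) (there p) = rights-∈ w p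

    lefts-All : ∀ {P : A ⊎ B → Set} {w} → All P w → All (P ∘ inj₁) (proj₁ (partitionSums w))
    lefts-All {w = []} [] = []
    lefts-All {w = inj₁ _ ∷ _} (p ∷ ps) = p ∷ lefts-All ps
    lefts-All {w = inj₂ _ ∷ _} (p ∷ ps) = lefts-All ps

    rights-All : ∀ {P : A ⊎ B → Set} {w} → All P w → All (P ∘ inj₂) (proj₂ (partitionSums w))
    rights-All {w = []} [] = []
    rights-All {w = inj₁ _ ∷ _} (p ∷ ps) = rights-All ps
    rights-All {w = inj₂ _ ∷ _} (p ∷ ps) = p ∷ rights-All ps

    lefts-AllPairs : ∀ {R : A ⊎ B → A ⊎ B → Set} {w} → AllPairs R w → AllPairs (λ x y → R (inj₁ x) (inj₁ y))
        (proj₁ (partitionSums w))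
    lefts-AllPairs {w = []} [] = []
    lefts-AllPairs {w = inj₁ _ ∷ _} (p ∷ ps) = lefts-All p ∷ lefts-AllPairs ps
    lefts-AllPairs {w = inj₂ _ ∷ _} (p ∷ ps) = lefts-AllPairs ps

    rights-AllPairs : ∀ {R : A ⊎ B → A ⊎ B → Set} {w} → AllPairs R w → AllPairs (λ x y → R (inj₂ x) (inj₂ y))
        (proj₂ (partitionSums w))
    rights-AllPairs {w = []} [] = []
    rights-AllPairs {w = inj₁ _ ∷ _} (p ∷ ps) = rights-AllPairs ps
    rights-AllPairs {w = inj₂ _ ∷ _} (p ∷ ps) = rights-All p ∷ rights-AllPairs ps

  -- Signatures in terms of beads.

  module Signature (ℓ : ℕ) (2≤ℓ : 2 ℕ.≤ ℓ) (L : ℤ) (L≡ℓ : L ≡ + ℓ) (i : ℕ) where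

    open Characterisation ℓ 2≤ℓ L L≡ℓ
    open Crystal ℓ i

    -- The rows whose ends carry a sign of the i-signature, in terms of beads.
    Plus Minus : Partition → ℕ → Set
    Plus  l a = β l a ≈ + i × ¬ Bead l (β l a + + 1)
    Minus l a = β l a ≈ + i + + 1 × ¬ Bead l (β l a - + 1)

    addable⇒plus : ∀ {l a b} → HasResidue ℓ i (a , b) → Addable l (a , b) → Plus l a
    addable⇒plus {l} {a} {b} res A = subst (_≈ + i) (sym (β-shape l (addable-part {l} A))) (∣⇒≈ res) , gap a refl
      where
      gap : ∀ a′ → a′ ≡ a → ¬ Bead l (β l a + + 1)
      gap zero refl (k , e) = ≺⇒≱ {β l 0} (subst (β l 0 ≺_) (sym e) (≺-suc {β l 0} ℤ.≤-refl)) (β-antitone l z≤n)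
      gap (suc c) refl (k , e) = ≺⇒≱ {β l k} k≺c (β-antitone l (ℕ.≤-pred (β-cancel-≺ l a≺k)))
        where
        a≺k : β l (suc c) ≺ β l k
        a≺k = subst (β l (suc c) ≺_) (sym e) (≺-suc {β l (suc c)} ℤ.≤-refl)
        go : ∀ p q c → + 1 + p ≤ q → p - (+ 1 + c) + + 1 ≺ q - c
        go p q c h = lin h (solve (p :: q :: c :: end))
        k≺c : β l k ≺ β l c
        k≺c = subst₂ _≺_ (trans (cong (_+ + 1) (sym (β-shape l (addable-part {l} A)))) (sym e)) (sym (β-def l c))
          (go (+ b) (+ part l c) (+ c) (+≤+ (addable-above {l} A c refl)))

    -- An addable box has the bead of its row as content, but a removable box has content one less;
    -- hence the runner of `i + 1` in `Minus`.
    removable⇒minus : ∀ {l a b} → HasResidue ℓ i (a , b) → Removable l (a , b) → Minus l a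
    removable⇒minus {l} {a} {b} res R =
      ≈-trans {y = content (a , b) + + 1} (≈-reflexive (trans βa (go (+ b) (+ a)))) (≈-+ (+ 1) (∣⇒≈ {content
          (a , b)} {+ i} res)) , gap
      where
      βa : β l a ≡ + suc b - + a
      βa = β-shape l (removable-part {l} R)
      go : ∀ b a → + 1 + b - a ≡ b - a + + 1
      go b a = solve (b :: a :: end)
      gap : ¬ Bead l (β l a - + 1)
      gap (k , e) = ≺⇒≱ {β l (suc a)} a≺k (β-antitone l (β-cancel-≺ l (subst (_≺ β l a) (sym e) (pred-≺ (β l a)))))
        where
        go′ : ∀ p b a → p ≤ b → p - (+ 1 + a) ≺ + 1 + b - a - + 1
        go′ p b a h = lin h (solve (p :: b :: a :: end))
        a≺k : β l (suc a) ≺ β l k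
        a≺k = subst₂ _≺_ (sym (β-def l (suc a))) (trans (cong (_- + 1) (sym βa)) (sym e))
          (go′ (+ part l (suc a)) (+ b) (+ a) (+≤+ (removable-below {l} R)))

    plus⇒addable : ∀ {l a} → Plus l a → HasResidue ℓ i (a , part l a) × Addable l (a , part l a)
    plus⇒addable {l} {a} (p , gap) = ≈⇒∣ (subst (_≈ + i) (β-def l a) p) , addable l a above
      where
      above : ∀ c → a ≡ suc c → part l a ℕ.< part l c
      above c refl = ℕ.≤∧≢⇒< (decreasing l c) λ e → gap (c , trans (β-shape l (sym e)) (trans (go (+ part l a)
          (+ c)) (cong (_+ + 1) (sym (β-def l a)))))
        where
        go : ∀ p c → p - c ≡ p - (+ 1 + c) + + 1
        go p c = solve (p :: c :: end)

    minus⇒removable : ∀ {l a} → Minus l a → ∃[ b ] part l a ≡ suc b × HasResidue ℓ i (a , b) × Removable l (a , b)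
    minus⇒removable {l} {a} (p , gap) = shape (part l a) refl
      where
      go : ∀ b a → + 1 + b - a ≡ b - a + + 1
      go b a = solve (b :: a :: end)
      go′ : ∀ b a → + 1 + b - (+ 1 + a) ≡ + 1 + b - a - + 1
      go′ b a = solve (b :: a :: end)
      shape : ∀ n → part l a ≡ n → ∃[ b ] part l a ≡ suc b × HasResidue ℓ i (a , b) × Removable l (a , b)
      shape zero e = ⊥-elim (gap (empty-row-bead l e (≺⇒≤ {β l a - + 1} (pred-≺ (β l a)))))
      shape (suc b) e = b , e , ≈⇒∣ (≈-cancel-+ {content (a , b)} {+ i} (+ 1) (subst (_≈ + i + + 1) (trans
          (β-shape l e) (go (+ b) (+ a))) p)) ,
        removable l a e (ℕ.≮⇒≥ λ q → gap (suc a , trans (β-shape l (ℕ.≤-antisym (subst (part l (suc a) ℕ.≤_) e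
            (decreasing l a)) q))
          (trans (go′ (+ b) (+ a)) (cong (_- + 1) (sym (β-shape l e))))))

    row-≤-bound : ∀ {l a} → Plus l a → a ℕ.≤ bound l
    row-≤-bound {l} {zero} p = z≤n
    row-≤-bound {l} {suc c} p = ℕ.≮⇒≥ λ q → ℕ.<⇒≱ (addable-above {l} (proj₂ (plus⇒addable {l} p)) c refl)
      (subst (ℕ._≤ part l (suc c)) (sym (vanishing l c (ℕ.≤-pred q))) z≤n)

    minus-row-≤-bound : ∀ {l a} → Minus l a → a ℕ.≤ bound l
    minus-row-≤-bound {l} {a} p with minus⇒removable {l} p
    ... | b , e , _ = ℕ.≮⇒≥ λ q → ℕ.1+n≢0 (trans (sym e) (vanishing l a (ℕ.<⇒≤ q)))

    Before : Box → Box → Set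
    Before (a , b) (a′ , b′) = a′ ℕ.< a ⊎ (a ≡ a′ × b ℕ.< b′)

    readingOrder-sorted : ∀ l → AllPairs Before (readingOrder l)
    readingOrder-sorted l = AllPairs.concat⁺
      (All.map⁺ (All.universal within (downFrom (suc (bound l)))))
      (AllPairs.map⁺ (AllPairs.applyDownFrom⁺₁ id (suc (bound l)) (λ j<i _ → between j<i)))
      where
      boxes : ℕ → List Box
      boxes a = map (a ,_) (upTo (suc (part l a)))
      within : ∀ a → AllPairs Before (boxes a)
      within a = AllPairs.map⁺ (AllPairs.applyUpTo⁺₁ id (suc (part l a)) (λ i<j _ → inj₂ (refl , i<j)))
      between : ∀ {a c} → c ℕ.< a → All (λ x → All (Before x) (boxes c)) (boxes a)
      between {a} {c} c<a = All.map⁺ (All.universal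
        (λ b → All.map⁺ {f = c ,_} (All.universal (λ _ → inj₁ c<a) (upTo (suc (part l c))))) (upTo (suc
            (part l a))))

    ∈-readingOrder : ∀ l {a b} → a ℕ.≤ bound l → b ℕ.≤ part l a → (a , b) ∈ readingOrder l
    ∈-readingOrder l {a} {b} p q = ∈-concatMap⁺ (λ a → map (a ,_) (upTo (suc (part l a))))
      (Any.map (λ { refl → ∈-map⁺ (a ,_) (∈-upTo⁺ (s≤s q)) }) (∈-downFrom⁺ (s≤s p)))

    box : ∀ {l} → Sign l → Box
    box (inj₁ (x , _)) = x
    box (inj₂ (x , _)) = x

    row : ∀ {l} → Sign l → ℕ
    row {l} s = proj₁ (box {l} s)

    signs-box : ∀ l x → All (λ s → box {l} s ≡ x) (signs l x)
    signs-box l x with hasResidue? x ×-dec removable? l x | hasResidue? x ×-dec addable? l x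
    ... | yes p | _     = refl ∷ []
    ... | no  _ | yes q = refl ∷ []
    ... | no  _ | no  _ = []

    signs-short : ∀ l x {R : Sign l → Sign l → Set} → AllPairs R (signs l x)
    signs-short l x with hasResidue? x ×-dec removable? l x | hasResidue? x ×-dec addable? l x
    ... | yes p | _     = [] ∷ []
    ... | no  _ | yes q = [] ∷ []
    ... | no  _ | no  _ = []

    signature-boxes : ∀ l → AllPairs (λ s t → Before (box {l} s) (box {l} t)) (signature l)
    signature-boxes l = AllPairs.concat⁺
      (All.map⁺ (All.universal (λ x → signs-short l x) (readingOrder l)))
      (AllPairs.map⁺ (AllPairs.map (λ {x} {y} p →
        All.map (λ { refl → All.map (λ { refl → p }) (signs-box l y) }) (signs-box l x)) (readingOrder-sorted l)))

    -- The removable box of a row and the addable position next to it have residues differing by 1,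
    -- which are distinct modulo `ℓ ≥ 2`. So the rows alone order the letters.
    one-letter-per-row : ∀ {l} (s t : Sign l) → Before (box {l} s) (box {l} t) → row {l} t ℕ.< row {l} s
    one-letter-per-row {l} s t (inj₁ p) = p
    one-letter-per-row {l} (inj₁ ((a , b) , _ , R)) (inj₁ ((_ , b′) , _ , R′)) (inj₂ (refl , p)) =
      ⊥-elim (ℕ.<⇒≢ p (ℕ.suc-injective (trans (sym (removable-part {l} R)) (removable-part {l} R′))))
    one-letter-per-row {l} (inj₂ ((a , b) , _ , A)) (inj₂ ((_ , b′) , _ , A′)) (inj₂ (refl , p)) =
      ⊥-elim (ℕ.<⇒≢ p (trans (sym (addable-part {l} A)) (addable-part {l} A′)))
    one-letter-per-row {l} (inj₂ ((a , b) , _ , A)) (inj₁ ((_ , b′) , _ , R)) (inj₂ (refl , p)) =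
      ⊥-elim (ℕ.<⇒≱ p (ℕ.≤-trans (ℕ.n≤1+n b′) (ℕ.≤-reflexive (trans (sym (removable-part {l} R))
          (addable-part {l} A)))))
    one-letter-per-row {l} (inj₁ ((a , b) , res , R)) (inj₂ ((_ , b′) , res′ , A)) (inj₂ (refl , p)) =
      ⊥-elim (≉-suc (+ i) (≈-trans (≈-sym (proj₁ (removable⇒minus {l} res R))) (proj₁ (addable⇒plus {l} res′ A))))

    Descending : ∀ l → Sign l → Sign l → Set
    Descending l s t = row {l} t ℕ.< row {l} s

    signature-rows : ∀ l → AllPairs (Descending l) (signature l)
    signature-rows l = AllPairs.map (λ {s} {t} → one-letter-per-row {l} s t) (signature-boxes l)

    ∈-signature : ∀ l {x s} → x ∈ readingOrder l → s ∈ signs l x → s ∈ signature l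
    ∈-signature l {x} p q = ∈-concatMap⁺ (signs l) (Any.map (λ { refl → q }) p)

    plus∈signature : ∀ {l a} → Plus l a → ∃[ y ] proj₁ (proj₁ y) ≡ a × inj₂ y ∈ signature l
    plus∈signature {l} {a} p with plus⇒addable {l} p
    ... | res , A with letter
      where
      letter : ∃[ y ] proj₁ (proj₁ y) ≡ a × inj₂ y ∈ signs l (a , part l a)
      letter with hasResidue? (a , part l a) ×-dec removable? l (a , part l a) | hasResidue? (a , part l a)
          ×-dec addable? l (a , part l a)
      ... | yes (_ , R) | _ = ⊥-elim (proj₁ A (proj₁ R))
      ... | no _ | yes q = _ , refl , here refl
      ... | no _ | no ¬q = ⊥-elim (¬q (res , A))
    ...   | y , e , q = y , e , ∈-signature l (∈-readingOrder l (row-≤-bound {l} p) ℕ.≤-refl) q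

    minus∈signature : ∀ {l a} → Minus l a → ∃[ y ] proj₁ (proj₁ y) ≡ a × inj₁ y ∈ signature l
    minus∈signature {l} {a} p with minus⇒removable {l} p
    ... | b , e , res , R with letter
      where
      letter : ∃[ y ] proj₁ (proj₁ y) ≡ a × inj₁ y ∈ signs l (a , b)
      letter with hasResidue? (a , b) ×-dec removable? l (a , b) | hasResidue? (a , b) ×-dec addable? l (a , b)
      ... | yes q | _ = _ , refl , here refl
      ... | no ¬q | _ = ⊥-elim (¬q (res , R))
    ...   | y , e′ , q = y , e′ , ∈-signature l (∈-readingOrder l (minus-row-≤-bound {l} p) (ℕ.≤-trans
          (ℕ.n≤1+n b) (ℕ.≤-reflexive (sym e)))) q

    -- Signatures without cancellation

    Reduced : Partition → Set
    Reduced l = ∀ {a c} → a ℕ.< c → Plus l a → Minus l c → ⊥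

    -- A - in row `c` below a + in row `a` makes `β l c - 1` a gap of residue `i`, with the
    -- congruent bead of row `a` and the adjacent, incongruent bead of row `c` above it.
    JM⇒reduced : ∀ {l} → JM (Bead l) → Reduced l
    JM⇒reduced {l} jm {a} {c} a<c (p , _) (q , gap) = ≉-pred (β l c) (≈-sym (jm (β l c - + 1) (β l a)
        (β l c) gap (a , refl) (c , refl)
      (≺-≤-trans {β l c - + 1} (pred-≺ (β l c)) (≺⇒≤ {β l c} (β-strict l a<c))) (pred-≺ (β l c))
      (≈-trans p (≈-cancel-+ (+ 1) (≈-trans (≈-sym q) (≈-reflexive (sym (-1+1 (β l c)))))))))
      where
      -1+1 : ∀ x → x - + 1 + + 1 ≡ x
      -1+1 x = solve (x :: end)

    NoPair : ∀ {l} → Sign l → Sign l → Set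
    NoPair (inj₁ _) (inj₂ _) = ⊥
    NoPair _        _        = ⊤

    reduce-id : ∀ {l} (w : List (Sign l)) → AllPairs (NoPair {l}) w → foldr (prepend {l}) [] w ≡ w
    reduce-id [] _ = refl
    reduce-id {l} (s ∷ w) (p ∷ ps) rewrite reduce-id {l} w ps = cons s w p
      where
      cons : ∀ s w → All (NoPair {l} s) w → prepend {l} s w ≡ s ∷ w
      cons (inj₁ _) [] _ = refl
      cons (inj₁ _) (inj₁ _ ∷ _) _ = refl
      cons (inj₁ _) (inj₂ _ ∷ _) (() ∷ _)
      cons (inj₂ _) [] _ = refl
      cons (inj₂ _) (_ ∷ _) _ = refl

    module _ {l} (reduced : Reduced l) where

      reducedSignature≡ : reducedSignature l ≡ signature l
      reducedSignature≡ = reduce-id {l} (signature l) (AllPairs.map (λ {s} {t} → noPair s t) (signature-rows l))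
        where
        noPair : ∀ (s t : Sign l) → Descending l s t → NoPair {l} s t
        noPair (inj₁ (_ , res , R)) (inj₂ (_ , res′ , A)) p = reduced p (addable⇒plus {l} res′ A)
            (removable⇒minus {l} res R)
        noPair (inj₁ _) (inj₁ _) p = _
        noPair (inj₂ _) _ p = _

    rowʳ : ∀ {l} → RemovableBox l → ℕ
    rowʳ x = proj₁ (proj₁ x)

    rowᵃ : ∀ {l} → AddableBox l → ℕ
    rowᵃ x = proj₁ (proj₁ x)


    module _ {l} (reduced : Reduced l) where

      opaque
        conormal-sorted : AllPairs (λ x y → rowᵃ {l} y ℕ.< rowᵃ {l} x) (conormal l)
        conormal-sorted = subst (λ w → AllPairs (λ x y → rowᵃ {l} y ℕ.< rowᵃ {l} x) (proj₂ (partitionSums w)))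
          (sym (reducedSignature≡ reduced)) (rights-AllPairs {R = Descending l} (signature-rows l))

        normal-sorted : AllPairs (λ x y → rowʳ {l} y ℕ.< rowʳ {l} x) (normal l)
        normal-sorted = subst (λ w → AllPairs (λ x y → rowʳ {l} y ℕ.< rowʳ {l} x) (proj₁ (partitionSums w)))
          (sym (reducedSignature≡ reduced)) (lefts-AllPairs {R = Descending l} (signature-rows l))

        conormal-rows : Enumerates (Plus l) (map (rowᵃ {l}) (conormal l))
        conormal-rows = record
          { unique   = AllPairs.map⁺ (AllPairs.map (λ p → ℕ.<⇒≢ p ∘ sym) conormal-sorted)
          ; sound    = λ p → sound (∈-map⁻ (rowᵃ {l}) p)
          ; complete = complete
          }
          where
          sound : ∀ {a} → ∃[ y ] y ∈ conormal l × a ≡ rowᵃ {l} y → Plus l a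
          sound ((_ , res , A) , _ , refl) = addable⇒plus {l} res A
          complete : ∀ {a} → Plus l a → a ∈ map (rowᵃ {l}) (conormal l)
          complete p with plus∈signature {l} p
          ... | y , refl , y∈ = ∈-map⁺ (rowᵃ {l}) (subst (λ w → y ∈ proj₂ (partitionSums w)) (sym
                (reducedSignature≡ reduced)) (rights-∈ (signature l) y∈))

        normal-rows : Enumerates (Minus l) (map (rowʳ {l}) (normal l))
        normal-rows = record
          { unique   = AllPairs.map⁺ (AllPairs.map (λ p → ℕ.<⇒≢ p ∘ sym) normal-sorted)
          ; sound    = λ p → sound (∈-map⁻ (rowʳ {l}) p)
          ; complete = complete
          }
          where
          sound : ∀ {a} → ∃[ y ] y ∈ normal l × a ≡ rowʳ {l} y → Minus l a
          sound ((_ , res , R) , _ , refl) = removable⇒minus {l} res R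
          complete : ∀ {a} → Minus l a → a ∈ map (rowʳ {l}) (normal l)
          complete p with minus∈signature {l} p
          ... | y , refl , y∈ = ∈-map⁺ (rowʳ {l}) (subst (λ w → y ∈ proj₁ (partitionSums w)) (sym
                (reducedSignature≡ reduced)) (lefts-∈ (signature l) y∈))

        -- The end of the first row is always addable, and without cancellation every + is conormal,
        -- so only the residue matters.
        firstRowConormal⇔ : FirstRowConormal l ⇔ β l 0 ≈ + i
        firstRowConormal⇔ = mk⇔ to from
          where
          to : FirstRowConormal l → β l 0 ≈ + i
          to p = proj₁ (Enumerates.sound conormal-rows (Any.map⁺ (Any.map sym p)))
          from : β l 0 ≈ + i → FirstRowConormal l
          from p = Any.map sym (Any.map⁻ (Enumerates.complete conormal-rows (p , λ (k , e) →
            ≺⇒≱ {β l 0} (subst (β l 0 ≺_) (sym e) (≺-suc {β l 0} ℤ.≤-refl)) (β-antitone l z≤n))))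

        -- The signature is read from the bottom, so the rightmost + lies in the row with the least
        -- index.
        f̃-step : 0 ℕ.< φ l → ∃[ m ] f̃ l ≡ just m × ∃[ a ] Plus l a × (∀ {c} → Plus l c → a ℕ.≤ c)
            × Changed l m a (+ 1)
        f̃-step pos with last-min (rowᵃ {l}) (conormal l) conormal-sorted pos
        ... | y@((a , b) , res , A) , e , y∈ , min =
          _ , cong (Maybe.map _) e , a , addable⇒plus {l} res A , lowest , added {l} A
          where
          lowest : ∀ {c} → Plus l c → a ℕ.≤ c
          lowest p with ∈-map⁻ (rowᵃ {l}) (Enumerates.complete conormal-rows p)
          ... | z , z∈ , refl = min z∈

        -- Dually, the leftmost - lies in the row with the greatest index. A second row with a - is
        -- returned as well: its unmoved bead is what the vacated position will be compared with.
        ẽ-step : 1 ℕ.< ε l → ∃[ m ] ẽ l ≡ just m × ∃[ c ] Minus l c × (∀ {a} → Minus l a → a ℕ.≤ c) ×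
                 Changed l m c (- (+ 1)) × ∃[ a ] Minus l a × a ℕ.< c
        ẽ-step big = go (normal l) refl big
          where
          go : ∀ xs → normal l ≡ xs → 1 ℕ.< length xs → ∃[ m ] Maybe.map (λ x → proj₁ (proj₂ (proj₂
              (proj₂ x)))) (List.head xs) ≡ just m × ∃[ c ] Minus l c × (∀ {a} → Minus l a → a ℕ.≤ c) ×
                 Changed l m c (- (+ 1)) × ∃[ a ] Minus l a × a ℕ.< c
          go (_ ∷ []) _ (s≤s ())
          go (x@((c , _) , res , R) ∷ y@((a , _) , res′ , R′) ∷ xs) e _ =
            _ , refl , c , removable⇒minus {l} res R , highest , taken {l} R , a , removable⇒minus {l} res′ R′
                , All.lookup first (here refl)
            where
            sorted : AllPairs (λ x y → rowʳ {l} y ℕ.< rowʳ {l} x) (x ∷ y ∷ xs)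
            sorted = subst (AllPairs (λ x y → rowʳ {l} y ℕ.< rowʳ {l} x)) e normal-sorted
            first : All (λ z → rowʳ {l} z ℕ.< c) (y ∷ xs)
            first with sorted
            ... | p ∷ _ = p
            highest : ∀ {a} → Minus l a → a ℕ.≤ c
            highest p with ∈-map⁻ (rowʳ {l}) (Enumerates.complete normal-rows p)
            ... | z , z∈ , refl with subst (z ∈_) e z∈
            ...   | here refl = ℕ.≤-refl
            ...   | there q = ℕ.<⇒≤ (All.lookup first q)

  -- The decomposition in terms of beads.

  module Shapes (ℓ : ℕ) (2≤ℓ : 2 ℕ.≤ ℓ) (L : ℤ) (L≡ℓ : L ≡ + ℓ) where

    open Characterisation ℓ 2≤ℓ L L≡ℓ

    -- For a decomposition these are the beads of `μ` shifted down by `r`; `t` stands for the first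
    -- row of `μ`, whose own bead in `l` may be displaced by `κ`.
    Low : Partition → ℕ → ℤ → ℤ → Set
    Low l r t x = x ≡ t ⊎ ∃[ a ] r ℕ.< a × β l a ≡ x

    -- The decomposition in terms of beads: rows up to r are on the runner of t,
    -- and t together with the rows below is an L-core.
    record Shape (l κ : Partition) (r : ℕ) (t : ℤ) : Set where
      field
        upper  : ∀ {a} → a ℕ.≤ r → β l a ≡ t + + ((r ∸ a) ℕ.+ part κ a) * L
        lower  : ∀ {a} → r ℕ.< a → β l a ≺ t
        tight  : t - L ≺ β l (suc r)
        closed : ∀ {x} → Low l r t x → ∃[ a ] r ℕ.< a × β l a ≡ x - L

      congruent : ∀ {a} → a ℕ.≤ r → β l a ≈ t
      congruent {a} p = by (+ ((r ∸ a) ℕ.+ part κ a)) (upper p)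

      private
        multiple : ∀ n → t ≤ t + + n * L
        multiple zero = eq (sym (ℤ.+-identityʳ t))
        multiple (suc n) = subst (λ k → t ≤ t + k) (sym (ℤ.suc-* (+ n) L)) (go (+ n * L) (multiple n))
          where
          go : ∀ k → t ≤ t + k → t ≤ t + (L + k)
          go k p = lin (p ⊕ 2≤L ⊕ 0≤ 2) (solve (t :: k :: L :: end))

        multiple₁ : ∀ {n} → n ≢ 0 → t + L ≤ t + + n * L
        multiple₁ {zero} p = ⊥-elim (p refl)
        multiple₁ {suc n} _ = subst (λ k → t + L ≤ t + k) (sym (ℤ.suc-* (+ n) L)) (go (+ n * L) (multiple n))
          where
          go : ∀ k → t ≤ t + k → t + L ≤ t + (L + k)
          go k p = lin p (solve (t :: k :: L :: end))

        multiple₂ : ∀ {n} → 1 ℕ.< n → t + L + L ≤ t + + n * L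
        multiple₂ {suc n} (s≤s p) = subst (λ k → t + L + L ≤ t + k) (sym (ℤ.suc-* (+ n) L))
          (go (+ n * L) (multiple₁ (λ e → ℕ.<⇒≢ p (sym e))))
          where
          go : ∀ k → t + L ≤ t + k → t + L + L ≤ t + (L + k)
          go k p = lin p (solve (t :: k :: L :: end))

      upper₁ : ∀ {a} → a ℕ.< r → t + L ≤ β l a
      upper₁ {a} p = subst (t + L ≤_) (sym (upper (ℕ.<⇒≤ p)))
        (multiple₁ λ e → ℕ.<⇒≢ (ℕ.m<n⇒0<n∸m p) (sym (ℕ.m+n≡0⇒m≡0 (r ∸ a) e)))

      upper₂ : ∀ {a} → suc a ℕ.< r → t + L + L ≤ β l a
      upper₂ {a} p = subst (t + L + L ≤_) (sym (upper (ℕ.<⇒≤ (ℕ.<⇒≤ p))))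
        (multiple₂ (ℕ.<-≤-trans (ℕ.m+n≤o⇒m≤o∸n 2 p) (ℕ.m≤m+n (r ∸ a) _)))

      last-0 : part κ r ≡ 0 → β l r ≡ t
      last-0 e = trans (upper ℕ.≤-refl) (trans (cong (λ n → t + + n * L) (cong₂ ℕ._+_ (ℕ.n∸n≡0 r) e))
          (ℤ.+-identityʳ t))

      last-pos : part κ r ≢ 0 → t + L ≤ β l r
      last-pos p = subst (t + L ≤_) (sym (upper ℕ.≤-refl)) (multiple₁ (λ e → p (ℕ.m+n≡0⇒n≡0 (r ∸ r) e)))

      previous-0 : ∀ {c} → r ≡ suc c → part κ c ≡ 0 → β l c ≡ t + L
      previous-0 {c} refl e = trans (upper (ℕ.n≤1+n c)) (cong (λ d → t + d) (trans
        (cong (λ n → + n * L) (cong₂ ℕ._+_ (ℕ.m+n∸n≡m 1 c) e)) (ℤ.*-identityˡ L)))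

      previous-pos : ∀ {c} → r ≡ suc c → part κ c ≢ 0 → t + L + L ≤ β l c
      previous-pos {c} refl p = subst (t + L + L ≤_) (sym (upper (ℕ.n≤1+n c)))
        (multiple₂ (subst (λ d → 1 ℕ.< d ℕ.+ part κ c) (sym (ℕ.m+n∸n≡m 1 c)) (s≤s (ℕ.n≢0⇒n>0 p))))

      low-bound : ∀ {x} → Low l r t x → x ≺ t + + 1
      low-bound (inj₁ refl) = ≺-suc {t} ℤ.≤-refl
      low-bound (inj₂ (a , r<a , refl)) = ≺-suc {β l a} (≺⇒≤ {β l a} (lower r<a))

      low-flush : ∀ {x y} → Low l r t x → y ≈ x → y ≤ x → Low l r t y
      low-flush {x} {y} low y≈x y≤x = flush-below {Low l r t} {t + + 1} (λ x p _ → inj₂ (closed p)) x y y≈x y≤x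
          (low-bound low) low

    -- Going up one row adds `ℓ - 1` to the part of `ν` and lowers the row index by 1, so the bead
    -- rises by `ℓ`; each unit of `κ` adds another `ℓ`. Thus the upper rows stay on the runner of
    -- `t`.
    decomposition⇒shape : ∀ {l μ r κ} → Decomposition ℓ l μ r κ → Shape l κ r (β μ 0 - + r)
    decomposition⇒shape {l} {μ} {r} {κ} D = record
      { upper  = upper′
      ; lower  = λ p → subst (_≺ β μ 0 - + r) (sym (proj₂ (low p)))
          (≺-minus (β μ (proj₁ (low p))) (β μ 0) (+ r) (β-strict μ (ℕ.n≢0⇒n>0 (low≢0 p))))
      ; tight  = tight′
      ; closed = closed′
      }
      where
      open Decomposition D
      flush : Flush (Bead μ)
      flush = core⇒flush {μ} core

      ≺-minus : ∀ x y r → x ≺ y → x - r ≺ y - r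
      ≺-minus x y r p = lin p (solve (x :: y :: r :: end))

      shift : ∀ c → part l (r ℕ.+ suc c) ≡ part μ (suc c)
      shift c with r ℕ.+ suc c ℕ.<? r | lower (r ℕ.+ suc c) (ℕ.m<m+n r ℕ.z<s)
      ... | yes p | _ = ⊥-elim (ℕ.m+n≮m r (suc c) p)
      ... | no _ | e = trans e (cong (part μ) (ℕ.m+n∸m≡n r (suc c)))

      shift-β : ∀ c → β l (r ℕ.+ suc c) ≡ β μ (suc c) - + r
      shift-β c = trans (β-shape l (shift c)) (trans (go (+ part μ (suc c)) (+ r) (+ suc c)) (cong (_- + r)
          (sym (β-def μ (suc c)))))
        where
        go : ∀ p r c → p - (r + c) ≡ p - c - r
        go p r c = solve (p :: r :: c :: end)

      low : ∀ {a} → r ℕ.< a → ∃[ c ] β l a ≡ β μ c - + r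
      low {a} p with ℕ.m≤n⇒∃[o]m+o≡n p
      ... | c , refl = suc c , trans (cong (β l) (sym (ℕ.+-suc r c))) (shift-β c)

      low≢0 : ∀ {a} (p : r ℕ.< a) → proj₁ (low p) ≢ 0
      low≢0 {a} p with ℕ.m≤n⇒∃[o]m+o≡n p
      ... | c , refl = λ ()

      upper-part : ∀ a d → a ℕ.+ d ≡ r → part l a ≡ part μ 0 ℕ.+ d ℕ.* (ℓ ∸ 1) ℕ.+ ℓ ℕ.* part κ a
      upper-part a d refl with a ℕ.<? a ℕ.+ d | upper a (ℕ.m≤m+n a d)
      ... | yes _ | e = trans e (cong (λ k → part μ 0 ℕ.+ k ℕ.* (ℓ ∸ 1) ℕ.+ ℓ ℕ.* part κ a) (ℕ.m+n∸m≡n a d))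
      upper-part a zero refl | no _ | e = trans e (cong (ℕ._+ ℓ ℕ.* part κ a) (trans (cong (part μ)
          (ℕ.m≤n⇒m∸n≡0 (ℕ.≤-reflexive (sym (ℕ.+-identityʳ a))))) (sym (ℕ.+-identityʳ (part μ 0)))))
      upper-part a (suc d) refl | no p | _ = ⊥-elim (p (ℕ.m<m+n a ℕ.z<s))

      upper′ : ∀ {a} → a ℕ.≤ r → β l a ≡ β μ 0 - + r + + ((r ∸ a) ℕ.+ part κ a) * L
      upper′ {a} a≤r = trans (β-shape l (upper-part a (r ∸ a) (ℕ.m+[n∸m]≡n a≤r)))
        (go (+ part μ 0) (+ (r ∸ a)) (+ (ℓ ∸ 1)) (+ part κ a) (+ a) (+ r) L {m₂ = + (ℓ ℕ.* part κ a)}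
          (ℤ.pos-* (r ∸ a) (ℓ ∸ 1)) (trans (ℤ.pos-* ℓ (part κ a)) (cong (_* + part κ a) (sym L≡ℓ)))
          (β-def μ 0)
          (trans L≡ℓ (cong +_ (sym (ℕ.suc-pred ℓ {{ℕ.>-nonZero (ℕ.<-≤-trans ℕ.z<s 2≤ℓ)}}))))
          (cong +_ (sym (ℕ.m+[n∸m]≡n a≤r))))
        where
        go : ∀ M d n k a r L {m₁ m₂ b} → m₁ ≡ d * n → m₂ ≡ L * k → b ≡ M - + 0 → L ≡ + 1 + n → r ≡ a + d →
             M + m₁ + m₂ - a ≡ b - r + (d + k) * L
        go M d n k a _ _ refl refl refl refl refl = solve (M :: d :: n :: k :: a :: end)

      -- Flushness puts a bead of `μ` at `β μ 0 - L`, in row 1 or below. Row 1 would mean a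
      -- difference of `ℓ - 1` between the first two parts, which `gap` excludes.
      next-μ : β μ 0 - L ≺ β μ 1
      next-μ with flush (β μ 0) (0 , refl)
      ... | zero , e = ⊥-elim (≺⇒≱ {β μ 0 - L} (lin (2≤L ⊕ 0≤ 1) (go (β μ 0) L)) (eq e))
        where
        go : ∀ b L → b - (+ 1 + (b - L)) ≡ L + + 1 - (+ 2 + + 0)
        go b L = solve (b :: L :: end)
      ... | suc k , e with cmp (β μ 0 - L) (β μ 1)
      ...   | inj₁ p = p
      ...   | inj₂ (inj₂ p) = ⊥-elim (≺⇒≱ {β μ 1} p (ℤ.≤-trans (qe e) (β-antitone μ (s≤s z≤n))))
      ...   | inj₂ (inj₁ e′) = ⊥-elim (gap (trans (cong (_∸ part μ 1) eqℕ) (ℕ.m+n∸n≡m (ℓ ∸ 1) (part μ 1))))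
        where
        go : ∀ M N n L {b c} → b ≡ M - + 0 → c ≡ N - + 1 → L ≡ + 1 + n → b - L ≡ c → M ≡ n + N
        go M N n _ refl refl refl e = lin≡ e (solve (M :: N :: n :: end))
        eqℕ : part μ 0 ≡ (ℓ ∸ 1) ℕ.+ part μ 1
        eqℕ = ℤ.+-injective (go (+ part μ 0) (+ part μ 1) (+ (ℓ ∸ 1)) L (β-def μ 0) (β-def μ 1)
          (trans L≡ℓ (cong +_ (sym (ℕ.suc-pred ℓ {{ℕ.>-nonZero (ℕ.<-≤-trans ℕ.z<s 2≤ℓ)}})))) e′)

      tight′ : β μ 0 - + r - L ≺ β l (suc r)
      tight′ = subst (β μ 0 - + r - L ≺_) (sym (trans (cong (β l) (sym (ℕ.+-comm r 1))) (shift-β 0))) (go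
          (β μ 0) (+ r) (β μ 1) next-μ)
        where
        go : ∀ b r c → b - L ≺ c → b - r - L ≺ c - r
        go b r c p = lin p (solve (b :: r :: c :: L :: end))

      drop : ∀ c → ∃[ a ] r ℕ.< a × β l a ≡ β μ c - + r - L
      drop c with flush (β μ c) (c , refl)
      ... | k , e = r ℕ.+ k , below k e
        where
        swap : ∀ b r → b - L - r ≡ b - r - L
        swap b r = solve (b :: r :: L :: end)
        below : ∀ k → β μ k ≡ β μ c - L → r ℕ.< r ℕ.+ k × β l (r ℕ.+ k) ≡ β μ c - + r - L
        below zero e = ⊥-elim (≺⇒≱ {β μ c - L} (lin (2≤L ⊕ 0≤ 1) (go (β μ c) L)) (ℤ.≤-trans (β-antitone μ z≤n)
            (eq e)))
          where
          go : ∀ b L → b - (+ 1 + (b - L)) ≡ L + + 1 - (+ 2 + + 0)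
          go b L = solve (b :: L :: end)
        below (suc k) e = ℕ.m<m+n r ℕ.z<s , trans (shift-β k) (trans (cong (_- + r) e) (swap (β μ c) (+ r)))

      closed′ : ∀ {x} → Low l r (β μ 0 - + r) x → ∃[ a ] r ℕ.< a × β l a ≡ x - L
      closed′ (inj₁ refl) = drop 0
      closed′ (inj₂ (a , p , refl)) with drop (proj₁ (low p))
      ... | a′ , q , e = a′ , q , trans e (cong (_- L) (sym (proj₂ (low p))))

  -- Powers of the raising operator `f̃`.

  module Raising (ℓ : ℕ) (2≤ℓ : 2 ℕ.≤ ℓ) (L : ℤ) (L≡ℓ : L ≡ + ℓ) (i : ℕ) where

    open Characterisation ℓ 2≤ℓ L L≡ℓ
    open Signature ℓ 2≤ℓ L L≡ℓ i
    open Crystal ℓ i using (φ; ε; f̃; f̃^; ẽ; FirstRowConormal; conormal; normal)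

    plus? : ∀ l a → Dec (Plus l a)
    plus? l a with β l a ≈? + i | bead? l (β l a + + 1)
    ... | yes p | no gap = yes (p , gap)
    ... | no p  | _ = no (p ∘ proj₁)
    ... | _ | yes b = no (λ q → proj₂ q b)

    ≈⇒≢suc : ∀ {x y} → x ≈ y → x ≢ y + + 1
    ≈⇒≢suc {x} {y} p e = ≉-suc y (≈-trans (≈-reflexive (sym e)) p)

    -- Powers of `f̃` move the rows with a + from the top down; `T` is the row where they have
    -- stopped.
    record Raised (l m : Partition) (T : ℕ) : Set where
      field
        raised : ∀ {a} → a ℕ.< T → Plus l a → β m a ≡ β l a + + 1
        kept   : ∀ {a} → Plus l a → T ℕ.≤ a → β m a ≡ β l a
        other  : ∀ {a} → ¬ Plus l a → β m a ≡ β l a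

      status : ∀ a → β m a ≡ β l a ⊎ (a ℕ.< T × Plus l a × β m a ≡ β l a + + 1)
      status a with plus? l a | a ℕ.<? T
      ... | no p  | _ = inj₁ (other p)
      ... | yes p | yes q = inj₂ (q , p , raised q p)
      ... | yes p | no q = inj₁ (kept p (ℕ.≮⇒≥ q))

      high : ∀ {a} → T ℕ.≤ a → β m a ≡ β l a
      high {a} p with status a
      ... | inj₁ e = e
      ... | inj₂ (q , _) = ⊥-elim (ℕ.<⇒≱ q p)

      bead-from : ∀ {x} → Bead m x → Bead l x ⊎ ∃[ a ] a ℕ.< T × Plus l a × β l a + + 1 ≡ x
      bead-from (a , e) with status a
      ... | inj₁ e′ = inj₁ (a , trans (sym e′) e)
      ... | inj₂ (q , p , e′) = inj₂ (a , q , p , trans (sym e′) e)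

      bead-to : ∀ {x} → Bead l x → x ≉ + i → Bead m x
      bead-to (a , refl) x≉i = a , other (x≉i ∘ proj₁)

      plus⁻ : ∀ {a} → Plus m a → Plus l a × T ℕ.≤ a
      plus⁻ {a} (p , gap) with status a
      ... | inj₂ (_ , q , e) = ⊥-elim (≈⇒≢suc (≈-trans p (≈-sym (proj₁ q))) e)
      ... | inj₁ e = Pa , ℕ.≮⇒≥ λ q → ≈⇒≢suc ≈-refl (trans (sym e) (raised q Pa))
        where
        pl : β l a ≈ + i
        pl = subst (_≈ + i) e p
        Pa : Plus l a
        Pa = pl , λ b → gap (subst (Bead m) (cong (_+ + 1) (sym e)) (bead-to b
          λ q → ≈⇒≢suc (≈-trans q (≈-sym pl)) refl))

      plus⁺ : ∀ {a} → Plus l a → T ℕ.≤ a → Plus m a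
      plus⁺ {a} (p , gap) T≤a = subst (_≈ + i) (sym e) p , λ b → absurd (bead-from (subst (Bead m) (cong
          (_+ + 1) e) b))
        where
        e : β m a ≡ β l a
        e = kept (p , gap) T≤a
        cancel : ∀ x y → x + + 1 ≡ y + + 1 → x ≡ y
        cancel x y p = lin≡ p (solve (x :: y :: end))
        absurd : ¬ (Bead l (β l a + + 1) ⊎ ∃[ c ] c ℕ.< T × Plus l c × β l c + + 1 ≡ β l a + + 1)
        absurd (inj₁ b) = gap b
        absurd (inj₂ (c , c<T , _ , q)) = ℕ.<⇒≱ c<T (subst (T ℕ.≤_) (sym (β-injective l (cancel (β l c)
            (β l a) q))) T≤a)

      -- A + of `m` is an unmoved + of `l`, and the rows below it are unmoved too. A new gap just
      -- before the bead of row `c` is impossible: the bead that left it would have moved onto that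
      -- of row `c`.
      reduced⁺ : Reduced l → Reduced m
      reduced⁺ red {a} {c} a<c p (q , gap) = red a<c (proj₁ (plus⁻ p)) (subst (_≈ + i + + 1) e q , λ b →
          gap (subst (Bead m) (cong (_- + 1) (sym e)) (below b)))
        where
        e : β m c ≡ β l c
        e = high (ℕ.≤-trans (proj₂ (plus⁻ p)) (ℕ.<⇒≤ a<c))
        -1+1 : ∀ x y → x ≡ y - + 1 → y ≡ x + + 1
        -1+1 x y p = lin≡ (sym p) (solve (x :: y :: end))
        below : Bead l (β l c - + 1) → Bead m (β l c - + 1)
        below (k , r) with status k
        ... | inj₁ s = k , trans s r
        ... | inj₂ (_ , Pk , _) = ⊥-elim (proj₂ Pk (c , -1+1 (β l k) (β l c) r))

    raised-0 : ∀ l → Raised l l 0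
    raised-0 l = record { raised = λ () ; kept = λ _ _ → refl ; other = λ _ → refl }

    raise-step : ∀ {l m m′ T a} → Raised l m T → Plus m a → (∀ {c} → Plus m c → a ℕ.≤ c) → Changed m m′ a (+ 1)
        → Raised l m′ (suc a)
    raise-step {l} {m} {m′} {T} {a} S p low C = record
      { raised = raised′
      ; kept   = λ {c} q a<c → trans (Changed.other C c (λ e → ℕ.<⇒≢ a<c (sym e))) (S.kept q (ℕ.≤-trans T≤a
          (ℕ.<⇒≤ a<c)))
      ; other  = λ {c} q → trans (Changed.other C c (λ { refl → q (proj₁ (S.plus⁻ p)) })) (S.other q)
      }
      where
      module S = Raised S
      T≤a = proj₂ (S.plus⁻ p)
      raised′ : ∀ {c} → c ℕ.< suc a → Plus l c → β m′ c ≡ β l c + + 1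
      raised′ {c} c≤a q with c ℕ.<? T
      ... | yes c<T = trans (Changed.other C c (λ { refl → ℕ.<⇒≱ c<T T≤a })) (S.raised c<T q)
      ... | no c≮T with ℕ.≤-antisym (ℕ.≤-pred c≤a) (low (S.plus⁺ q (ℕ.≮⇒≥ c≮T)))
      ...   | refl = trans (Changed.at C) (cong (_+ + 1) (S.kept q T≤a))

    φ-rows : ∀ l → length (map (rowᵃ {l}) (conormal l)) ≡ φ l
    φ-rows l = length-map (rowᵃ {l}) (conormal l)

    ε-rows : ∀ l → length (map (rowʳ {l}) (normal l)) ≡ ε l
    ε-rows l = length-map (rowʳ {l}) (normal l)

    -- Each application removes exactly one row with a +; the count guarantees that one is left for
    -- the next application.
    raise-all : ∀ {l} → Reduced l → ∀ k → k ℕ.≤ φ l → ∃[ m ] f̃^ k l ≡ just m × ∃[ T ] Raised l m T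
        × φ m ℕ.+ k ≡ φ l
    raise-all {l} red zero _ = l , refl , 0 , raised-0 l , ℕ.+-identityʳ (φ l)
    raise-all {l} red (suc k) k<φ with raise-all red k (ℕ.<⇒≤ k<φ)
    ... | m , e , T , S , count with f̃-step {m} (Raised.reduced⁺ S red) (positive (φ m) count)
      where
      positive : ∀ n → n ℕ.+ k ≡ φ l → 0 ℕ.< n
      positive zero e = ⊥-elim (ℕ.<⇒≢ k<φ e)
      positive (suc n) e = ℕ.z<s
    ... | m′ , e′ , a , p , low , C = m′ , trans (cong (_>>= f̃) e) e′ , suc a , S′ ,
      trans (ℕ.+-suc (φ m′) k) (trans (cong (ℕ._+ k) (sym fewer)) count)
      where
      S′ : Raised l m′ (suc a)
      S′ = raise-step S p low C
      module S = Raised S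
      module S′ = Raised S′
      to : ∀ c → Plus m′ c → Plus m c × c ≢ a
      to c q with S′.plus⁻ q
      ... | Pc , a<c = S.plus⁺ Pc (ℕ.≤-trans (proj₂ (S.plus⁻ p)) (ℕ.<⇒≤ a<c)) , λ e → ℕ.<⇒≢ a<c (sym e)
      from : ∀ c → Plus m c → c ≢ a → Plus m′ c
      from c q c≢a = S′.plus⁺ (proj₁ (S.plus⁻ q)) (ℕ.≤∧≢⇒< (low q) (c≢a ∘ sym))
      fewer : φ m ≡ suc (φ m′)
      fewer = trans (sym (φ-rows m)) (trans (remove-length (conormal-rows {m} (S.reduced⁺ red))
          (conormal-rows {m′} (S′.reduced⁺ red)) p to from)
        (cong suc (φ-rows m′)))

    another : ∀ {P : ℕ → Set} {xs} → Enumerates P xs → 1 ℕ.< length xs → ∀ c → ∃[ a ] P a × a ≢ c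
    another {xs = x ∷ y ∷ xs} E _ c with x ℕ.≟ c
    ... | no x≢c = x , Enumerates.sound E (here refl) , x≢c
    ... | yes refl with Enumerates.unique E
    ...   | (x≢y ∷ _) ∷ _ = y , Enumerates.sound E (there (here refl)) , x≢y ∘ sym
    another {xs = _ ∷ []} E (s≤s ()) c

    -- The single + that survives is in the lowest row, since rows are moved from the top. The
    -- assumption `1 < φ l` supplies a moved row to compare it with.
    raise-but-last : ∀ {l} → Reduced l → 1 ℕ.< φ l → ∃[ m ] f̃^ (φ l ∸ 1) l ≡ just m × ∃[ c ] Raised l m c
        × Plus l c ×
                     (∀ {a} → Plus l a → a ℕ.≤ c) × ∃[ a ] Plus l a × a ℕ.< c
    raise-but-last {l} red 1<φ with raise-all {l} red (φ l ∸ 1) (ℕ.m∸n≤m (φ l) 1)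
    ... | m , e , T , S , count with conormal-rows {m} (Raised.reduced⁺ S red) | single
      where
      single : length (map (rowᵃ {m}) (conormal m)) ≡ 1
      single = trans (φ-rows m) (ℕ.+-cancelʳ-≡ (φ l ∸ 1) (φ m) 1 (trans count (sym (ℕ.m+[n∸m]≡n (ℕ.<⇒≤ 1<φ)))))
    ... | E | single with first (map (rowᵃ {m}) (conormal m)) E single
      where
      first : ∀ xs → Enumerates (Plus m) xs → length xs ≡ 1 → ∃[ c ] Plus m c
      first (c ∷ _) E _ = c , Enumerates.sound E (here refl)
    -- Among the rows with a + only `c` is at or beyond `T`, so `c` itself serves as the threshold.
    ... | c , p = m , e , c , record { raised = raised′ ; kept = λ q c≤a → S.kept q
          (ℕ.≤-trans T≤c c≤a) ; other = S.other } ,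
        proj₁ (S.plus⁻ p) , max , a , Pa , ℕ.≤∧≢⇒< (max Pa) a≢c
      where
      module S = Raised S
      T≤c = proj₂ (S.plus⁻ p)
      only : ∀ {a} → Plus l a → T ℕ.≤ a → a ≡ c
      only q T≤a = singleton E single (S.plus⁺ q T≤a) p
      max : ∀ {a} → Plus l a → a ℕ.≤ c
      max {a} q = ℕ.≮⇒≥ λ c<a → ℕ.<⇒≢ c<a (sym (only q (ℕ.≤-trans T≤c (ℕ.<⇒≤ c<a))))
      raised′ : ∀ {a} → a ℕ.< c → Plus l a → β m a ≡ β l a + + 1
      raised′ {a} a<c q with a ℕ.<? T
      ... | yes a<T = S.raised a<T q
      ... | no a≮T = ⊥-elim (ℕ.<⇒≢ a<c (only q (ℕ.≮⇒≥ a≮T)))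
      other-plus = another (conormal-rows {l} red) (subst (1 ℕ.<_) (sym (φ-rows l)) 1<φ) c
      a = proj₁ other-plus
      Pa = proj₁ (proj₂ other-plus)
      a≢c = proj₂ (proj₂ other-plus)

  ≺-trans : ∀ {x y z} → x ≺ y → y ≺ z → x ≺ z
  ≺-trans {x} p q = ≺-≤-trans {x} p (≺⇒≤ q)

  ≺⇒≢ : ∀ {x y} → x ≺ y → x ≢ y
  ≺⇒≢ {x} p refl = ≺-irrefl {x} p

  -- Both equivalences for beads.

  module Main (ℓ : ℕ) (2≤ℓ : 2 ℕ.≤ ℓ) (L : ℤ) (L≡ℓ : L ≡ + ℓ) (i : ℕ)
              {l κ : Partition} {r : ℕ} {t : ℤ}
              (S : Shapes.Shape ℓ 2≤ℓ L L≡ℓ l κ r t) (jm : Congruence.JM L (Hooks.2≤L ℓ 2≤ℓ L L≡ℓ) (Bead l)) where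

    open Characterisation ℓ 2≤ℓ L L≡ℓ
    open Signature ℓ 2≤ℓ L L≡ℓ i
    open Shapes ℓ 2≤ℓ L L≡ℓ
    open Raising ℓ 2≤ℓ L L≡ℓ i
    open Crystal ℓ i using (φ; ε; f̃^; ẽ; FirstRowConormal)
    open Shape S

    private
      I = + i

      t≺t+L : t ≺ t + L
      t≺t+L = lin (2≤L ⊕ 0≤ 1) (solve (t :: L :: end))

      reduced : Reduced l
      reduced = JM⇒reduced {l} jm

      lower≉ : ∀ {x y} → y ≈ x → t ≈ x → ¬ (t - L ≺ y × y ≺ t)
      lower≉ {x} {y} p q (t-L<y , y<t) = go (≈-step (≈-trans q (≈-sym p)) y<t)
        where
        go : ¬ (y + L ≤ t)
        go h = lin⊥ 0 (h ⊕ t-L<y) (solve (t :: y :: L :: end))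

      bead-row : ∀ {x} → Bead l x → x ≉ t → ∃[ a ] r ℕ.< a × β l a ≡ x
      bead-row (a , e) x≉t with r ℕ.<? a
      ... | yes p = a , p , e
      ... | no p = ⊥-elim (x≉t (subst (_≈ t) e (congruent (ℕ.≮⇒≥ p))))

      low-bead : ∀ {x} → Low l r t x → x ≺ t → Bead l x
      low-bead (inj₁ refl) p = ⊥-elim (≺-irrefl {t} p)
      low-bead (inj₂ (a , _ , e)) _ = a , e

      -- A bead right after that of row `a` would belong to a higher row, hence to the runner of `t`
      -- again.
      plus-row : t ≈ I → ∀ {a} → a ℕ.≤ r → Plus l a
      plus-row t≈I {a} a≤r = ≈-trans (congruent a≤r) t≈I , λ (k , e) →
        ≉-suc (β l a) (≈-trans (≈-reflexive (sym e)) (≈-trans (congruent (ℕ.≤-trans (ℕ.<⇒≤ (β-cancel-≺ l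
            (above e))) a≤r)) (≈-sym (congruent a≤r))))
        where
        above : ∀ {k} → β l k ≡ β l a + + 1 → β l a ≺ β l k
        above e = subst (β l a ≺_) (sym e) (≺-suc {β l a} ℤ.≤-refl)

      pred≉ : ∀ {x y} → x ≈ y → x - + 1 ≉ y
      pred≉ {x} p q = ≉-pred x (≈-trans q (≈-sym p))

      suc≉ : ∀ {x y} → x ≈ y → x + + 1 ≉ y
      suc≉ {x} p q = ≉-suc x (≈-trans q (≈-sym p))

      -- A bead right before would be off the runner of `t`, hence in a row below `r` and less than
      -- `t`. Row `r` is left out: its bead may be `t`, directly after such a bead.
      minus-row : t ≈ I + + 1 → ∀ {a} → a ℕ.< r → Minus l a
      minus-row t≈ {a} a<r = ≈-trans (congruent (ℕ.<⇒≤ a<r)) t≈ , λ b → absurd (bead-row b (pred≉ (congruent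
          (ℕ.<⇒≤ a<r))))
        where
        go : ∀ x → t + L ≤ x → t ≤ x - + 1
        go x p = lin (p ⊕ 2≤L ⊕ 0≤ 1) (solve (t :: x :: L :: end))
        absurd : ¬ (∃[ c ] r ℕ.< c × β l c ≡ β l a - + 1)
        absurd (c , r<c , e) = ≺⇒≱ {β l c} (lower r<c) (subst (t ≤_) (sym e) (go (β l a) (upper₁ a<r)))

    first-row : ∀ {x} → β l 0 ≈ x → t ≈ x
    first-row p = ≈-trans (≈-sym (congruent z≤n)) p

    module Part1 {m c} (R : Raised l m c) (Pc : Plus l c) (max : ∀ {a} → Plus l a → a ℕ.≤ c) where
      open Raised R

      module Sufficient (t≈I : t ≈ I) (κ0 : part κ r ≡ 0) (count : φ l ℕ.≤ suc r) where

        bounded : ∀ {a} → Plus l a → a ℕ.< suc r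
        bounded = initial-bound (conormal-rows {l} reduced) (suc r) (λ a<1+r → plus-row t≈I (ℕ.≤-pred a<1+r))
          (subst (ℕ._≤ suc r) (sym (φ-rows l)) count)

        c≡r : c ≡ r
        c≡r = ℕ.≤-antisym (ℕ.≤-pred (bounded Pc)) (max (plus-row t≈I ℕ.≤-refl))

        position : ∀ {x} → Bead m x → (∃[ a ] a ℕ.< r × x ≡ β l a + + 1) ⊎ x ≡ t ⊎ ∃[ a ] r ℕ.< a × β m a ≡ x
            × β l a ≡ x
        position (a , e) with ℕ.<-cmp a r
        ... | tri< a<r _ _ = inj₁ (a , a<r , trans (sym e) (raised (subst (a ℕ.<_) (sym c≡r) a<r) (plus-row t≈I
              (ℕ.<⇒≤ a<r))))
        ... | tri≈ _ refl _ = inj₂ (inj₁ (trans (sym e) (trans (high (ℕ.≤-reflexive c≡r)) (last-0 κ0))))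
        ... | tri> _ _ r<a = inj₂ (inj₂ (a , r<a , e , trans (sym (high (ℕ.≤-trans (ℕ.≤-reflexive c≡r)
              (ℕ.<⇒≤ r<a)))) e))

        lower-bead : ∀ {x} → ∃[ a ] r ℕ.< a × β l a ≡ x → Bead m x
        lower-bead (a , r<a , e) = a , trans (high (ℕ.≤-trans (ℕ.≤-reflexive c≡r) (ℕ.<⇒≤ r<a))) e

        raised≻ : ∀ {a} → a ℕ.< r → t + + 1 ≺ β l a + + 1
        raised≻ {a} a<r = go (β l a) (upper₁ a<r)
          where
          go : ∀ x → t + L ≤ x → t + + 1 ≺ x + + 1
          go x p = lin (p ⊕ 2≤L ⊕ 0≤ 1) (solve (t :: x :: L :: end))

        -- The rows above `r` have moved to the runner of `t + 1` beyond `t + 1`; row `r` stays at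
        -- `t`, and with the unmoved lower rows it forms the core.
        good : Good (Bead m) (t + + 1)
        good = record { gap = gap ; floor = floor ; above = above ; below = below }
          where
          gap : ¬ Bead m (t + + 1)
          gap b with position b
          ... | inj₁ (a , a<r , e) = ≺⇒≢ {t + + 1} (raised≻ a<r) e
          ... | inj₂ (inj₁ e) = ≉-suc t (≈-reflexive e)
          ... | inj₂ (inj₂ (a , r<a , _ , e)) = ≺⇒≢ {β l a} (≺-trans {β l a} (lower r<a) (≺-suc {t} ℤ.≤-refl)) e
          floor : Bead m (t + + 1 - L)
          floor with closed {t} (inj₁ refl)
          ... | a , r<a , e with bead? l (β l a + + 1)
          -- Otherwise the lower row with bead `t - L` would carry a +, one more than the count
          -- allows.
          ...   | no b = ⊥-elim (ℕ.<⇒≱ (bounded {a} (≈-trans (≈-trans (≈-reflexive e) (-L≈ t)) t≈I , b)) r<a)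
          ...   | yes b = subst (Bead m) (go (β l a) e) (lower-bead (bead-row b (suc≉ (≈-trans (≈-reflexive e)
                (-L≈ t)))))
            where
            go : ∀ x → x ≡ t - L → x + + 1 ≡ t + + 1 - L
            go x p = lin≡ p (solve (x :: t :: L :: end))
          above : ∀ x → Bead m x → t + + 1 ≺ x → x ≈ t + + 1
          above x b p with position b
          ... | inj₁ (a , a<r , refl) = ≈-+ (+ 1) (congruent (ℕ.<⇒≤ a<r))
          ... | inj₂ (inj₁ refl) = ⊥-elim (≺-irrefl {t} (≺-trans {t} (≺-suc {t} ℤ.≤-refl) p))
          ... | inj₂ (inj₂ (a , r<a , _ , refl)) =
            ⊥-elim (≺-irrefl {β l a} (≺-trans {β l a} (lower r<a) (≺-trans {t} (≺-suc {t} ℤ.≤-refl) p)))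
          below : ∀ x → Bead m x → x ≺ t + + 1 → Bead m (x - L)
          below x b p with position b
          ... | inj₁ (a , a<r , refl) = ⊥-elim (≺-irrefl {t + + 1} (≺-trans {t + + 1} (raised≻ a<r) p))
          ... | inj₂ (inj₁ refl) = lower-bead (closed (inj₁ refl))
          ... | inj₂ (inj₂ (a , r<a , _ , refl)) = lower-bead (closed (inj₂ (a , r<a , refl)))

      module Necessary (jm′ : JM (Bead m)) {a} (Pa : Plus l a) (a<c : a ℕ.< c) where

        private
          -- The place that the last + could have moved to. The moved bead of row `a` is congruent
          -- to `x` and above it, so `JM` for `m` puts all beads beyond `x` on the runner of
          -- `i + 1`.
          x = β l c + + 1

          x≈ : x ≈ I + + 1
          x≈ = ≈-+ (+ 1) (proj₁ Pc)

          x-gap : ¬ Bead m x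
          x-gap b with bead-from b
          ... | inj₁ b′ = proj₂ Pc b′
          ... | inj₂ (k , k<c , _ , e) = ℕ.<⇒≢ k<c (β-injective l (cancel (β l k) (β l c) e))
            where
            cancel : ∀ x y → x + + 1 ≡ y + + 1 → x ≡ y
            cancel x y p = lin≡ p (solve (x :: y :: end))

          step : β l c + L ≤ β l a
          step = ≈-step (≈-trans (proj₁ Pa) (≈-sym (proj₁ Pc))) (β-strict l a<c)

          x≺a : x ≺ β l a
          x≺a = go (β l a) (β l c) step ne
            where
            ne : β l c + + 1 ≢ β l a
            ne e = ≈⇒≢suc (≈-trans (proj₁ Pa) (≈-sym (proj₁ Pc))) (sym e)
            go : ∀ a c → c + L ≤ a → c + + 1 ≢ a → c + + 1 ≺ a
            go a c p ne with cmp (c + + 1) a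
            ... | inj₁ q = q
            ... | inj₂ (inj₁ e) = ⊥-elim (ne e)
            ... | inj₂ (inj₂ q) = ⊥-elim (lin⊥ 1 (p ⊕ q ⊕ 2≤L) (solve (a :: c :: L :: end)))

          a-raised : β m a ≡ β l a + + 1
          a-raised = raised a<c Pa

          beads-above : ∀ z → Bead m z → x ≺ z → z ≈ I + + 1
          beads-above z b p = ≈-trans (jm′ x (β l a + + 1) z x-gap (a , a-raised) b
            (≺-trans {x} x≺a (≺-suc {β l a} ℤ.≤-refl)) p (≈-+ (+ 1) (≈-trans (proj₁ Pa) (≈-sym (proj₁ Pc))))) x≈

          -- Flushness of the core would fill `x`, although row `c` carries a +.
          flush-absurd : ∀ {z} → Low l r t z → z ≈ I + + 1 → x ≤ z → x ≺ t → ⊥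
          flush-absurd low z≈ x≤z x≺t = proj₂ Pc (low-bead (low-flush low (≈-trans x≈ (≈-sym z≈)) x≤z) x≺t)

        -- If `t` were on another runner, the top row would be unmoved and beyond `x`, so
        -- `t ≈ i + 1`. The row `a` is then below `r`, and `x` lies below `t` on its runner, where
        -- the core leaves no gap.
        t≈I : t ≈ I
        t≈I with t ≈? I | t ≈? I + + 1
        ... | yes p | _ = p
        ... | no ¬p | no ¬q = ⊥-elim (¬q (first-row (beads-above (β l 0) (0 , other (¬p ∘ first-row ∘ proj₁))
                (≺-≤-trans {x} x≺a (β-antitone l z≤n)))))
        ... | no _ | yes q = ⊥-elim (flush-absurd {t} (inj₁ refl) q (≺⇒≤ {x} x≺t) x≺t)
          where
          r<a : r ℕ.< a
          r<a = ℕ.≰⇒> λ a≤r → ≉-suc I (≈-trans (≈-sym (≈-trans (congruent a≤r) q)) (proj₁ Pa))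
          x≺t : x ≺ t
          x≺t = ≺-trans {x} x≺a (lower r<a)

        -- If `c` were below `r`, the bead of row `suc r` would be beyond `x`. By `tight` it is off
        -- runner `i`, hence unmoved, so it is on the runner of `x`, and the core fills `x`.
        c≡r : c ≡ r
        c≡r with ℕ.m≤n⇒m<n∨m≡n (max (plus-row t≈I ℕ.≤-refl))
        ... | inj₂ e = sym e
        ... | inj₁ r<c = ⊥-elim (flush-absurd (inj₂ (suc r , ℕ.n<1+n r , refl))
                (beads-above z z-bead x≺z) (≺⇒≤ {x} x≺z) (≺-trans {x} x≺z (lower (ℕ.n<1+n r))))
          where
          z = β l (suc r)
          z≉I : z ≉ I
          z≉I p = lower≉ p t≈I (tight , lower (ℕ.n<1+n r))
          z-bead : Bead m z
          z-bead = suc r , other (z≉I ∘ proj₁)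
          x≤z : x ≤ z
          x≤z = go (β l c) z (≈-step (≈-trans t≈I (≈-sym (proj₁ Pc))) (lower r<c)) tight
            where
            go : ∀ c z → c + L ≤ t → t - L ≺ z → c + + 1 ≤ z
            go c z p q = lin (p ⊕ q) (solve (c :: z :: t :: L :: end))
          x≺z : x ≺ z
          x≺z with cmp x z
          ... | inj₁ p = p
          ... | inj₂ (inj₁ e) = ⊥-elim (proj₂ Pc (suc r , sym e))
          ... | inj₂ (inj₂ p) = ⊥-elim (≺⇒≱ {z} p x≤z)

        -- Otherwise `t` is a gap of `m` with row `r`, left behind on its runner, and row `a`, moved
        -- to the next runner, both above it.
        κ≡0 : part κ r ≡ 0
        κ≡0 with part κ r ℕ.≟ 0
        ... | yes e = e
        ... | no ne = ⊥-elim (suc≉ (congruent (ℕ.<⇒≤ a<r)) (jm′ t (β l r) (β l a + + 1) t-gap (r , high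
              (ℕ.≤-reflexive c≡r)) (a , a-raised)
                t≺r (≺-trans {t} t≺r (≺-trans {β l r} (β-strict l a<r) (≺-suc {β l a} ℤ.≤-refl)))
                    (congruent ℕ.≤-refl)))
          where
          a<r : a ℕ.< r
          a<r = subst (a ℕ.<_) c≡r a<c
          t≺r : t ≺ β l r
          t≺r = ≺-≤-trans {t} t≺t+L (last-pos ne)
          t-gap : ¬ Bead m t
          t-gap b with bead-from b
          ... | inj₂ (k , k<c , _ , e) = ≺⇒≢ {t} (≺-trans {t} (≺-≤-trans {t} t≺t+L (upper₁ (subst
                (k ℕ.<_) c≡r k<c))) (≺-suc {β l k} ℤ.≤-refl)) (sym e)
          ... | inj₁ (k , e) with r ℕ.<? k
          ...   | yes r<k = ≺⇒≢ {β l k} (lower r<k) e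
          ...   | no r≮k = ≺⇒≢ {t} (≺-≤-trans {t} t≺r (β-antitone l (ℕ.≮⇒≥ r≮k))) (sym e)

        count : φ l ≡ suc r
        count = trans (sym (φ-rows l)) (ℕ.≤-antisym
          (length≤bound (conormal-rows {l} reduced) (suc r) (λ p → s≤s (subst (_ ℕ.≤_) c≡r (max p))))
          (initial-length≤ (conormal-rows {l} reduced) (suc r) (λ p → plus-row t≈I (ℕ.≤-pred p))))

    module Part2 {m c} (C : Changed l m c (- (+ 1))) (Mc : Minus l c) (max : ∀ {a} → Minus l a → a ℕ.≤ c) where
      open Changed C

      bead-from : ∀ {x} → Bead m x → (∃[ a ] a ≢ c × β l a ≡ x) ⊎ β l c - + 1 ≡ x
      bead-from (a , e) with a ℕ.≟ c
      ... | yes refl = inj₂ (trans (sym at) e)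
      ... | no a≢c = inj₁ (a , a≢c , trans (sym (other a a≢c)) e)

      bead-to : ∀ {a} → a ≢ c → Bead m (β l a)
      bead-to {a} a≢c = a , other a a≢c

      private
        above-t : ∀ {x} → t + L ≤ x → t ≺ x - + 1
        above-t {x} p = go x p 2≤L
          where
          go : ∀ x → t + L ≤ x → + 2 ≤ L → t ≺ x - + 1
          go x p q = lin (p ⊕ q) (solve (t :: x :: L :: end))

        above-t+L : ∀ {x} → t + L + L ≤ x → t + L ≺ x - + 1
        above-t+L {x} p = go x p 2≤L
          where
          go : ∀ x → t + L + L ≤ x → + 2 ≤ L → t + L ≺ x - + 1
          go x p q = lin (p ⊕ q) (solve (t :: x :: L :: end))

        ≺-last : t + L ≺ t + L + L
        ≺-last = lin (2≤L ⊕ 0≤ 1) (solve (t :: L :: end))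

      module Necessary (jm′ : JM (Bead m)) {a} (Ma : Minus l a) (a<c : a ℕ.< c) where

        private
          a≢c : a ≢ c
          a≢c = ℕ.<⇒≢ a<c

          -- The vacated position is the gap to test: row `a` is congruent to it, so all rows above
          -- `c` must be on the runner of `i + 1`.
          x-gap : ¬ Bead m (β l c)
          x-gap b with bead-from b
          ... | inj₁ (k , k≢c , e) = k≢c (β-injective l e)
          ... | inj₂ e = ≺⇒≢ {β l c - + 1} (pred-≺ (β l c)) e

          beads-above : ∀ {k} → k ℕ.< c → β l k ≈ I + + 1
          beads-above {k} k<c = ≈-trans (jm′ (β l c) (β l a) (β l k) x-gap (bead-to a≢c) (bead-to (ℕ.<⇒≢ k<c))
            (β-strict l a<c) (β-strict l k<c) (≈-trans (proj₁ Ma) (≈-sym (proj₁ Mc)))) (proj₁ Mc)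

        t≈ : t ≈ I + + 1
        t≈ = first-row (beads-above (ℕ.≤-<-trans z≤n a<c))

        -- Otherwise row `suc r` is `c` or above it, hence on the runner of `t`, against `tight`.
        c≤r : c ℕ.≤ r
        c≤r = ℕ.≮⇒≥ λ r<c → lower≉ (beads-above′ (ℕ.m≤n⇒m<n∨m≡n r<c)) t≈ (tight , lower (ℕ.n<1+n r))
          where
          beads-above′ : suc r ℕ.< c ⊎ suc r ≡ c → β l (suc r) ≈ I + + 1
          beads-above′ (inj₁ p) = beads-above p
          beads-above′ (inj₂ refl) = proj₁ Mc

        count : ∀ {n} → c ≡ n → (∀ {k} → k ℕ.≤ n → Minus l k) → ε l ≡ suc n
        count {n} refl minus = trans (sym (ε-rows l)) (ℕ.≤-antisym
          (length≤bound (normal-rows {l} reduced) (suc n) (λ p → s≤s (max p)))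
          (initial-length≤ (normal-rows {l} reduced) (suc n) (λ p → minus (ℕ.≤-pred p))))

        -- Otherwise `t` is a gap, with row `a` on its runner and the moved bead of row `r` off it.
        κ-last : c ≡ r → part κ r ≡ 0
        κ-last refl with part κ r ℕ.≟ 0
        ... | yes e = e
        ... | no ne = ⊥-elim (pred≉ (congruent ℕ.≤-refl) (jm′ t (β l a) (β l r - + 1) t-gap (bead-to a≢c) (r , at)
                (≺-≤-trans {t} t≺t+L (upper₁ a<c)) (above-t (last-pos ne)) (congruent (ℕ.<⇒≤ a<c))))
          where
          t-gap : ¬ Bead m t
          t-gap b with bead-from b
          ... | inj₂ e = ≺⇒≢ {t} (above-t (last-pos ne)) (sym e)
          ... | inj₁ (k , k≢r , e) with ℕ.<-cmp k r
          ...   | tri< k<r _ _ = ≺⇒≢ {t} (≺-≤-trans {t} t≺t+L (upper₁ k<r)) (sym e)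
          ...   | tri≈ _ k≡r _ = k≢r k≡r
          ...   | tri> _ _ r<k = ≺⇒≢ {β l k} (lower r<k) e

        -- The same argument one step higher: row `r` stays at or below `t`, so `t + L` is a gap if
        -- `κ` is positive in row `c`.
        κ-previous : r ≡ suc c → part κ c ≡ 0
        κ-previous r≡ with part κ c ℕ.≟ 0
        ... | yes e = e
        ... | no ne = ⊥-elim (pred≉ {y = t + L} (≈-trans (congruent c≤r) (≈-sym (+L≈ t))) (jm′ (t + L) (β l a)
              (β l c - + 1) t+L-gap
                (bead-to a≢c) (c , at) (≺-≤-trans {t + L} ≺-last (upper₂ (subst (suc a ℕ.<_) (sym r≡) (s≤s a<c))))
                (above-t+L (previous-pos r≡ ne)) (≈-trans (congruent (ℕ.≤-trans (ℕ.<⇒≤ a<c) c≤r)) (≈-sym (+L≈ t)))))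
          where
          c<r : c ℕ.< r
          c<r = ℕ.≤-reflexive (sym r≡)
          -- Row `r` carries no -, so a bead precedes it directly; being off the runner of `t`, that
          -- bead belongs to a lower row and is less than `t`.
          last≤t : β l r ≤ t
          last≤t with bead? l (β l r - + 1)
          ... | no b = ⊥-elim (ℕ.<⇒≱ c<r (max (≈-trans (congruent ℕ.≤-refl) t≈ , b)))
          ... | yes b with bead-row b (pred≉ (congruent ℕ.≤-refl))
          ...   | k , r<k , e = go (β l r) (subst (_≺ t) e (lower r<k))
            where
            go : ∀ x → x - + 1 ≺ t → x ≤ t
            go x p = lin p (solve (x :: t :: end))
          t+L-gap : ¬ Bead m (t + L)
          t+L-gap b with bead-from b
          ... | inj₂ e = ≺⇒≢ {t + L} (above-t+L (previous-pos r≡ ne)) (sym e)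
          ... | inj₁ (k , k≢c , e) with ℕ.<-cmp k c
          ...   | tri< k<c _ _ = ≺⇒≢ {t + L} (≺-≤-trans {t + L} ≺-last (upper₂ (subst (suc k ℕ.<_) (sym r≡)
                (s≤s k<c)))) (sym e)
          ...   | tri≈ _ k≡c _ = k≢c k≡c
          ...   | tri> _ _ c<k = ≺⇒≢ {β l k} (≤-≺-trans {β l k} (ℤ.≤-trans (β-antitone l (subst (ℕ._≤ k)
                (sym r≡) c<k)) last≤t) t≺t+L) e

        conclusion : (ε l ≡ r × part κ (r ∸ 1) ≡ 0) ⊎ (ε l ≡ suc r × part κ r ≡ 0)
        conclusion = cases (ℕ.m≤n⇒m<n∨m≡n c≤r)
          where
          minus : c ≡ r → ∀ {k} → k ℕ.≤ r → Minus l k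
          minus c≡r k≤r with ℕ.m≤n⇒m<n∨m≡n k≤r
          ... | inj₁ k<r = minus-row t≈ k<r
          ... | inj₂ refl = subst (Minus l) c≡r Mc
          r≡ : c ℕ.< r → r ≡ suc c
          r≡ c<r = ℕ.≤-antisym (ℕ.≮⇒≥ λ p → ℕ.<⇒≱ (ℕ.n<1+n c) (max (minus-row t≈ p))) c<r
          cases : c ℕ.< r ⊎ c ≡ r → (ε l ≡ r × part κ (r ∸ 1) ≡ 0) ⊎ (ε l ≡ suc r × part κ r ≡ 0)
          cases (inj₂ c≡r) = inj₂ (count c≡r (minus c≡r) , κ-last c≡r)
          cases (inj₁ c<r) = inj₁ (trans (count refl (λ k≤c → minus-row t≈ (ℕ.≤-<-trans k≤c c<r))) (sym (r≡ c<r)) ,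
            trans (cong (λ n → part κ (n ∸ 1)) (r≡ c<r)) (κ-previous (r≡ c<r)))

      module Sufficient (t≈ : t ≈ I + + 1) where

        minus-upto : Minus l r → ∀ {a} → a ℕ.≤ r → Minus l a
        minus-upto Mr a≤r with ℕ.m≤n⇒m<n∨m≡n a≤r
        ... | inj₁ a<r = minus-row t≈ a<r
        ... | inj₂ refl = Mr

        -- A - needs a gap on the runner of `t - 1`, but the core fills this runner from `x` down.
        no-minus-below : ∀ {a x} → Low l r t x → x ≺ t → x ≈ t - + 1 → r ℕ.< a → Minus l a → β l a ≤ x → ⊥
        no-minus-below {a} {x} low x≺t x≈ r<a (p , gap) a≤x = gap (low-bead
          (low-flush low (≈-trans (≈-+ (- (+ 1)) (≈-trans p (≈-sym t≈))) (≈-sym x≈)) (ℤ.≤-trans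
              (≺⇒≤ {β l a - + 1} (pred-≺ (β l a))) a≤x))
          (≺-trans {β l a - + 1} (pred-≺ (β l a)) (lower r<a)))

        lower-bead : c ℕ.≤ r → ∀ {x} → ∃[ a ] r ℕ.< a × β l a ≡ x → Bead m x
        lower-bead c≤r (a , r<a , refl) = bead-to (λ e → ℕ.<⇒≱ r<a (subst (ℕ._≤ r) (sym e) c≤r))

        -- All rows above `r` carry a -, so `ε` decides whether row `r` does, that is, whether
        -- `t - 1` is vacant.
        module LastRow (βr≡t : β l r ≡ t) where

          last-minus : ε l ≡ suc r → Minus l r
          last-minus len = cases (bead? l (t - + 1))
            where
            bounded : Bead l (t - + 1) → ∀ {a} → Minus l a → a ℕ.< r
            bounded b {a} p with ℕ.<-cmp a r
            ... | tri< a<r _ _ = a<r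
            ... | tri≈ _ refl _ = ⊥-elim (proj₂ p (subst (λ y → Bead l (y - + 1)) (sym βr≡t) b))
            ... | tri> _ _ r<a = ⊥-elim (no-minus-below (inj₂ (bead-row b (≉-pred t))) (pred-≺ t) ≈-refl r<a p
                  (≺⇒≤pred {β l a} (lower r<a)))
            cases : Dec (Bead l (t - + 1)) → Minus l r
            cases (no b) = ≈-trans (congruent ℕ.≤-refl) t≈ , subst (λ y → ¬ Bead l (y - + 1)) (sym βr≡t) b
            cases (yes b) = ⊥-elim (ℕ.<⇒≱ (ℕ.≤-reflexive (trans (sym len) (sym (ε-rows l))))
              (length≤bound (normal-rows {l} reduced) r (bounded b)))

          no-last-minus : ε l ≡ r → Bead l (t - + 1)
          no-last-minus len = cases (bead? l (t - + 1))
            where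
            minus : ¬ Bead l (t - + 1) → ∀ {a} → a ℕ.< suc r → Minus l a
            minus b a<1+r = minus-upto (≈-trans (congruent ℕ.≤-refl) t≈ , subst (λ y → ¬ Bead l (y - + 1))
                (sym βr≡t) b) (ℕ.≤-pred a<1+r)
            cases : Dec (Bead l (t - + 1)) → Bead l (t - + 1)
            cases (yes b) = b
            cases (no b) = ⊥-elim (ℕ.<⇒≱ (initial-length≤ (normal-rows {l} reduced) (suc r) (minus b))
                (ℕ.≤-reflexive (trans (ε-rows l) len)))

        module AllRows (βr≡t : β l r ≡ t) (Mr : Minus l r) (bounded : ∀ {a} → Minus l a → a ℕ.< suc r) where

          c≡r : c ≡ r
          c≡r = ℕ.≤-antisym (ℕ.≤-pred (bounded Mc)) (max Mr)

          position : ∀ {x} → Bead m x → (∃[ a ] a ℕ.< r × β l a ≡ x) ⊎ x ≡ t - + 1 ⊎ ∃[ a ] r ℕ.< a × β l a ≡ x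
          position b with bead-from b
          ... | inj₂ e = inj₂ (inj₁ (trans (sym e) (cong (_- + 1) (trans (cong (β l) c≡r) βr≡t))))
          ... | inj₁ (a , a≢c , e) with ℕ.<-cmp a r
          ...   | tri< a<r _ _ = inj₁ (a , a<r , e)
          ...   | tri≈ _ a≡r _ = ⊥-elim (a≢c (trans a≡r (sym c≡r)))
          ...   | tri> _ _ r<a = inj₂ (inj₂ (a , r<a , e))

          t≺upper : ∀ {a} → a ℕ.< r → t ≺ β l a
          t≺upper a<r = ≺-≤-trans {t} t≺t+L (upper₁ a<r)

          lower′ : ∀ {x} → ∃[ a ] r ℕ.< a × β l a ≡ x → Bead m x
          lower′ = lower-bead (ℕ.≤-reflexive c≡r)

          -- Row `r` has moved to `t - 1` and vacated `t`; the lower rows keep `t - L` occupied.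
          good : Good (Bead m) t
          good = record { gap = gap ; floor = lower′ (closed (inj₁ refl)) ; above = above ; below = below }
            where
            gap : ¬ Bead m t
            gap b with position b
            ... | inj₁ (a , a<r , e) = ≺⇒≢ {t} (t≺upper a<r) (sym e)
            ... | inj₂ (inj₁ e) = ≺⇒≢ {t - + 1} (pred-≺ t) (sym e)
            ... | inj₂ (inj₂ (a , r<a , e)) = ≺⇒≢ {β l a} (lower r<a) e
            above : ∀ x → Bead m x → t ≺ x → x ≈ t
            above x b p with position b
            ... | inj₁ (a , a<r , refl) = congruent (ℕ.<⇒≤ a<r)
            ... | inj₂ (inj₁ refl) = ⊥-elim (≺-irrefl {t} (≺-trans {t} p (pred-≺ t)))
            ... | inj₂ (inj₂ (a , r<a , refl)) = ⊥-elim (≺-irrefl {t} (≺-trans {t} p (lower r<a)))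
            below : ∀ x → Bead m x → x ≺ t → Bead m (x - L)
            below x b p with position b
            ... | inj₁ (a , a<r , refl) = ⊥-elim (≺-irrefl {t} (≺-trans {t} (t≺upper a<r) p))
            ... | inj₂ (inj₂ (a , r<a , refl)) = lower′ (closed (inj₂ (a , r<a , refl)))
            ... | inj₂ (inj₁ refl) with closed {t} (inj₁ refl)
            ...   | a , r<a , e with bead? l (β l a - + 1)
            -- The moved bead `t - 1` needs `t - 1 - L` below it. If that were vacant, the row with
            -- bead `t - L` would carry a -.
            ...     | no b′ = ⊥-elim (ℕ.<⇒≱ (bounded {a} (≈-trans (≈-trans (≈-reflexive e) (-L≈ t)) t≈ , b′)) r<a)
            ...     | yes b′ = subst (Bead m) (go (β l a) e) (lower′ (bead-row b′ (pred≉ (≈-trans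
                  (≈-reflexive e) (-L≈ t)))))
              where
              go : ∀ x → x ≡ t - L → x - + 1 ≡ t - + 1 - L
              go x p = lin≡ p (solve (x :: t :: L :: end))

        module AllButLast {c₁} (r≡ : r ≡ suc c₁) (βr≡t : β l r ≡ t) (κ0 : part κ c₁ ≡ 0)
                          (left : Bead l (t - + 1)) (bounded : ∀ {a} → Minus l a → a ℕ.< r) where

          c≡c₁ : c ≡ c₁
          c≡c₁ = ℕ.≤-antisym (ℕ.≤-pred (subst (c ℕ.<_) r≡ (bounded Mc))) (max (minus-row t≈ (ℕ.≤-reflexive
              (sym r≡))))
          c<r : c ℕ.< r
          c<r = ℕ.≤-reflexive (trans (cong suc c≡c₁) (sym r≡))
          moved : β l c ≡ t + L
          moved = trans (cong (β l) c≡c₁) (previous-0 r≡ κ0)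

          position : ∀ {x} → Bead m x → (∃[ a ] a ℕ.< c × β l a ≡ x) ⊎ x ≡ t + L - + 1 ⊎ Low l r t x
          position b with bead-from b
          ... | inj₂ e = inj₂ (inj₁ (trans (sym e) (cong (_- + 1) moved)))
          ... | inj₁ (a , a≢c , e) with ℕ.<-cmp a c
          ...   | tri< a<c _ _ = inj₁ (a , a<c , e)
          ...   | tri≈ _ a≡c _ = ⊥-elim (a≢c a≡c)
          ...   | tri> _ _ c<a = inj₂ (inj₂ (low (ℕ.m≤n⇒m<n∨m≡n (subst (ℕ._≤ a) (trans (cong suc c≡c₁)
                (sym r≡)) c<a)) e))
            where
            low : ∀ {a x} → r ℕ.< a ⊎ r ≡ a → β l a ≡ x → Low l r t x
            low (inj₁ r<a) e = inj₂ (_ , r<a , e)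
            low (inj₂ r≡a) e = inj₁ (trans (sym e) (trans (cong (β l) (sym r≡a)) βr≡t))

          low≺ : ∀ {x} → Low l r t x → x ≺ t + L
          low≺ {x} p = ≺-≤-trans {x} (low-bound p) (go 2≤L)
            where
            go : + 2 ≤ L → t + + 1 ≤ t + L
            go h = lin (h ⊕ 0≤ 1) (solve (t :: L :: end))

          ≺upper : ∀ {a} → a ℕ.< c → t + L ≺ β l a
          ≺upper {a} a<c = ≺-≤-trans {t + L} ≺-last (upper₂ (ℕ.≤-<-trans a<c c<r))

          lower′ : ∀ {x} → ∃[ a ] r ℕ.< a × β l a ≡ x → Bead m x
          lower′ = lower-bead (ℕ.<⇒≤ c<r)

          -- Row `r - 1` has vacated `t + L`, and row `r` at `t` is the floor. The moved bead
          -- `t + L - 1` joins a flush runner because `t - 1` is occupied by `left`.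
          good : Good (Bead m) (t + L)
          good = record { gap = gap ; floor = floor ; above = above ; below = below }
            where
            gap : ¬ Bead m (t + L)
            gap b with position b
            ... | inj₁ (a , a<c , e) = ≺⇒≢ {t + L} (≺upper a<c) (sym e)
            ... | inj₂ (inj₁ e) = ≺⇒≢ {t + L - + 1} (pred-≺ (t + L)) (sym e)
            ... | inj₂ (inj₂ p) = ≺-irrefl {t + L} (low≺ p)
            floor : Bead m (t + L - L)
            floor = subst (Bead m) (trans βr≡t (go t L)) (bead-to (ℕ.<⇒≢ c<r ∘ sym))
              where
              go : ∀ t L → t ≡ t + L - L
              go t L = solve (t :: L :: end)
            above : ∀ x → Bead m x → t + L ≺ x → x ≈ t + L
            above x b p with position b
            ... | inj₁ (a , a<c , refl) = ≈-trans (congruent (ℕ.<⇒≤ (ℕ.<-trans a<c c<r))) (≈-sym (+L≈ t))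
            ... | inj₂ (inj₁ refl) = ⊥-elim (≺-irrefl {t + L} (≺-trans {t + L} p (pred-≺ (t + L))))
            ... | inj₂ (inj₂ q) = ⊥-elim (≺-irrefl {t + L} (≺-trans {t + L} p (low≺ q)))
            below : ∀ x → Bead m x → x ≺ t + L → Bead m (x - L)
            below x b p with position b
            ... | inj₁ (a , a<c , refl) = ⊥-elim (≺-irrefl {t + L} (≺-trans {t + L} (≺upper a<c) p))
            ... | inj₂ (inj₁ refl) = subst (Bead m) (go t L) (lower′ (bead-row left (≉-pred t)))
              where
              go : ∀ t L → t - + 1 ≡ t + L - + 1 - L
              go t L = solve (t :: L :: end)
            ... | inj₂ (inj₂ q) = lower′ (closed q)

        all-rows : part κ r ≡ 0 → ε l ≡ suc r → JM (Bead m)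
        all-rows κ0 len = good⇒JM (AllRows.good βr≡t Mr
          (initial-bound (normal-rows {l} reduced) (suc r) minus (ℕ.≤-reflexive (trans (ε-rows l) len))))
          where
          βr≡t : β l r ≡ t
          βr≡t = last-0 κ0
          Mr : Minus l r
          Mr = LastRow.last-minus βr≡t len
          minus : ∀ {a} → a ℕ.< suc r → Minus l a
          minus a<1+r = minus-upto Mr (ℕ.≤-pred a<1+r)

        all-but-last : ∀ {c₁} → r ≡ suc c₁ → part κ c₁ ≡ 0 → ε l ≡ r → JM (Bead m)
        all-but-last {c₁} r≡ κ0 len = good⇒JM (AllButLast.good r≡ βr≡t κ0 (LastRow.no-last-minus βr≡t len)
          (initial-bound (normal-rows {l} reduced) r (minus-row t≈) (ℕ.≤-reflexive (trans (ε-rows l) len))))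
          where
          βr≡t : β l r ≡ t
          -- The parts of `κ` decrease, so row `r` of `κ` vanishes with row `r - 1`.
          βr≡t = last-0 (ℕ.n≤0⇒n≡0 (subst (part κ r ℕ.≤_) κ0 (subst (λ n → part κ n ℕ.≤ part κ c₁) (sym r≡)
              (decreasing κ c₁))))

  any-just : ∀ {A : Set} {P : A → Set} {x : Maybe A} {y} → x ≡ just y → MaybeAny.Any P x → P y
  any-just refl (MaybeAny.just p) = p

  just-any : ∀ {A : Set} {P : A → Set} {x : Maybe A} {y} → x ≡ just y → P y → MaybeAny.Any P x
  just-any refl p = MaybeAny.just p

  -- Translation back to partitions and the crystal.

  module Theorem {ℓ i : ℕ} (2≤ℓ : 2 ℕ.≤ ℓ) {l μ : Partition} {r : ℕ} {κ : Partition}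
                 (D : Decomposition ℓ l μ r κ) (P : Characterisation.Persistent ℓ 2≤ℓ (+ ℓ) refl l) where

    open Characterisation ℓ 2≤ℓ (+ ℓ) refl
    open Shapes ℓ 2≤ℓ (+ ℓ) refl using (Shape; decomposition⇒shape)
    open Signature ℓ 2≤ℓ (+ ℓ) refl i using (Reduced; JM⇒reduced; f̃-step; ẽ-step; firstRowConormal⇔; Plus; Minus)
    open Raising ℓ 2≤ℓ (+ ℓ) refl i using (raise-but-last; Raised)
    open Crystal ℓ i using (φ; ε; f̃^; ẽ; FirstRowConormal)
    module Successor = Signature ℓ 2≤ℓ (+ ℓ) refl (suc i)

    jm : JM (Bead l)
    jm = persistent⇒JM P

    S : Shape l κ r (β μ 0 - + r)
    S = decomposition⇒shape {l} {μ} D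

    open Main ℓ 2≤ℓ (+ ℓ) refl i {l} {κ} S jm

    reduced : Reduced l
    reduced = JM⇒reduced {l} jm

    ℓPartition⇒JM : ∀ m → IsℓPartition ℓ m → JM (Bead m)
    ℓPartition⇒JM m p = persistent⇒JM {m} (proj₂ p)

    row-0 : β l 0 ≈ β μ 0 - + r
    row-0 = Shape.congruent S z≤n

    next-first-row : Crystal.FirstRowConormal ℓ (suc i) l ⇔ β l 0 ≈ + i + + 1
    next-first-row = subst (λ x → Crystal.FirstRowConormal ℓ (suc i) l ⇔ β l 0 ≈ x) (ℤ.+-comm (+ 1) (+ i))
      (Successor.firstRowConormal⇔ (Successor.JM⇒reduced {l} jm))

    Part1Conclusion Part2Conclusion : Set
    Part1Conclusion = part κ r ≡ 0 × FirstRowConormal l × φ l ≡ suc r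
    Part2Conclusion = Crystal.FirstRowConormal ℓ (suc i) l × ((ε l ≡ r × part κ (r ∸ 1) ≡ 0) ⊎ (ε l ≡ suc r
        × part κ r ≡ 0))

    part1 : 1 ℕ.< φ l → MaybeAny.Any (IsℓPartition ℓ) (f̃^ (φ l ∸ 1) l) ⇔ Part1Conclusion
    part1 1<φ = go (raise-but-last {l} reduced 1<φ)
      where
      go : (∃[ m ] f̃^ (φ l ∸ 1) l ≡ just m × ∃[ c ] Raised l m c × Plus l c × (∀ {a} → Plus l a → a ℕ.≤ c)
          × ∃[ a ] Plus l a × a ℕ.< c) →
           MaybeAny.Any (IsℓPartition ℓ) (f̃^ (φ l ∸ 1) l) ⇔ Part1Conclusion
      go (m , e , c , R , Pc , max , a , Pa , a<c) = mk⇔ (to ∘ any-just e) (just-any e ∘ from)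
        where
        module P = Part1 {m} {c} R Pc max
        to : IsℓPartition ℓ m → Part1Conclusion
        to q = N.κ≡0 , Equivalence.from (firstRowConormal⇔ {l} reduced) (≈-trans row-0 N.t≈I) , N.count
          where
          module N = P.Necessary (ℓPartition⇒JM m q) Pa a<c
        from : Part1Conclusion → IsℓPartition ℓ m
        from (κ0 , first , len) = JM⇒ℓPartition m
          (good⇒JM (P.Sufficient.good (first-row (Equivalence.to (firstRowConormal⇔ {l} reduced) first)) κ0
              (ℕ.≤-reflexive len)))

    part2 : 1 ℕ.< ε l → MaybeAny.Any (IsℓPartition ℓ) (ẽ l) ⇔ Part2Conclusion
    part2 1<ε = go (ẽ-step {l} reduced 1<ε)
      where
      go : (∃[ m ] ẽ l ≡ just m × ∃[ c ] Minus l c × (∀ {a} → Minus l a → a ℕ.≤ c) × Changed l m c (- (+ 1))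
          × ∃[ a ] Minus l a × a ℕ.< c) →
           MaybeAny.Any (IsℓPartition ℓ) (ẽ l) ⇔ Part2Conclusion
      go (m , e , c , Mc , max , C , a , Ma , a<c) = mk⇔ (to ∘ any-just e) (just-any e ∘ from)
        where
        module P = Part2 {m} {c} C Mc max
        to : IsℓPartition ℓ m → Part2Conclusion
        to q = Equivalence.from next-first-row (≈-trans row-0 N.t≈) , N.conclusion
          where
          module N = P.Necessary (ℓPartition⇒JM m q) Ma a<c
        from : Part2Conclusion → IsℓPartition ℓ m
        from (first , cases) = JM⇒ℓPartition m (jm′ cases)
          where
          t≈ : β μ 0 - + r ≈ + i + + 1
          t≈ = first-row (Equivalence.to next-first-row first)
          jm′ : (ε l ≡ r × part κ (r ∸ 1) ≡ 0) ⊎ (ε l ≡ suc r × part κ r ≡ 0) → JM (Bead m)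
          jm′ (inj₂ (len , κ0)) = P.Sufficient.all-rows t≈ κ0 len
          -- Since `1 < ε l` and `ε l ≡ r`, the row `r` is positive and the truncated `r ∸ 1` is a
          -- true predecessor.
          jm′ (inj₁ (len , κ0)) = P.Sufficient.all-but-last t≈ (sym (ℕ.m+[n∸m]≡n (subst (1 ℕ.≤_) len
              (ℕ.<⇒≤ 1<ε)))) κ0 len

open import Data.Nat.Base using (ℕ; suc; _≤_; _<_; _∸_)
open import Data.Product.Base using (_×_; _,_)
open import Data.Sum.Base using (_⊎_)
open import Data.Maybe.Relation.Unary.Any using (Any)
open import Function.Bundles using (_⇔_)
open import Relation.Binary.PropositionalEquality using (_≡_)
open Crystal using (φ; ε; f̃^; ẽ; FirstRowConormal)

theorem2p4p2p4 : (ℓ i : ℕ) → 2 ≤ ℓ → i < ℓ →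
    (l μ : Partition) (r : ℕ) (κ : Partition) →
    Decomposition ℓ l μ r κ → IsℓPartition ℓ l →
    (1 < φ ℓ i l →
    Any (IsℓPartition ℓ) (f̃^ ℓ i (φ ℓ i l ∸ 1) l)
    ⇔ (part κ r ≡ 0 × FirstRowConormal ℓ i l × φ ℓ i l ≡ suc r))
    × (1 < ε ℓ i l →
    Any (IsℓPartition ℓ) (ẽ ℓ i l)
    ⇔ (FirstRowConormal ℓ (suc i) l
    × ((ε ℓ i l ≡ r × part κ (r ∸ 1) ≡ 0)
    ⊎ (ε ℓ i l ≡ suc r × part κ r ≡ 0))))
theorem2p4p2p4 ℓ i 2≤ℓ _ l μ r κ D (_ , persistent) = part1 , part2
  where
  open Beads.Theorem {ℓ} {i} 2≤ℓ D persistent using (part1; part2)
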